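{- For every real number $\epsilon \in (0,1)$ there exists a constant $c_\epsilon > 0$ (depending only on $\epsilon$) such that for every integer $n \ge 2$ and every integer $m \in \left[n, 2^{n^{1-\epsilon}}\right]$ there exists a matrix $A \in \{0,1\}^{m\times n}$ with $$\frac{\mathrm{herdisc}(A)}{\mathrm{detlb}(A)} \ge c_\epsilon \sqrt{\log m \,\log n}.$$
   Context: For a real $m\times n$ matrix $A$, the discrepancy is $\mathrm{disc}(A) = \min_{x\in\{\pm1\}^n}\|Ax\|_\infty$. The hereditary discrepancy $\mathrm{herdisc}(A)$ is the maximum of $\mathrm{disc}(B)$ over all submatrices $B$ of $A$ (equivalently, over all submatrices consisting of a nonempty subset of the columns of $A$). The determinant lower bound is $\mathrm{detlb}(A) = \max_{k}\max_{B}|\det(B)|^{1/k}$, where $k$ ranges over $1\le k\le \min(m,n)$ and $B$ over all $k\times k$ submatrices of $A$ (any $k$ rows and any $k$ columns). -}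

module Defs where

open import Data.Nat.Base as ℕ using (ℕ; zero; suc)
import Data.Nat.Properties as ℕ
open import Data.Nat.Coprimality as Coprime using (1-coprimeTo)
open import Data.Integer.Base as ℤ using (ℤ; +_; 0ℤ; 1ℤ; -1ℤ)
import Data.Integer.Properties as ℤ
open import Data.Rational.Base as ℚ using (ℚ; 0ℚ; 1ℚ; ↥_; ↧_; ↧ₙ_; *≤*)
import Data.Rational.Properties as ℚ
open import Data.Fin.Base using (Fin; zero; suc; toℕ; punchIn)
open import Data.List.Base using (List; []; _∷_; _++_; map; concatMap; foldr; upTo; allFin)
open import Data.List.Extrema.Nat using (max)
open import Data.Vec.Base as Vec using (Vec; []; _∷_; lookup)
open import Data.Product.Base using (_×_; _,_; ∃; ∃-syntax; Σ-syntax; proj₁; proj₂)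
open import Data.Sum.Base using (_⊎_; inj₁; inj₂)
open import Level using (0ℓ)
open import Relation.Unary using (Pred; _∪_; _∈_; _∉_)
open import Relation.Nullary using (¬_; yes; no)
open import Relation.Binary.PropositionalEquality using (_≡_; refl; sym; subst; cong)
open import Algebra.Bundles using (CommutativeRing)
open import Algebra.Properties.Semiring.Exp
  (CommutativeRing.semiring ℚ.+-*-commutativeRing) as ℚ^ using (_^_)
open import Algebra.Properties.CommutativeMonoid.Sum ℤ.+-0-commutativeMonoid
  using (sum)

------------------------------------------------------------------------
-- Real numbers as Dedekind cuts: x is represented by { q ∈ ℚ : q < x },
-- an inhabited, bounded above, downward closed set without a maximum.

record ℝ : Set₁ where
  field
    Cut       : Pred ℚ 0ℓ
    inhabited : ∃[ q ] q ∈ Cut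
    bounded   : ∃[ b ] (∀ {q} → q ∈ Cut → q ℚ.≤ b)
    closed    : ∀ {p q} → p ℚ.< q → q ∈ Cut → p ∈ Cut
    rounded   : ∀ {p} → p ∈ Cut → ∃[ q ] (p ℚ.< q × q ∈ Cut)

open ℝ public

-- Both orders are the usual ones; strictness is witnessed by a rational
-- q with x ≤ q < y.
infix 4 _≤ᴿ_ _<ᴿ_

_≤ᴿ_ : ℝ → ℝ → Set
x ≤ᴿ y = ∀ {q} → q ∈ Cut x → q ∈ Cut y

_<ᴿ_ : ℝ → ℝ → Set
x <ᴿ y = ∃[ q ] (q ∉ Cut x × q ∈ Cut y)

-- The least upper bound of a set of rationals.  Every operation below is
-- the supremum of the values of the operation at suitable rationals.

sup : (P : Pred ℚ 0ℓ) → ∃[ q ] q ∈ P → ∃[ b ] (∀ {q} → q ∈ P → q ℚ.≤ b) → ℝ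
sup P (q₀ , q₀∈P) (b , P≤b) = record
  { Cut       = λ p → ∃[ q ] (p ℚ.< q × q ∈ P)
  ; inhabited = q₀ ℚ.- 1ℚ , q₀ , p-1<p , q₀∈P
  ; bounded   = b , λ (q , p<q , q∈P) → ℚ.≤-trans (ℚ.<⇒≤ p<q) (P≤b q∈P)
  ; closed    = λ p<q (r , q<r , r∈P) → r , ℚ.<-trans p<q q<r , r∈P
  ; rounded   = λ (q , p<q , q∈P) → let (r , p<r , r<q) = ℚ.<-dense p<q in
                r , p<r , q , r<q , q∈P
  }
  where
  p-1<p : q₀ ℚ.- 1ℚ ℚ.< q₀
  p-1<p = subst (q₀ ℚ.- 1ℚ ℚ.<_) (ℚ.+-identityʳ q₀)
            (ℚ.+-monoʳ-< q₀ {ℚ.- 1ℚ} {0ℚ} (ℚ.*<* ℤ.-<+))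

module Lemmas where
  <⇒≱ : ∀ {p q} → p ℚ.< q → ¬ (q ℚ.≤ p)
  <⇒≱ p<q q≤p = ℚ.<-irrefl refl (ℚ.<-≤-trans p<q q≤p)

  ∉⇒≤ : ∀ x {q r} → q ∈ Cut x → r ∉ Cut x → q ℚ.≤ r
  ∉⇒≤ x q∈x r∉x = ℚ.≮⇒≥ (λ r<q → r∉x (closed x r<q q∈x))

  upper : ∀ x → ∃[ r ] r ∉ Cut x
  upper x = let (b , x≤b) = bounded x in
    b , λ b∈x → let (q , b<q , q∈x) = rounded x b∈x in
      <⇒≱ b<q (x≤b q∈x)

  *-mono-≤ : ∀ {p q r s} → 0ℚ ℚ.≤ p → 0ℚ ℚ.≤ s → p ℚ.≤ q → r ℚ.≤ s → p ℚ.* r ℚ.≤ q ℚ.* s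
  *-mono-≤ {p} {q} {r} {s} 0≤p 0≤s p≤q r≤s = ℚ.≤-trans
    (ℚ.*-monoˡ-≤-nonNeg p {{ℚ.nonNegative 0≤p}} r≤s)
    (ℚ.*-monoʳ-≤-nonNeg s {{ℚ.nonNegative 0≤s}} p≤q)

  0≤1 : 0ℚ ℚ.≤ 1ℚ
  0≤1 = *≤* (ℤ.+≤+ ℕ.z≤n)

  1≤p^k : ∀ {p} k → 1ℚ ℚ.≤ p → 1ℚ ℚ.≤ p ^ k
  1≤p^k     zero    1≤p = ℚ.≤-refl
  1≤p^k {p} (suc k) 1≤p = subst (ℚ._≤ p ℚ.* p ^ k) (ℚ.*-identityʳ 1ℚ)
    (*-mono-≤ 0≤1 (ℚ.≤-trans 0≤1 (1≤p^k k 1≤p)) 1≤p (1≤p^k k 1≤p))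

  0≤p^k : ∀ {p} k → 0ℚ ℚ.≤ p → 0ℚ ℚ.≤ p ^ k
  0≤p^k     zero    0≤p = 0≤1
  0≤p^k {p} (suc k) 0≤p = subst (ℚ._≤ p ℚ.* p ^ k) (ℚ.*-zeroʳ p)
    (ℚ.*-monoˡ-≤-nonNeg p {{ℚ.nonNegative 0≤p}} (0≤p^k k 0≤p))

  p≤p^k : ∀ {p} k .{{_ : ℕ.NonZero k}} → 1ℚ ℚ.≤ p → p ℚ.≤ p ^ k
  p≤p^k {p} (suc k) 1≤p = subst (ℚ._≤ p ℚ.* p ^ k) (ℚ.*-identityʳ p)
    (ℚ.*-monoˡ-≤-nonNeg p {{ℚ.nonNegative (ℚ.≤-trans 0≤1 1≤p)}} (1≤p^k k 1≤p))

  ^-monoˡ-≤ : ∀ {p q} k → 0ℚ ℚ.≤ p → p ℚ.≤ q → p ^ k ℚ.≤ q ^ k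
  ^-monoˡ-≤ zero    0≤p p≤q = ℚ.≤-refl
  ^-monoˡ-≤ (suc k) 0≤p p≤q =
    *-mono-≤ 0≤p (0≤p^k k (ℚ.≤-trans 0≤p p≤q)) p≤q (^-monoˡ-≤ k 0≤p p≤q)

  ^-monoˡ-< : ∀ {p q} k .{{_ : ℕ.NonZero k}} → 0ℚ ℚ.≤ p → p ℚ.< q → p ^ k ℚ.< q ^ k
  ^-monoˡ-< {p} {q} (suc k) 0≤p p<q = ℚ.≤-<-trans
    (ℚ.*-monoˡ-≤-nonNeg p {{ℚ.nonNegative 0≤p}} (^-monoˡ-≤ k 0≤p (ℚ.<⇒≤ p<q)))
    (ℚ.*-monoˡ-<-pos (q ^ k) {{ℚ.positive (0<q^ k)}} p<q)
    where
    0<q : 0ℚ ℚ.< q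
    0<q = ℚ.≤-<-trans 0≤p p<q
    0<q^ : ∀ j → 0ℚ ℚ.< q ^ j
    0<q^ zero    = ℚ.*<* (ℤ.+<+ (ℕ.s≤s ℕ.z≤n))
    0<q^ (suc j) = subst (ℚ._< q ℚ.* q ^ j) (ℚ.*-zeroˡ (q ^ j))
      (ℚ.*-monoˡ-<-pos (q ^ j) {{ℚ.positive (0<q^ j)}} 0<q)

  ^-monoʳ-≤ : ∀ {p} {j k} → 1ℚ ℚ.≤ p → j ℕ.≤ k → p ^ j ℚ.≤ p ^ k
  ^-monoʳ-≤ {k = k} 1≤p ℕ.z≤n       = 1≤p^k k 1≤p
  ^-monoʳ-≤ {p}     1≤p (ℕ.s≤s j≤k) =
    ℚ.*-monoˡ-≤-nonNeg p {{ℚ.nonNegative (ℚ.≤-trans 0≤1 1≤p)}} (^-monoʳ-≤ 1≤p j≤k)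

  n/1 : ∀ n → (+ n) ℚ./ 1 ≡ ℚ.mkℚ (+ n) 0 (Coprime.sym (1-coprimeTo n))
  n/1 n = ℚ.normalize-coprime (Coprime.sym (1-coprimeTo n))

  ∣↥∣-bound : ∀ s N → s ℚ.≤ (+ N) ℚ./ 1 → 0ℚ ℚ.≤ s → ℤ.∣ ↥ s ∣ ℕ.≤ N ℕ.* ↧ₙ s
  ∣↥∣-bound s N s≤N 0≤s = ℤ.drop‿+≤+ (begin
    + ℤ.∣ ↥ s ∣          ≡⟨ ℤ.0≤i⇒+∣i∣≡i 0≤↥s ⟩
    ↥ s                  ≡⟨ ℤ.*-identityʳ (↥ s) ⟨
    ↥ s ℤ.* 1ℤ           ≤⟨ ℚ.drop-*≤* (subst (s ℚ.≤_) (n/1 N) s≤N) ⟩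
    + N ℤ.* ↧ s          ≡⟨ ℤ.pos-* N (↧ₙ s) ⟨
    + (N ℕ.* ↧ₙ s)       ∎)
    where
    open ℤ.≤-Reasoning
    0≤↥s : 0ℤ ℤ.≤ ↥ s
    0≤↥s = subst (0ℤ ℤ.≤_) (ℤ.*-identityʳ (↥ s)) (ℚ.drop-*≤* 0≤s)

  archimedes : ∀ q → ∃[ N ] q ℚ.≤ (+ N) ℚ./ 1
  archimedes q = ℤ.∣ ↥ q ∣ , subst (q ℚ.≤_) (sym (n/1 ℤ.∣ ↥ q ∣)) (*≤* (begin
    ↥ q ℤ.* 1ℤ                    ≡⟨ ℤ.*-identityʳ (↥ q) ⟩
    ↥ q                           ≤⟨ i≤∣i∣ (↥ q) ⟩
    + ℤ.∣ ↥ q ∣                   ≤⟨ ℤ.+≤+ (ℕ.m≤m*n ℤ.∣ ↥ q ∣ (↧ₙ q)) ⟩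
    + (ℤ.∣ ↥ q ∣ ℕ.* ↧ₙ q)        ≡⟨ ℤ.pos-* ℤ.∣ ↥ q ∣ (↧ₙ q) ⟩
    + ℤ.∣ ↥ q ∣ ℤ.* ↧ q           ∎))
    where
    open ℤ.≤-Reasoning
    i≤∣i∣ : ∀ i → i ℤ.≤ + ℤ.∣ i ∣
    i≤∣i∣ (+ _)      = ℤ.≤-refl
    i≤∣i∣ ℤ.-[1+ _ ] = ℤ.-≤+

open Lemmas

fromℚ : ℚ → ℝ
fromℚ q = sup (_≡ q) (q , refl) (q , λ { refl → ℚ.≤-refl })

fromℕ : ℕ → ℝ
fromℕ n = fromℚ ((+ n) ℚ./ 1)

0ℝ 1ℝ : ℝ
0ℝ = fromℕ 0
1ℝ = fromℕ 1

infixl 6 _-ᴿ_ _⊔ᴿ_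
infixl 7 _*ᴿ_ _/ᴿ_
infixr 8 _^ᴿ_

_-ᴿ_ : ℝ → ℝ → ℝ
x -ᴿ y = sup
  (λ p → ∃[ a ] ∃[ r ] (a ∈ Cut x × r ∉ Cut y × p ≡ a ℚ.- r))
  (let (a , a∈x) = inhabited x ; (r , r∉y) = upper y in _ , a , r , a∈x , r∉y , refl)
  (let (b , x≤b) = bounded x ; (q , q∈y) = inhabited y in
   b ℚ.- q , λ { (a , r , a∈x , r∉y , refl) →
     ℚ.+-mono-≤ (x≤b a∈x) (ℚ.neg-antimono-≤ (∉⇒≤ y q∈y r∉y)) })

_⊔ᴿ_ : ℝ → ℝ → ℝ
x ⊔ᴿ y = sup
  (Cut x ∪ Cut y)
  (let (q , q∈x) = inhabited x in q , inj₁ q∈x)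
  (let (b , x≤b) = bounded x ; (c , y≤c) = bounded y in
   b ℚ.⊔ c , λ { (inj₁ q∈x) → ℚ.≤-trans (x≤b q∈x) (ℚ.p≤p⊔q b c)
               ; (inj₂ q∈y) → ℚ.≤-trans (y≤c q∈y) (ℚ.p≤q⊔p b c) })

-- Products, quotients, roots and powers are the usual ones for nonnegative
-- arguments (and, in a power, base at least 1), the only ones that occur here.
-- The alternatives p ≡ 0ℚ and p ≡ 1ℚ cover arguments equal to 0, whose cuts
-- contain no nonnegative rational.

_*ᴿ_ : ℝ → ℝ → ℝ
x *ᴿ y = sup
  (λ p → p ≡ 0ℚ ⊎ ∃[ a ] ∃[ b ] (a ∈ Cut x × b ∈ Cut y × 0ℚ ℚ.≤ a × 0ℚ ℚ.≤ b × p ≡ a ℚ.* b))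
  (0ℚ , inj₁ refl)
  (let (c , x≤c) = bounded x ; (d , y≤d) = bounded y in
   0ℚ ℚ.⊔ c ℚ.* d , λ
   { (inj₁ refl) → ℚ.p≤p⊔q 0ℚ (c ℚ.* d)
   ; (inj₂ (a , b , a∈x , b∈y , 0≤a , 0≤b , refl)) →
       ℚ.≤-trans (*-mono-≤ 0≤a (ℚ.≤-trans 0≤b (y≤d b∈y)) (x≤c a∈x) (y≤d b∈y))
                 (ℚ.p≤q⊔p 0ℚ (c ℚ.* d)) })

-- For r > 0, the condition p * r ≤ a says p ≤ a / r.
_/ᴿ_ : ℝ → (y : ℝ) → 0ℝ <ᴿ y → ℝ
(x /ᴿ y) 0<y = sup
  (λ p → p ≡ 0ℚ ⊎ ∃[ a ] ∃[ r ] (a ∈ Cut x × r ∉ Cut y × p ℚ.* r ℚ.≤ a))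
  (0ℚ , inj₁ refl)
  (let (b , x≤b) = bounded x in bound b , λ
   { (inj₁ refl) → ℚ.p≤p⊔q 0ℚ (b ℚ.* ℚ.1/ q)
   ; (inj₂ (a , r , a∈x , r∉y , pr≤a)) → upperBound b (∉⇒≤ y q∈y r∉y) (ℚ.≤-trans pr≤a (x≤b a∈x)) })
  where
  q : ℚ
  q = proj₁ (rounded y (proj₂ (proj₂ 0<y)))
  q∈y : q ∈ Cut y
  q∈y = proj₂ (proj₂ (rounded y (proj₂ (proj₂ 0<y))))
  0<q : 0ℚ ℚ.< q
  0<q = ℚ.≤-<-trans (ℚ.≮⇒≥ (λ r<0 → proj₁ (proj₂ 0<y) (0ℚ , r<0 , refl)))
                    (proj₁ (proj₂ (rounded y (proj₂ (proj₂ 0<y)))))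
  instance
    q-pos : ℚ.Positive q
    q-pos = ℚ.positive 0<q
    q-nonZero : ℚ.NonZero q
    q-nonZero = ℚ.pos⇒nonZero q
    q⁻¹-nonNeg : ℚ.NonNegative (ℚ.1/ q)
    q⁻¹-nonNeg = ℚ.pos⇒nonNeg (ℚ.1/ q) {{ℚ.1/pos⇒pos q}}
  bound : ℚ → ℚ
  bound b = 0ℚ ℚ.⊔ b ℚ.* ℚ.1/ q
  upperBound : ∀ b {p r} → q ℚ.≤ r → p ℚ.* r ℚ.≤ b → p ℚ.≤ bound b
  upperBound b {p} {r} q≤r pr≤b with p ℚ.≤? 0ℚ
  ... | yes p≤0 = ℚ.≤-trans p≤0 (ℚ.p≤p⊔q 0ℚ (b ℚ.* ℚ.1/ q))
  ... | no  p≰0 = ℚ.≤-trans (begin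
    p                          ≡⟨ ℚ.*-identityʳ p ⟨
    p ℚ.* 1ℚ                   ≡⟨ cong (p ℚ.*_) (ℚ.*-inverseʳ q) ⟨
    p ℚ.* (q ℚ.* ℚ.1/ q)       ≡⟨ ℚ.*-assoc p q (ℚ.1/ q) ⟨
    p ℚ.* q ℚ.* ℚ.1/ q         ≤⟨ ℚ.*-monoʳ-≤-nonNeg (ℚ.1/ q) (ℚ.≤-trans
                                    (ℚ.*-monoˡ-≤-nonNeg p {{ℚ.nonNegative (ℚ.<⇒≤ (ℚ.≰⇒> p≰0))}} q≤r) pr≤b) ⟩
    b ℚ.* ℚ.1/ q               ∎) (ℚ.p≤q⊔p 0ℚ (b ℚ.* ℚ.1/ q))
    where open ℚ.≤-Reasoning

root : (k : ℕ) .{{_ : ℕ.NonZero k}} → ℝ → ℝ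
root k x = sup
  (λ p → p ≡ 0ℚ ⊎ (0ℚ ℚ.≤ p × p ^ k ∈ Cut x))
  (0ℚ , inj₁ refl)
  (let (b , x≤b) = bounded x in 1ℚ ℚ.⊔ b , λ
   { (inj₁ refl) → ℚ.≤-trans 0≤1 (ℚ.p≤p⊔q 1ℚ b)
   ; {p} (inj₂ (_ , p^k∈x)) → upperBound b p (x≤b p^k∈x) })
  where
  upperBound : ∀ b p → p ^ k ℚ.≤ b → p ℚ.≤ 1ℚ ℚ.⊔ b
  upperBound b p p^k≤b with ℚ.≤-total p 1ℚ
  ... | inj₁ p≤1 = ℚ.≤-trans p≤1 (ℚ.p≤p⊔q 1ℚ b)
  ... | inj₂ 1≤p = ℚ.≤-trans (ℚ.≤-trans (p≤p^k k 1≤p) p^k≤b) (ℚ.p≤q⊔p 1ℚ b)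

√ : ℝ → ℝ
√ = root 2

-- For s = c / d ≥ 0 and p ≥ 0, the condition p ^ d ≤ b ^ c says p ≤ b ^ s.
_^ᴿ_ : ℕ → ℝ → ℝ
b ^ᴿ x = sup
  (λ p → p ≡ 1ℚ ⊎ ∃[ s ] (s ∈ Cut x × 0ℚ ℚ.≤ s × 0ℚ ℚ.≤ p × p ^ (↧ₙ s) ℚ.≤ ((+ b) ℚ./ 1) ^ ℤ.∣ ↥ s ∣))
  (1ℚ , inj₁ refl)
  (let (c , x≤c) = bounded x ; (N , c≤N) = archimedes c in β ^ N , λ
   { (inj₁ refl) → 1≤p^k N 1≤β
   ; (inj₂ (s , s∈x , 0≤s , 0≤p , p^d≤b^c)) →
       upperBound s N 0≤s (ℚ.≤-trans (x≤c s∈x) c≤N) p^d≤b^c })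
  where
  β : ℚ
  β = 1ℚ ℚ.+ (+ b) ℚ./ 1
  0≤b : 0ℚ ℚ.≤ (+ b) ℚ./ 1
  0≤b = ℚ.nonNegative⁻¹ _ {{ℚ.normalize-nonNeg b 1}}
  b≤β : (+ b) ℚ./ 1 ℚ.≤ β
  b≤β = subst (ℚ._≤ β) (ℚ.+-identityˡ _) (ℚ.+-monoˡ-≤ ((+ b) ℚ./ 1) 0≤1)
  1≤β : 1ℚ ℚ.≤ β
  1≤β = subst (ℚ._≤ β) (ℚ.+-identityʳ 1ℚ) (ℚ.+-monoʳ-≤ 1ℚ 0≤b)
  upperBound : ∀ s N {p} → 0ℚ ℚ.≤ s → s ℚ.≤ (+ N) ℚ./ 1 →
               p ^ (↧ₙ s) ℚ.≤ ((+ b) ℚ./ 1) ^ ℤ.∣ ↥ s ∣ → p ℚ.≤ β ^ N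
  upperBound s@record{} N {p} 0≤s s≤N p^d≤b^c = ℚ.≮⇒≥ λ β^N<p →
    <⇒≱ (^-monoˡ-< (↧ₙ s) (ℚ.≤-trans 0≤1 (1≤p^k N 1≤β)) β^N<p) (begin
      p ^ (↧ₙ s)                       ≤⟨ p^d≤b^c ⟩
      ((+ b) ℚ./ 1) ^ ℤ.∣ ↥ s ∣        ≤⟨ ^-monoˡ-≤ ℤ.∣ ↥ s ∣ 0≤b b≤β ⟩
      β ^ ℤ.∣ ↥ s ∣                    ≤⟨ ^-monoʳ-≤ 1≤β (∣↥∣-bound s N s≤N 0≤s) ⟩
      β ^ (N ℕ.* ↧ₙ s)                 ≡⟨ ℚ^.^-assocʳ β N (↧ₙ s) ⟨
      (β ^ N) ^ (↧ₙ s)                 ∎)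
    where open ℚ.≤-Reasoning

-- For s = c / d ≥ 0, the condition 2 ^ c ≤ n ^ d says s ≤ log₂ n; the
-- alternative s ≡ 0ℚ only serves to make log₂ 0 well defined.
log₂ : ℕ → ℝ
log₂ n = sup
  (λ s → s ≡ 0ℚ ⊎ (0ℚ ℚ.≤ s × 2 ℕ.^ ℤ.∣ ↥ s ∣ ℕ.≤ n ℕ.^ (↧ₙ s)))
  (0ℚ , inj₁ refl)
  ((+ n) ℚ./ 1 , λ
   { (inj₁ refl) → ℚ.nonNegative⁻¹ _ {{ℚ.normalize-nonNeg n 1}}
   ; {s} (inj₂ (0≤s , 2^c≤n^d)) → upperBound s 0≤s 2^c≤n^d })
  where
  n≤2^n : ∀ n → n ℕ.≤ 2 ℕ.^ n
  n≤2^n zero    = ℕ.z≤n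
  n≤2^n (suc n) = ℕ.+-mono-≤ (ℕ.m^n>0 2 n) (ℕ.≤-trans (n≤2^n n) (ℕ.m≤m+n (2 ℕ.^ n) 0))
  upperBound : ∀ s → 0ℚ ℚ.≤ s → 2 ℕ.^ ℤ.∣ ↥ s ∣ ℕ.≤ n ℕ.^ (↧ₙ s) → s ℚ.≤ (+ n) ℚ./ 1
  upperBound s 0≤s 2^c≤n^d = subst (s ℚ.≤_) (sym (n/1 n)) (*≤* (begin
    ↥ s ℤ.* 1ℤ          ≡⟨ ℤ.*-identityʳ (↥ s) ⟩
    ↥ s                 ≡⟨ ℤ.0≤i⇒+∣i∣≡i (subst (0ℤ ℤ.≤_) (ℤ.*-identityʳ (↥ s)) (ℚ.drop-*≤* 0≤s)) ⟨
    + ℤ.∣ ↥ s ∣         ≤⟨ ℤ.+≤+ (ℕ.≮⇒≥ (λ nd<c → ℕ.<⇒≱ (ℕ.^-monoʳ-< 2 (ℕ.s≤s (ℕ.s≤s ℕ.z≤n)) nd<c) 2^c≤2^nd)) ⟩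
    + (n ℕ.* ↧ₙ s)      ≡⟨ ℤ.pos-* n (↧ₙ s) ⟩
    + n ℤ.* ↧ s         ∎))
    where
    open ℤ.≤-Reasoning
    2^c≤2^nd : 2 ℕ.^ ℤ.∣ ↥ s ∣ ℕ.≤ 2 ℕ.^ (n ℕ.* ↧ₙ s)
    2^c≤2^nd = ℕ.≤-trans 2^c≤n^d (subst (n ℕ.^ (↧ₙ s) ℕ.≤_) (ℕ.^-*-assoc 2 n (↧ₙ s))
      (ℕ.^-monoˡ-≤ (↧ₙ s) (n≤2^n n)))

------------------------------------------------------------------------
-- Discrepancy and the determinant lower bound.  The entries are integers,
-- so that discrepancies are natural numbers and determinants integers.

Matrix : ℕ → ℕ → Set
Matrix m n = Fin m → Fin n → ℤ

Is01 : ∀ {m n} → Matrix m n → Set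
Is01 A = ∀ i j → A i j ≡ 0ℤ ⊎ A i j ≡ 1ℤ

-- The k-element subsets of Fin n, each as its increasing list of elements.
choose : (k n : ℕ) → List (Vec (Fin n) k)
choose zero    n       = [] ∷ []
choose (suc k) zero    = []
choose (suc k) (suc n) =
  map (λ v → zero ∷ Vec.map suc v) (choose k n) ++ map (Vec.map suc) (choose (suc k) n)

submatrix : ∀ {m n k l} → Matrix m n → Vec (Fin m) k → Vec (Fin n) l → Matrix k l
submatrix A rows cols i j = A (lookup rows i) (lookup cols j)

oneTo : ℕ → List ℕ
oneTo n = map suc (upTo n)

‖_·_‖∞ : ∀ {m n} → Matrix m n → Vec ℤ n → ℕ
‖_·_‖∞ {m} A x = max 0 (map (λ i → ℤ.∣ sum (λ j → A i j ℤ.* lookup x j) ∣) (allFin m))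

-- min± f is the minimum of f over {±1}ⁿ.
min± : ∀ {n} → (Vec ℤ n → ℕ) → ℕ
min± {zero}  f = f []
min± {suc n} f = min± (λ x → f (1ℤ ∷ x)) ℕ.⊓ min± (λ x → f (-1ℤ ∷ x))

disc : ∀ {m n} → Matrix m n → ℕ
disc A = min± (λ x → ‖ A · x ‖∞)

herdisc : ∀ {m n} → Matrix m n → ℕ
herdisc {m} {n} A =
  max 0 (concatMap (λ k → concatMap (λ l →
    concatMap (λ rows → map (λ cols → disc (submatrix A rows cols))
      (choose l n)) (choose k m)) (oneTo n)) (oneTo m))

-- Laplace expansion along the first row.
det : ∀ {n} → Matrix n n → ℤ
det {zero}  A = 1ℤ
det {suc n} A = sum (λ j → (-1ℤ ℤ.^ toℕ j) ℤ.* A zero j ℤ.* det (λ i l → A (suc i) (punchIn j l)))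

maxᴿ : List ℝ → ℝ
maxᴿ = foldr _⊔ᴿ_ 0ℝ

-- The index j ∈ {0, …, min(m,n) - 1} stands for k = j + 1.
detlb : ∀ {m n} → Matrix m n → ℝ
detlb {m} {n} A =
  maxᴿ (concatMap (λ j →
    concatMap (λ rows → map (λ cols → root (suc j) (fromℕ ℤ.∣ det (submatrix A rows cols) ∣))
      (choose (suc j) n)) (choose (suc j) m)) (upTo (m ℕ.⊓ n)))

module Submission where

-- The columns of A are pairs (v, i) of an inner node v of a complete binary tree
-- of height t² and an i < s², its rows are triples (σ, p, S) of a side, a leaf
-- and a subset S, and the entry is 1 iff p lies below the σ-child of v and i ∈ S.
--
-- Discrepancy: given signs x, the difference of the row sums of the two sides is
-- a sum over i ∈ S of walks Σ ± x(v, i) along the path p.  For a random leaf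
-- these are simple random walks of length t², so by a fourth moment argument
-- some leaf has Σᵢ |walkᵢ| ≥ s² t / 2, and a suitable side and S give a row sum of
-- order s² t.
--
-- Determinants: by linearity in the columns, a K × K minor is the sum of the 2ᴷ
-- minors in which every column is restricted to the rows of one side.  In such a
-- minor the columns with the same i are laminar, so column operations leave at
-- most s² ones in each row, and Hadamard's inequality gives |det| ≤ (3 s)ᴷ.
--
-- The ratio is of order s t; choosing s² ≈ log m and t² ≈ log n is possible since
-- (2^{t²} s²)^Q ≤ n · (log m)^Q ≤ n^Q for 1/Q < ε.  When s or t would be 0, both
-- logarithms are bounded and a matrix with a single 1 does.
open import Defs
open import Data.Nat.Base as ℕ using (ℕ; zero; suc; NonZero; z≤n; s≤s; ⌊_/2⌋)
import Data.Nat.Properties as ℕ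
import Data.Nat.Tactic.RingSolver as ℕ
open import Data.Nat.DivMod using (m/n*n≤m; m≡m%n+[m/n]*n; m%n<n)
open import Data.Integer.Base as ℤ using (ℤ; +_; 0ℤ; 1ℤ; ∣_∣; +≤+)
import Data.Integer.Properties as ℤ
open import Data.Rational.Base as ℚ using (ℚ; mkℚ; 0ℚ; 1ℚ; ½; ↥_; ↧_; ↧ₙ_; *≤*; *<*)
import Data.Rational.Properties as ℚ
import Data.Rational.Unnormalised.Properties as ℚᵘ
open import Data.Bool.Base using (Bool; true; false; _∧_; _∨_; not; if_then_else_)
import Data.Bool.Properties as Bool
open import Data.Fin.Base using (Fin; zero; suc; toℕ; fromℕ<; punchIn; splitAt; remQuot; combine; _↑ˡ_; _↑ʳ_)
import Data.Fin.Properties as Fin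
open import Data.List.Base using (List; []; _∷_; map; concatMap; upTo)
open import Data.List.Extrema.Nat using (max; xs≤max)
open import Data.List.Membership.Propositional using (find; lose) renaming (_∈_ to _∈ˡ_)
open import Data.List.Membership.Propositional.Properties
import Data.List.Relation.Unary.All as All
open import Data.List.Relation.Unary.Any as Any using (Any; here; there)
import Data.List.Relation.Unary.Any.Properties as Any
open import Data.Vec.Base as Vec using (Vec; []; _∷_; lookup; replicate)
import Data.Vec.Properties as Vec
open import Data.Product.Base using (_×_; _,_; ∃-syntax; Σ-syntax; proj₁; proj₂)
open import Data.Sum.Base as Sum using (_⊎_; inj₁; inj₂; [_,_]′)
open import Function.Base using (_∘_; id)
open import Relation.Nullary using (¬_; does; yes; no; contradiction)
open import Relation.Unary using (_∈_; _∉_)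
open import Relation.Binary.PropositionalEquality
open import Algebra.Bundles using (CommutativeRing)
open import Algebra.Properties.CommutativeMonoid.Sum ℤ.+-0-commutativeMonoid
  using (sum; sum-cong-≗; ∑-comm; ∑-distrib-+)
open import Algebra.Properties.CommutativeMonoid.Sum ℕ.*-1-commutativeMonoid
  using () renaming (sum to ∏)
open import Algebra.Properties.Semiring.Sum ℤ.+-*-semiring
  using (*-distribˡ-sum; *-distribʳ-sum)

-- The two sides pull in opposite directions. The walks need both, since only the difference of the
-- sides gives signed steps. But a full column meets both: if w lies below the left child of v, the
-- leaves of w are inside those of v on the left side and outside them on the right side, so full
-- columns are neither nested nor disjoint. Restricting every column to one side, chosen column by
-- column, restores laminarity, because columns on different sides share no row; the price is a
-- constant factor per column.
--
-- Exterior algebra handles the determinants because every step is then an induction over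
-- coordinates in ℤ: a determinant is the top coefficient of the wedge of the columns, a column
-- operation is v ∧ v = 0, the splitting into sides is linearity, and Hadamard's inequality is |v ∧
-- ω| ≤ |v| |ω|. Roots are avoided by comparing squares and powers; this is why the height and the
-- number of elements are the perfect squares t² and s². Real numbers enter only at the end, where
-- integer bounds are compared with cuts.

module ExteriorAlgebra where

  -- Exterior algebra over ℤ and the determinant as a wedge of columns

  open import Data.Integer.Base hiding (suc)
  open import Data.Integer.Tactic.RingSolver using (solve-∀)
  open ≡-Reasoning

  -- A form is the family of its coefficients in the basis e_S, S ⊆ {1, …, n}.
  Form : ℕ → Set
  Form n = Vec Bool n → ℤ

  infixr 7 _⋏_ _⌟_

  -- Let e be the first basis vector, v = v₀ e + v′ and ω = ω₀ + e ∧ ω₁, where ω₁ collects the sets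
  -- containing e. Then v ∧ ω = v′ ∧ ω₀ + e ∧ (v₀ ω₀ - v′ ∧ ω₁); the sign comes from moving v′ past
  -- e.
  _⋏_ : ∀ {n} → (Fin n → ℤ) → Form n → Form n
  (v ⋏ ω) []          = 0ℤ
  (v ⋏ ω) (false ∷ S) = ((v ∘ suc) ⋏ (ω ∘ (false ∷_))) S
  (v ⋏ ω) (true ∷ S)  = v zero * ω (false ∷ S) - ((v ∘ suc) ⋏ (ω ∘ (true ∷_))) S

  -- Contraction, with the same splitting: v ⌟ ω = v₀ ω₁ + v′ ⌟ ω₀ - e ∧ (v′ ⌟ ω₁). It is the
  -- adjoint of `_⋏_` and measures the loss in Hadamard's inequality.
  _⌟_ : ∀ {n} → (Fin n → ℤ) → Form n → Form n
  (v ⌟ ω) []          = 0ℤ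
  (v ⌟ ω) (false ∷ S) = v zero * ω (true ∷ S) + ((v ∘ suc) ⌟ (ω ∘ (false ∷_))) S
  (v ⌟ ω) (true ∷ S)  = - ((v ∘ suc) ⌟ (ω ∘ (true ∷_))) S

  ⋏-cong : ∀ {n} {u v : Fin n → ℤ} {ω η : Form n} → u ≗ v → ω ≗ η → u ⋏ ω ≗ v ⋏ η
  ⋏-cong u≗v ω≗η []          = refl
  ⋏-cong u≗v ω≗η (false ∷ S) = ⋏-cong (u≗v ∘ suc) (ω≗η ∘ (false ∷_)) S
  ⋏-cong u≗v ω≗η (true ∷ S)  = cong₂ _-_ (cong₂ _*_ (u≗v zero) (ω≗η (false ∷ S)))
                                         (⋏-cong (u≗v ∘ suc) (ω≗η ∘ (true ∷_)) S)

  ⋏-congʳ : ∀ {n} (v : Fin n → ℤ) {ω η : Form n} → ω ≗ η → v ⋏ ω ≗ v ⋏ η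
  ⋏-congʳ v = ⋏-cong (λ _ → refl)

  ⋏-congˡ : ∀ {n} {u v : Fin n → ℤ} (ω : Form n) → u ≗ v → u ⋏ ω ≗ v ⋏ ω
  ⋏-congˡ ω u≗v = ⋏-cong u≗v (λ _ → refl)

  ⋏-linearʳ : ∀ {n} (v : Fin n → ℤ) a b (ω η : Form n) →
              v ⋏ (λ S → a * ω S + b * η S) ≗ λ S → a * (v ⋏ ω) S + b * (v ⋏ η) S
  ⋏-linearʳ v a b ω η []          = sym (cong₂ _+_ (ℤ.*-zeroʳ a) (ℤ.*-zeroʳ b))
  ⋏-linearʳ v a b ω η (false ∷ S) = ⋏-linearʳ (v ∘ suc) a b (ω ∘ (false ∷_)) (η ∘ (false ∷_)) S
  ⋏-linearʳ v a b ω η (true ∷ S)  = trans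
    (cong (_-_ (v zero * (a * ω (false ∷ S) + b * η (false ∷ S))))
          (⋏-linearʳ (v ∘ suc) a b (ω ∘ (true ∷_)) (η ∘ (true ∷_)) S))
    (ring (v zero) a b (ω (false ∷ S)) (η (false ∷ S))
          (((v ∘ suc) ⋏ (ω ∘ (true ∷_))) S) (((v ∘ suc) ⋏ (η ∘ (true ∷_))) S))
    where
    ring : ∀ v a b x y x′ y′ → v * (a * x + b * y) - (a * x′ + b * y′) ≡
                               a * (v * x - x′) + b * (v * y - y′)
    ring = solve-∀

  ⋏-linearˡ : ∀ {n} a b (u v : Fin n → ℤ) (ω : Form n) →
              (λ i → a * u i + b * v i) ⋏ ω ≗ λ S → a * (u ⋏ ω) S + b * (v ⋏ ω) S
  ⋏-linearˡ a b u v ω []          = sym (cong₂ _+_ (ℤ.*-zeroʳ a) (ℤ.*-zeroʳ b))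
  ⋏-linearˡ a b u v ω (false ∷ S) = ⋏-linearˡ a b (u ∘ suc) (v ∘ suc) (ω ∘ (false ∷_)) S
  ⋏-linearˡ a b u v ω (true ∷ S)  = trans
    (cong (_-_ ((a * u zero + b * v zero) * ω (false ∷ S)))
          (⋏-linearˡ a b (u ∘ suc) (v ∘ suc) (ω ∘ (true ∷_)) S))
    (ring a b (u zero) (v zero) (ω (false ∷ S))
          (((u ∘ suc) ⋏ (ω ∘ (true ∷_))) S) (((v ∘ suc) ⋏ (ω ∘ (true ∷_))) S))
    where
    ring : ∀ a b u v x x′ y′ → (a * u + b * v) * x - (a * x′ + b * y′) ≡
                               a * (u * x - x′) + b * (v * x - y′)
    ring = solve-∀

  ⋏-zeroʳ : ∀ {n} (v : Fin n → ℤ) → v ⋏ (λ _ → 0ℤ) ≗ λ _ → 0ℤ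
  ⋏-zeroʳ v []          = refl
  ⋏-zeroʳ v (false ∷ S) = ⋏-zeroʳ (v ∘ suc) S
  ⋏-zeroʳ v (true ∷ S)  = cong₂ _-_ (ℤ.*-zeroʳ (v zero)) (⋏-zeroʳ (v ∘ suc) S)

  ⋏-zeroˡ : ∀ {n} (ω : Form n) → (λ _ → 0ℤ) ⋏ ω ≗ λ _ → 0ℤ
  ⋏-zeroˡ ω []          = refl
  ⋏-zeroˡ ω (false ∷ S) = ⋏-zeroˡ (ω ∘ (false ∷_)) S
  ⋏-zeroˡ ω (true ∷ S)  = cong₂ _-_ (ℤ.*-zeroˡ (ω (false ∷ S))) (⋏-zeroˡ (ω ∘ (true ∷_)) S)

  ⋏-sumʳ : ∀ {n K} (v : Fin n → ℤ) (e : Fin K → ℤ) (ω : Fin K → Form n) →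
           v ⋏ (λ S → sum (λ j → e j * ω j S)) ≗ λ S → sum (λ j → e j * (v ⋏ ω j) S)
  ⋏-sumʳ {K = zero}  v e ω S = ⋏-zeroʳ v S
  ⋏-sumʳ {K = suc K} v e ω S = begin
    (v ⋏ (λ S → e zero * ω zero S + sum (λ j → e (suc j) * ω (suc j) S))) S
      ≡⟨ ⋏-congʳ v (λ S → cong (_+_ (e zero * ω zero S)) (sym (ℤ.*-identityˡ _))) S ⟩
    (v ⋏ (λ S → e zero * ω zero S + 1ℤ * sum (λ j → e (suc j) * ω (suc j) S))) S
      ≡⟨ ⋏-linearʳ v (e zero) 1ℤ (ω zero) _ S ⟩
    e zero * (v ⋏ ω zero) S + 1ℤ * (v ⋏ (λ S → sum (λ j → e (suc j) * ω (suc j) S))) S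
      ≡⟨ cong (_+_ (e zero * (v ⋏ ω zero) S))
           (trans (ℤ.*-identityˡ _) (⋏-sumʳ v (e ∘ suc) (ω ∘ suc) S)) ⟩
    e zero * (v ⋏ ω zero) S + sum (λ j → e (suc j) * (v ⋏ ω (suc j)) S) ∎

  ⋏-sumˡ : ∀ {n K} (e : Fin K → ℤ) (v : Fin K → Fin n → ℤ) (ω : Form n) →
           (λ i → sum (λ j → e j * v j i)) ⋏ ω ≗ λ S → sum (λ j → e j * (v j ⋏ ω) S)
  ⋏-sumˡ {K = zero}  e v ω S = ⋏-zeroˡ ω S
  ⋏-sumˡ {K = suc K} e v ω S = begin
    ((λ i → e zero * v zero i + sum (λ j → e (suc j) * v (suc j) i)) ⋏ ω) S
      ≡⟨ ⋏-congˡ ω (λ i → cong (_+_ (e zero * v zero i)) (sym (ℤ.*-identityˡ _))) S ⟩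
    ((λ i → e zero * v zero i + 1ℤ * sum (λ j → e (suc j) * v (suc j) i)) ⋏ ω) S
      ≡⟨ ⋏-linearˡ (e zero) 1ℤ (v zero) _ ω S ⟩
    e zero * (v zero ⋏ ω) S + 1ℤ * ((λ i → sum (λ j → e (suc j) * v (suc j) i)) ⋏ ω) S
      ≡⟨ cong (_+_ (e zero * (v zero ⋏ ω) S))
           (trans (ℤ.*-identityˡ _) (⋏-sumˡ (e ∘ suc) (v ∘ suc) ω S)) ⟩
    e zero * (v zero ⋏ ω) S + sum (λ j → e (suc j) * (v (suc j) ⋏ ω) S) ∎

  -- Expanded this far, swapping u and v exchanges the first two terms up to sign and leaves the
  -- last to the induction hypothesis. The explicit scalar -1 is the shape that `⋏-linearʳ`
  -- produces.
  ⋏-true : ∀ {n} (u v : Fin (suc n) → ℤ) (ω : Form (suc n)) S →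
           (u ⋏ (v ⋏ ω)) (true ∷ S) ≡
           u zero * ((v ∘ suc) ⋏ (ω ∘ (false ∷_))) S
             - (v zero * ((u ∘ suc) ⋏ (ω ∘ (false ∷_))) S
                + -1ℤ * ((u ∘ suc) ⋏ ((v ∘ suc) ⋏ (ω ∘ (true ∷_)))) S)
  ⋏-true u v ω S = cong (_-_ (u zero * ((v ∘ suc) ⋏ (ω ∘ (false ∷_))) S)) (trans
    (⋏-congʳ (u ∘ suc) (λ S → cong (_+_ (v zero * ω (false ∷ S))) (sym (ℤ.-1*i≡-i (η S)))) S)
    (⋏-linearʳ (u ∘ suc) (v zero) -1ℤ (ω ∘ (false ∷_)) η S))
    where
    η : Form _
    η = (v ∘ suc) ⋏ (ω ∘ (true ∷_))

  ⋏-anticomm : ∀ {n} (u v : Fin n → ℤ) (ω : Form n) → u ⋏ v ⋏ ω ≗ λ S → - (v ⋏ u ⋏ ω) S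
  ⋏-anticomm u v ω []          = refl
  ⋏-anticomm u v ω (false ∷ S) = ⋏-anticomm (u ∘ suc) (v ∘ suc) (ω ∘ (false ∷_)) S
  ⋏-anticomm u v ω (true ∷ S)  = begin
    (u ⋏ v ⋏ ω) (true ∷ S) ≡⟨ ⋏-true u v ω S ⟩
    u₀ * v₁ - (v₀ * u₁ + -1ℤ * uv)
      ≡⟨ cong (λ z → u₀ * v₁ - (v₀ * u₁ + -1ℤ * z))
           (⋏-anticomm (u ∘ suc) (v ∘ suc) (ω ∘ (true ∷_)) S) ⟩
    u₀ * v₁ - (v₀ * u₁ + -1ℤ * - vu) ≡⟨ ring u₀ v₀ u₁ v₁ vu ⟩
    - (v₀ * u₁ - (u₀ * v₁ + -1ℤ * vu)) ≡⟨ cong -_ (⋏-true v u ω S) ⟨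
    - (v ⋏ u ⋏ ω) (true ∷ S) ∎
    where
    u₀ = u zero
    v₀ = v zero
    u₁ = ((u ∘ suc) ⋏ (ω ∘ (false ∷_))) S
    v₁ = ((v ∘ suc) ⋏ (ω ∘ (false ∷_))) S
    uv = ((u ∘ suc) ⋏ (v ∘ suc) ⋏ (ω ∘ (true ∷_))) S
    vu = ((v ∘ suc) ⋏ (u ∘ suc) ⋏ (ω ∘ (true ∷_))) S
    ring : ∀ u₀ v₀ u₁ v₁ z → u₀ * v₁ - (v₀ * u₁ + -1ℤ * - z) ≡ - (v₀ * u₁ - (u₀ * v₁ + -1ℤ * z))
    ring = solve-∀

  ⋏-self : ∀ {n} (v : Fin n → ℤ) (ω : Form n) → v ⋏ v ⋏ ω ≗ λ _ → 0ℤ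
  ⋏-self v ω []          = refl
  ⋏-self v ω (false ∷ S) = ⋏-self (v ∘ suc) (ω ∘ (false ∷_)) S
  ⋏-self v ω (true ∷ S)  = begin
    (v ⋏ v ⋏ ω) (true ∷ S) ≡⟨ ⋏-true v v ω S ⟩
    a - (a + -1ℤ * ((v ∘ suc) ⋏ (v ∘ suc) ⋏ (ω ∘ (true ∷_))) S)
      ≡⟨ cong (λ z → a - (a + -1ℤ * z)) (⋏-self (v ∘ suc) (ω ∘ (true ∷_)) S) ⟩
    a - (a + -1ℤ * 0ℤ) ≡⟨ ring a ⟩
    0ℤ ∎
    where
    a = v zero * ((v ∘ suc) ⋏ (ω ∘ (false ∷_))) S
    ring : ∀ a → a - (a + -1ℤ * 0ℤ) ≡ 0ℤ
    ring = solve-∀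

  one : ∀ {n} → Form n
  one []          = 1ℤ
  one (false ∷ S) = one S
  one (true ∷ S)  = 0ℤ

  -- The product of the columns, the first one outermost. Its coefficient at S is the minor on the
  -- rows in S, and 0 unless S has K elements. Matrices are rectangular because the induction
  -- removes columns while the rows stay.
  wedge : ∀ {n K} → Matrix n K → Form n
  wedge {K = zero}  M = one
  wedge {K = suc K} M = (λ i → M i zero) ⋏ wedge (λ i j → M i (suc j))

  wedge-false : ∀ {n K} (M : Matrix (suc n) K) → wedge M ∘ (false ∷_) ≗ wedge (M ∘ suc)
  wedge-false {K = zero}  M S = refl
  wedge-false {K = suc K} M S = ⋏-congʳ (λ i → M (suc i) zero) (wedge-false (λ i j → M i (suc j))) S

  -- Laplace expansion along the first row. It is needed at every S, not just the full set, because
  -- the induction uses it under a wedge with the first column. The minus sign in `_⋏_` shifts the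
  -- alternating signs by one place.
  wedge-true : ∀ {n K} (M : Matrix (suc n) (suc K)) S →
    wedge M (true ∷ S) ≡
    sum (λ j → (-1ℤ ^ toℕ j) * M zero j * wedge (λ i l → M (suc i) (punchIn j l)) S)
  wedge-true {K = zero}  M S = begin
    M zero zero * one S - ((λ i → M (suc i) zero) ⋏ (λ _ → 0ℤ)) S
      ≡⟨ cong (_-_ (M zero zero * one S)) (⋏-zeroʳ (λ i → M (suc i) zero) S) ⟩
    M zero zero * one S - 0ℤ
      ≡⟨ ring (M zero zero) (one S) ⟩
    1ℤ * M zero zero * one S + 0ℤ ∎
    where
    ring : ∀ x y → x * y - 0ℤ ≡ 1ℤ * x * y + 0ℤ
    ring = solve-∀
  wedge-true {K = suc K} M S = begin
    M zero zero * wedge M⁺ (false ∷ S) - (c ⋏ (wedge M⁺ ∘ (true ∷_))) S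
      ≡⟨ cong₂ _-_ (cong (M zero zero *_) (wedge-false M⁺ S)) (⋏-congʳ c (wedge-true M⁺) S) ⟩
    M zero zero * wedge (M⁺ ∘ suc) S - (c ⋏ (λ S → sum (λ j → e j * ω j S))) S
      ≡⟨ cong₂ _+_ (cong (_* wedge (M⁺ ∘ suc) S) (sym (ℤ.*-identityˡ (M zero zero))))
           (cong -_ (⋏-sumʳ c e ω S)) ⟩
    1ℤ * M zero zero * wedge (M⁺ ∘ suc) S - sum (λ j → e j * (c ⋏ ω j) S)
      ≡⟨ cong (_+_ (1ℤ * M zero zero * wedge (M⁺ ∘ suc) S))
           (neg-sum (λ j → -1ℤ ^ toℕ j) (λ j → M zero (suc j)) (λ j → (c ⋏ ω j) S)) ⟩
    1ℤ * M zero zero * wedge (M⁺ ∘ suc) S +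
      sum (λ j → -1ℤ * (-1ℤ ^ toℕ j) * M zero (suc j) * (c ⋏ ω j) S) ∎
    where
    M⁺ : Matrix _ _
    M⁺ i j = M i (suc j)
    c : Fin _ → ℤ
    c i = M (suc i) zero
    e : Fin _ → ℤ
    e j = (-1ℤ ^ toℕ j) * M zero (suc j)
    ω : Fin _ → Form _
    ω j = wedge (λ i l → M (suc i) (suc (punchIn j l)))
    neg-sum : ∀ {k} (s m w : Fin k → ℤ) →
              - sum (λ j → s j * m j * w j) ≡ sum (λ j → -1ℤ * s j * m j * w j)
    neg-sum {zero}  s m w = refl
    neg-sum {suc k} s m w = trans
      (ℤ.neg-distrib-+ (s zero * m zero * w zero) _)
      (cong₂ _+_ (ring (s zero) (m zero) (w zero)) (neg-sum (s ∘ suc) (m ∘ suc) (w ∘ suc)))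
      where
      ring : ∀ s m w → - (s * m * w) ≡ -1ℤ * s * m * w
      ring = solve-∀

  det≡wedge : ∀ {n} (M : Matrix n n) → det M ≡ wedge M (replicate n true)
  det≡wedge {zero}  M = refl
  det≡wedge {suc n} M = trans
    (sum-cong-≗ (λ j → cong (((-1ℤ ^ toℕ j) * M zero j) *_)
      (det≡wedge (λ i l → M (suc i) (punchIn j l)))))
    (sym (wedge-true M (replicate n true)))

  -- Anticommutativity moves the extra column next to its copy, where `⋏-self` applies.
  column⋏wedge : ∀ {n K} (M : Matrix n K) l → (λ i → M i l) ⋏ wedge M ≗ λ _ → 0ℤ
  column⋏wedge M zero    S = ⋏-self (λ i → M i zero) (wedge (λ i j → M i (suc j))) S
  column⋏wedge M (suc l) S = begin
    ((λ i → M i (suc l)) ⋏ (λ i → M i zero) ⋏ ω) S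
      ≡⟨ ⋏-anticomm (λ i → M i (suc l)) (λ i → M i zero) ω S ⟩
    - ((λ i → M i zero) ⋏ (λ i → M i (suc l)) ⋏ ω) S
      ≡⟨ cong -_ (trans (⋏-congʳ (λ i → M i zero) (column⋏wedge (λ i j → M i (suc j)) l) S)
                        (⋏-zeroʳ (λ i → M i zero) S)) ⟩
    0ℤ ∎
    where ω = wedge (λ i j → M i (suc j))

  ⋏-subtract-columns : ∀ {n K} (u : Fin n → ℤ) (e : Fin K → ℤ) (M : Matrix n K) →
    (λ i → u i - sum (λ l → e l * M i l)) ⋏ wedge M ≗ u ⋏ wedge M
  ⋏-subtract-columns u e M S = begin
    ((λ i → u i - sum (λ l → e l * M i l)) ⋏ wedge M) S
      ≡⟨ ⋏-congˡ (wedge M) (λ i → ring₁ (u i) _) S ⟩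
    ((λ i → 1ℤ * u i + -1ℤ * sum (λ l → e l * M i l)) ⋏ wedge M) S
      ≡⟨ ⋏-linearˡ 1ℤ -1ℤ u (λ i → sum (λ l → e l * M i l)) (wedge M) S ⟩
    1ℤ * (u ⋏ wedge M) S + -1ℤ * ((λ i → sum (λ l → e l * M i l)) ⋏ wedge M) S
      ≡⟨ cong (λ z → 1ℤ * (u ⋏ wedge M) S + -1ℤ * z)
           (trans (⋏-sumˡ e (λ l i → M i l) (wedge M) S)
                  (sum≡0 (λ l → trans (cong (e l *_) (column⋏wedge M l S)) (ℤ.*-zeroʳ (e l))))) ⟩
    1ℤ * (u ⋏ wedge M) S + -1ℤ * 0ℤ ≡⟨ ring₂ _ ⟩
    (u ⋏ wedge M) S ∎
    where
    ring₁ : ∀ x y → x - y ≡ 1ℤ * x + -1ℤ * y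
    ring₁ = solve-∀
    ring₂ : ∀ x → 1ℤ * x + -1ℤ * 0ℤ ≡ x
    ring₂ = solve-∀
    sum≡0 : ∀ {k} {f : Fin k → ℤ} → (∀ j → f j ≡ 0ℤ) → sum f ≡ 0ℤ
    sum≡0 {zero}  f≡0 = refl
    sum≡0 {suc k} f≡0 = cong₂ _+_ (f≡0 zero) (sum≡0 (f≡0 ∘ suc))

  -- The inner product for which the basis e_S is orthonormal.
  ⟨_,_⟩ : ∀ {n} → Form n → Form n → ℤ
  ⟨_,_⟩ {zero}  ω η = ω [] * η []
  ⟨_,_⟩ {suc n} ω η = ⟨ ω ∘ (false ∷_) , η ∘ (false ∷_) ⟩ + ⟨ ω ∘ (true ∷_) , η ∘ (true ∷_) ⟩

  ⟨⟩-cong : ∀ {n} {ω ω′ η η′ : Form n} → ω ≗ ω′ → η ≗ η′ → ⟨ ω , η ⟩ ≡ ⟨ ω′ , η′ ⟩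
  ⟨⟩-cong {zero}  p q = cong₂ _*_ (p []) (q [])
  ⟨⟩-cong {suc n} p q = cong₂ _+_ (⟨⟩-cong (p ∘ (false ∷_)) (q ∘ (false ∷_)))
                                  (⟨⟩-cong (p ∘ (true ∷_)) (q ∘ (true ∷_)))

  ⟨⟩-sym : ∀ {n} (ω η : Form n) → ⟨ ω , η ⟩ ≡ ⟨ η , ω ⟩
  ⟨⟩-sym {zero}  ω η = ℤ.*-comm (ω []) (η [])
  ⟨⟩-sym {suc n} ω η = cong₂ _+_ (⟨⟩-sym (ω ∘ (false ∷_)) (η ∘ (false ∷_)))
                                 (⟨⟩-sym (ω ∘ (true ∷_)) (η ∘ (true ∷_)))

  ⟨⟩-linear : ∀ {n} a b (ω η ζ : Form n) →
              ⟨ (λ S → a * ω S + b * η S) , ζ ⟩ ≡ a * ⟨ ω , ζ ⟩ + b * ⟨ η , ζ ⟩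
  ⟨⟩-linear {zero}  a b ω η ζ = ring a b (ω []) (η []) (ζ [])
    where
    ring : ∀ a b x y z → (a * x + b * y) * z ≡ a * (x * z) + b * (y * z)
    ring = solve-∀
  ⟨⟩-linear {suc n} a b ω η ζ = trans
    (cong₂ _+_ (⟨⟩-linear a b (ω ∘ (false ∷_)) (η ∘ (false ∷_)) (ζ ∘ (false ∷_)))
               (⟨⟩-linear a b (ω ∘ (true ∷_)) (η ∘ (true ∷_)) (ζ ∘ (true ∷_))))
    (ring a b _ _ _ _)
    where
    ring : ∀ a b x y z w → a * x + b * y + (a * z + b * w) ≡ a * (x + z) + b * (y + w)
    ring = solve-∀

  ⟨⟩-square : ∀ {n} a b (ω η : Form n) →
    ⟨ (λ S → a * ω S + b * η S) , (λ S → a * ω S + b * η S) ⟩ ≡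
    a * a * ⟨ ω , ω ⟩ + + 2 * a * b * ⟨ ω , η ⟩ + b * b * ⟨ η , η ⟩
  ⟨⟩-square a b ω η = begin
    ⟨ ζ , ζ ⟩ ≡⟨ ⟨⟩-linear a b ω η ζ ⟩
    a * ⟨ ω , ζ ⟩ + b * ⟨ η , ζ ⟩ ≡⟨ cong₂ (λ x y → a * x + b * y) (flip ω) (flip η) ⟩
    a * (a * ⟨ ω , ω ⟩ + b * ⟨ η , ω ⟩) + b * (a * ⟨ ω , η ⟩ + b * ⟨ η , η ⟩)
      ≡⟨ cong (λ z → a * (a * ⟨ ω , ω ⟩ + b * z) + b * (a * ⟨ ω , η ⟩ + b * ⟨ η , η ⟩)) (⟨⟩-sym η ω) ⟩
    a * (a * ⟨ ω , ω ⟩ + b * ⟨ ω , η ⟩) + b * (a * ⟨ ω , η ⟩ + b * ⟨ η , η ⟩)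
      ≡⟨ ring a b _ _ _ ⟩
    a * a * ⟨ ω , ω ⟩ + + 2 * a * b * ⟨ ω , η ⟩ + b * b * ⟨ η , η ⟩ ∎
    where
    ζ : Form _
    ζ S = a * ω S + b * η S
    flip : ∀ θ → ⟨ θ , ζ ⟩ ≡ a * ⟨ ω , θ ⟩ + b * ⟨ η , θ ⟩
    flip θ = trans (⟨⟩-sym θ ζ) (⟨⟩-linear a b ω η θ)
    ring : ∀ a b x y z → a * (a * x + b * y) + b * (a * y + b * z) ≡ a * a * x + + 2 * a * b * y + b * b * z
    ring = solve-∀

open ExteriorAlgebra

-- Hadamard's inequality and a product bound in place of AM-GM

module Hadamard where

  open import Data.Integer.Base hiding (suc)
  open import Data.Integer.Tactic.RingSolver using (solve-∀)

  ⟨⟩-negʳ : ∀ {n} (ω η : Form n) → ⟨ ω , (λ S → - η S) ⟩ ≡ - ⟨ ω , η ⟩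
  ⟨⟩-negʳ {zero}  ω η = sym (ℤ.neg-distribʳ-* (ω []) (η []))
  ⟨⟩-negʳ {suc n} ω η = trans
    (cong₂ _+_ (⟨⟩-negʳ (ω ∘ (false ∷_)) (η ∘ (false ∷_))) (⟨⟩-negʳ (ω ∘ (true ∷_)) (η ∘ (true ∷_))))
    (sym (ℤ.neg-distrib-+ ⟨ ω ∘ (false ∷_) , η ∘ (false ∷_) ⟩ ⟨ ω ∘ (true ∷_) , η ∘ (true ∷_) ⟩))

  0≤i*i : ∀ i → 0ℤ ≤ i * i
  0≤i*i i = subst (0ℤ ≤_) (sym (i*i≡∣i∣*∣i∣ i)) (+≤+ ℕ.z≤n)
    where
    i*i≡∣i∣*∣i∣ : ∀ i → i * i ≡ + (∣ i ∣ ℕ.* ∣ i ∣)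
    i*i≡∣i∣*∣i∣ (+ n)    = sym (ℤ.pos-* n n)
    i*i≡∣i∣*∣i∣ -[1+ n ] = refl

  0≤⟨⟩ : ∀ {n} (ω : Form n) → 0ℤ ≤ ⟨ ω , ω ⟩
  0≤⟨⟩ {zero}  ω = 0≤i*i (ω [])
  0≤⟨⟩ {suc n} ω = ℤ.+-mono-≤ (0≤⟨⟩ (ω ∘ (false ∷_))) (0≤⟨⟩ (ω ∘ (true ∷_)))

  coefficient²≤⟨⟩ : ∀ {n} (ω : Form n) S → ω S * ω S ≤ ⟨ ω , ω ⟩
  coefficient²≤⟨⟩ ω []          = ℤ.≤-refl
  coefficient²≤⟨⟩ ω (false ∷ S) = subst (_≤ ⟨ ω , ω ⟩) (ℤ.+-identityʳ (ω (false ∷ S) * ω (false ∷ S)))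
    (ℤ.+-mono-≤ (coefficient²≤⟨⟩ (ω ∘ (false ∷_)) S) (0≤⟨⟩ (ω ∘ (true ∷_))))
  coefficient²≤⟨⟩ ω (true ∷ S)  = subst (_≤ ⟨ ω , ω ⟩) (ℤ.+-identityˡ (ω (true ∷ S) * ω (true ∷ S)))
    (ℤ.+-mono-≤ (0≤⟨⟩ (ω ∘ (false ∷_))) (coefficient²≤⟨⟩ (ω ∘ (true ∷_)) S))

  ⋏-⌟-adjoint : ∀ {n} (v : Fin n → ℤ) (ω η : Form n) → ⟨ v ⋏ ω , η ⟩ ≡ ⟨ ω , v ⌟ η ⟩
  ⋏-⌟-adjoint {zero}  v ω η = sym (ℤ.*-zeroʳ (ω []))
  ⋏-⌟-adjoint {suc n} v ω η = begin
    ⟨ v′ ⋏ ω₀ , η₀ ⟩ + ⟨ (λ S → a * ω₀ S - (v′ ⋏ ω₁) S) , η₁ ⟩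
      ≡⟨ cong (_+_ ⟨ v′ ⋏ ω₀ , η₀ ⟩) (trans
           (⟨⟩-cong {η = η₁} (λ S → cong (_+_ (a * ω₀ S)) (sym (ℤ.-1*i≡-i ((v′ ⋏ ω₁) S)))) (λ _ → refl))
           (⟨⟩-linear a -1ℤ ω₀ (v′ ⋏ ω₁) η₁)) ⟩
    ⟨ v′ ⋏ ω₀ , η₀ ⟩ + (a * ⟨ ω₀ , η₁ ⟩ + -1ℤ * ⟨ v′ ⋏ ω₁ , η₁ ⟩)
      ≡⟨ cong₂ (λ x y → x + (a * ⟨ ω₀ , η₁ ⟩ + -1ℤ * y)) (⋏-⌟-adjoint v′ ω₀ η₀) (⋏-⌟-adjoint v′ ω₁ η₁) ⟩
    ⟨ ω₀ , v′ ⌟ η₀ ⟩ + (a * ⟨ ω₀ , η₁ ⟩ + -1ℤ * ⟨ ω₁ , v′ ⌟ η₁ ⟩)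
      ≡⟨ ring a ⟨ ω₀ , v′ ⌟ η₀ ⟩ ⟨ ω₀ , η₁ ⟩ ⟨ ω₁ , v′ ⌟ η₁ ⟩ ⟩
    (a * ⟨ ω₀ , η₁ ⟩ + 1ℤ * ⟨ ω₀ , v′ ⌟ η₀ ⟩) + - ⟨ ω₁ , v′ ⌟ η₁ ⟩
      ≡⟨ cong₂ _+_ (sym linear) (sym (⟨⟩-negʳ ω₁ (v′ ⌟ η₁))) ⟩
    ⟨ ω₀ , (λ S → a * η₁ S + (v′ ⌟ η₀) S) ⟩ + ⟨ ω₁ , (λ S → - (v′ ⌟ η₁) S) ⟩ ∎
    where
    open ≡-Reasoning
    a = v zero
    v′ = v ∘ suc
    ω₀ = ω ∘ (false ∷_)
    ω₁ = ω ∘ (true ∷_)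
    η₀ = η ∘ (false ∷_)
    η₁ = η ∘ (true ∷_)
    linear : ⟨ ω₀ , (λ S → a * η₁ S + (v′ ⌟ η₀) S) ⟩ ≡ a * ⟨ ω₀ , η₁ ⟩ + 1ℤ * ⟨ ω₀ , v′ ⌟ η₀ ⟩
    linear = begin
      ⟨ ω₀ , (λ S → a * η₁ S + (v′ ⌟ η₀) S) ⟩
        ≡⟨ ⟨⟩-cong {ω = ω₀} (λ _ → refl) (λ S → cong (_+_ (a * η₁ S)) (sym (ℤ.*-identityˡ ((v′ ⌟ η₀) S)))) ⟩
      ⟨ ω₀ , (λ S → a * η₁ S + 1ℤ * (v′ ⌟ η₀) S) ⟩ ≡⟨ ⟨⟩-sym ω₀ _ ⟩
      ⟨ (λ S → a * η₁ S + 1ℤ * (v′ ⌟ η₀) S) , ω₀ ⟩ ≡⟨ ⟨⟩-linear a 1ℤ η₁ (v′ ⌟ η₀) ω₀ ⟩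
      a * ⟨ η₁ , ω₀ ⟩ + 1ℤ * ⟨ v′ ⌟ η₀ , ω₀ ⟩
        ≡⟨ cong₂ (λ x y → a * x + 1ℤ * y) (⟨⟩-sym η₁ ω₀) (⟨⟩-sym (v′ ⌟ η₀) ω₀) ⟩
      a * ⟨ ω₀ , η₁ ⟩ + 1ℤ * ⟨ ω₀ , v′ ⌟ η₀ ⟩ ∎
    ring : ∀ a x y z → x + (a * y + -1ℤ * z) ≡ (a * y + 1ℤ * x) + - z
    ring = solve-∀

  ∣_∣² : ∀ {n} → (Fin n → ℤ) → ℤ
  ∣ v ∣² = sum (λ i → v i * v i)

  -- This is v ⌟ (v ∧ ω) + v ∧ (v ⌟ ω) = |v|² ω, paired with ω. In the induction the cross terms -2a
  -- ⟨ω₀ , x₁⟩ and 2a ⟨ω₁ , y₀⟩ cancel by adjointness.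
  ⋏-⌟-norm : ∀ {n} (v : Fin n → ℤ) (ω : Form n) →
             ⟨ v ⋏ ω , v ⋏ ω ⟩ + ⟨ v ⌟ ω , v ⌟ ω ⟩ ≡ ∣ v ∣² * ⟨ ω , ω ⟩
  ⋏-⌟-norm {zero}  v ω = refl
  ⋏-⌟-norm {suc n} v ω = begin
    (⟨ x₀ , x₀ ⟩ + ⟨ (λ S → a * ω₀ S - x₁ S) , (λ S → a * ω₀ S - x₁ S) ⟩) +
    (⟨ (λ S → a * ω₁ S + y₀ S) , (λ S → a * ω₁ S + y₀ S) ⟩ + ⟨ (λ S → - y₁ S) , (λ S → - y₁ S) ⟩)
      ≡⟨ cong₂ (λ p q → (⟨ x₀ , x₀ ⟩ + p) + q) step₁ (cong₂ _+_ step₂ step₃) ⟩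
    (⟨ x₀ , x₀ ⟩ + (a * a * W₀ + + 2 * a * -1ℤ * ⟨ ω₀ , x₁ ⟩ + -1ℤ * -1ℤ * ⟨ x₁ , x₁ ⟩)) +
    ((a * a * W₁ + + 2 * a * 1ℤ * ⟨ ω₁ , y₀ ⟩ + 1ℤ * 1ℤ * ⟨ y₀ , y₀ ⟩) + ⟨ y₁ , y₁ ⟩)
      ≡⟨ cong (λ z → (⟨ x₀ , x₀ ⟩ + (a * a * W₀ + + 2 * a * -1ℤ * z + -1ℤ * -1ℤ * ⟨ x₁ , x₁ ⟩)) +
          ((a * a * W₁ + + 2 * a * 1ℤ * ⟨ ω₁ , y₀ ⟩ + 1ℤ * 1ℤ * ⟨ y₀ , y₀ ⟩) + ⟨ y₁ , y₁ ⟩))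
          (trans (⟨⟩-sym ω₀ x₁) (⋏-⌟-adjoint v′ ω₁ ω₀)) ⟩
    (⟨ x₀ , x₀ ⟩ + (a * a * W₀ + + 2 * a * -1ℤ * ⟨ ω₁ , y₀ ⟩ + -1ℤ * -1ℤ * ⟨ x₁ , x₁ ⟩)) +
    ((a * a * W₁ + + 2 * a * 1ℤ * ⟨ ω₁ , y₀ ⟩ + 1ℤ * 1ℤ * ⟨ y₀ , y₀ ⟩) + ⟨ y₁ , y₁ ⟩)
      ≡⟨ ring₁ a W₀ W₁ ⟨ ω₁ , y₀ ⟩ ⟨ x₀ , x₀ ⟩ ⟨ x₁ , x₁ ⟩ ⟨ y₀ , y₀ ⟩ ⟨ y₁ , y₁ ⟩ ⟩
    a * a * (W₀ + W₁) + ((⟨ x₀ , x₀ ⟩ + ⟨ y₀ , y₀ ⟩) + (⟨ x₁ , x₁ ⟩ + ⟨ y₁ , y₁ ⟩))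
      ≡⟨ cong₂ (λ p q → a * a * (W₀ + W₁) + (p + q)) (⋏-⌟-norm v′ ω₀) (⋏-⌟-norm v′ ω₁) ⟩
    a * a * (W₀ + W₁) + (∣ v′ ∣² * W₀ + ∣ v′ ∣² * W₁)
      ≡⟨ ring₂ (a * a) ∣ v′ ∣² W₀ W₁ ⟩
    (a * a + ∣ v′ ∣²) * (W₀ + W₁) ∎
    where
    open ≡-Reasoning
    a = v zero
    v′ = v ∘ suc
    ω₀ = ω ∘ (false ∷_)
    ω₁ = ω ∘ (true ∷_)
    x₀ = v′ ⋏ ω₀
    x₁ = v′ ⋏ ω₁
    y₀ = v′ ⌟ ω₀
    y₁ = v′ ⌟ ω₁
    W₀ = ⟨ ω₀ , ω₀ ⟩
    W₁ = ⟨ ω₁ , ω₁ ⟩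
    neg-linear : ∀ S → a * ω₀ S - x₁ S ≡ a * ω₀ S + -1ℤ * x₁ S
    neg-linear S = cong (_+_ (a * ω₀ S)) (sym (ℤ.-1*i≡-i (x₁ S)))
    id-linear : ∀ S → a * ω₁ S + y₀ S ≡ a * ω₁ S + 1ℤ * y₀ S
    id-linear S = cong (_+_ (a * ω₁ S)) (sym (ℤ.*-identityˡ (y₀ S)))
    step₁ = trans (⟨⟩-cong neg-linear neg-linear) (⟨⟩-square a -1ℤ ω₀ x₁)
    step₂ = trans (⟨⟩-cong id-linear id-linear) (⟨⟩-square a 1ℤ ω₁ y₀)
    step₃ : ⟨ (λ S → - y₁ S) , (λ S → - y₁ S) ⟩ ≡ ⟨ y₁ , y₁ ⟩
    step₃ = begin
      ⟨ (λ S → - y₁ S) , (λ S → - y₁ S) ⟩ ≡⟨ ⟨⟩-negʳ (λ S → - y₁ S) y₁ ⟩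
      - ⟨ (λ S → - y₁ S) , y₁ ⟩          ≡⟨ cong -_ (trans (⟨⟩-sym (λ S → - y₁ S) y₁) (⟨⟩-negʳ y₁ y₁)) ⟩
      - - ⟨ y₁ , y₁ ⟩                    ≡⟨ ℤ.neg-involutive ⟨ y₁ , y₁ ⟩ ⟩
      ⟨ y₁ , y₁ ⟩                        ∎
    ring₁ : ∀ a w₀ w₁ z x₀ x₁ y₀ y₁ →
      (x₀ + (a * a * w₀ + + 2 * a * -1ℤ * z + -1ℤ * -1ℤ * x₁)) +
      ((a * a * w₁ + + 2 * a * 1ℤ * z + 1ℤ * 1ℤ * y₀) + y₁) ≡
      a * a * (w₀ + w₁) + ((x₀ + y₀) + (x₁ + y₁))
    ring₁ = solve-∀
    ring₂ : ∀ b c w₀ w₁ → b * (w₀ + w₁) + (c * w₀ + c * w₁) ≡ (b + c) * (w₀ + w₁)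
    ring₂ = solve-∀

  ⋏-norm-≤ : ∀ {n} (v : Fin n → ℤ) (ω : Form n) → ⟨ v ⋏ ω , v ⋏ ω ⟩ ≤ ∣ v ∣² * ⟨ ω , ω ⟩
  ⋏-norm-≤ v ω = subst₂ _≤_ (ℤ.+-identityʳ ⟨ v ⋏ ω , v ⋏ ω ⟩) (⋏-⌟-norm v ω)
    (ℤ.+-monoʳ-≤ ⟨ v ⋏ ω , v ⋏ ω ⟩ (0≤⟨⟩ (v ⌟ ω)))

  ∣∣-mono-≤ : ∀ {i j} → 0ℤ ≤ i → i ≤ j → ∣ i ∣ ℕ.≤ ∣ j ∣
  ∣∣-mono-≤ (+≤+ _) (+≤+ m≤n) = m≤n

  ⟨one,one⟩≡1 : ∀ {n} → ⟨ one {n} , one ⟩ ≡ 1ℤ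
  ⟨one,one⟩≡1 {zero}  = refl
  ⟨one,one⟩≡1 {suc n} = cong₂ _+_ (⟨one,one⟩≡1 {n}) (⟨0,0⟩≡0 {n})
    where
    ⟨0,0⟩≡0 : ∀ {n} → ⟨ (λ (_ : Vec Bool n) → 0ℤ) , (λ _ → 0ℤ) ⟩ ≡ 0ℤ
    ⟨0,0⟩≡0 {zero}  = refl
    ⟨0,0⟩≡0 {suc n} = cong₂ _+_ (⟨0,0⟩≡0 {n}) (⟨0,0⟩≡0 {n})

  -- One application of |v ∧ ω| ≤ |v| |ω| per column. The left side is the sum of the squares of all
  -- maximal minors, so it controls each of them.
  hadamard : ∀ {n K} (M : Matrix n K) →
             ∣ ⟨ wedge M , wedge M ⟩ ∣ ℕ.≤ ∏ (λ j → ∣ ∣ (λ i → M i j) ∣² ∣)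
  hadamard {n} {zero}  M = ℕ.≤-reflexive (cong ∣_∣ (⟨one,one⟩≡1 {n}))
  hadamard {n} {suc K} M = begin
    ∣ ⟨ wedge M , wedge M ⟩ ∣             ≤⟨ ∣∣-mono-≤ (0≤⟨⟩ (wedge M)) (⋏-norm-≤ v ω) ⟩
    ∣ ∣ v ∣² * ⟨ ω , ω ⟩ ∣                ≡⟨ ℤ.abs-* ∣ v ∣² ⟨ ω , ω ⟩ ⟩
    ∣ ∣ v ∣² ∣ ℕ.* ∣ ⟨ ω , ω ⟩ ∣          ≤⟨ ℕ.*-monoʳ-≤ ∣ ∣ v ∣² ∣ (hadamard (λ i j → M i (suc j))) ⟩
    ∏ (λ j → ∣ ∣ (λ i → M i j) ∣² ∣)      ∎
    where
    open ℕ.≤-Reasoning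
    v : Fin n → ℤ
    v i = M i zero
    ω : Form n
    ω = wedge (λ i j → M i (suc j))

  ^-distribʳ-* : ∀ k m n → (m ℕ.* n) ℕ.^ k ≡ m ℕ.^ k ℕ.* n ℕ.^ k
  ^-distribʳ-* zero    m n = refl
  ^-distribʳ-* (suc k) m n = trans (cong (ℕ._*_ (m ℕ.* n)) (^-distribʳ-* k m n))
    (ℕ.[m*n]*[o*p]≡[m*o]*[n*p] m n (m ℕ.^ k) (n ℕ.^ k))

  0≤sum : ∀ {k} {f : Fin k → ℤ} → (∀ j → 0ℤ ≤ f j) → 0ℤ ≤ sum f
  0≤sum {zero}  0≤f = ℤ.≤-refl
  0≤sum {suc k} 0≤f = ℤ.+-mono-≤ (0≤f zero) (0≤sum (0≤f ∘ suc))

  -- The substitute for the AM–GM inequality, at the price of a factor 2.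
  a^k≤k^k*2^a : ∀ a k → .{{_ : ℕ.NonZero k}} → a ℕ.^ k ℕ.≤ k ℕ.^ k ℕ.* 2 ℕ.^ a
  a^k≤k^k*2^a a k = begin
    a ℕ.^ k                              ≤⟨ ℕ.^-monoˡ-≤ k (ℕ.<⇒≤ a<k[1+q]) ⟩
    (k ℕ.* suc q) ℕ.^ k                  ≤⟨ ℕ.^-monoˡ-≤ k (ℕ.*-monoʳ-≤ k (1+n≤2^n q)) ⟩
    (k ℕ.* 2 ℕ.^ q) ℕ.^ k                ≡⟨ ^-distribʳ-* k k (2 ℕ.^ q) ⟩
    k ℕ.^ k ℕ.* (2 ℕ.^ q) ℕ.^ k          ≡⟨ cong (ℕ._*_ (k ℕ.^ k)) (ℕ.^-*-assoc 2 q k) ⟩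
    k ℕ.^ k ℕ.* 2 ℕ.^ (q ℕ.* k)          ≤⟨ ℕ.*-monoʳ-≤ (k ℕ.^ k) (ℕ.^-monoʳ-≤ 2 (m/n*n≤m a k)) ⟩
    k ℕ.^ k ℕ.* 2 ℕ.^ a                  ∎
    where
    open ℕ.≤-Reasoning
    q = a ℕ./ k
    1+n≤2^n : ∀ n → suc n ℕ.≤ 2 ℕ.^ n
    1+n≤2^n zero    = ℕ.≤-refl
    1+n≤2^n (suc n) = ℕ.+-mono-≤ (ℕ.m^n>0 2 n) (ℕ.≤-trans (1+n≤2^n n) (ℕ.m≤m+n (2 ℕ.^ n) 0))
    a<k[1+q] : a ℕ.< k ℕ.* suc q
    a<k[1+q] = begin-strict
      a                     ≡⟨ m≡m%n+[m/n]*n a k ⟩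
      a ℕ.% k ℕ.+ q ℕ.* k     <⟨ ℕ.+-monoˡ-< (q ℕ.* k) (m%n<n a k) ⟩
      k ℕ.+ q ℕ.* k         ≡⟨ ℕ.*-comm (suc q) k ⟩
      k ℕ.* suc q           ∎

  -- Here k stands for the intended mean of the `a j`. In the k-th power the exponents of 2 add up
  -- to the sum of the `a j`, so a bound k K on that sum will give (2k)^K once the k-th root is
  -- taken.
  ∏-^-≤ : ∀ {K} (a : Fin K → ℤ) k → .{{_ : ℕ.NonZero k}} → (∀ j → 0ℤ ≤ a j) →
          ∏ (∣_∣ ∘ a) ℕ.^ k ℕ.≤ (k ℕ.^ k) ℕ.^ K ℕ.* 2 ℕ.^ ∣ sum a ∣
  ∏-^-≤ {zero}  a k 0≤a = ℕ.≤-reflexive (ℕ.^-zeroˡ k)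
  ∏-^-≤ {suc K} a k 0≤a = begin
    (x ℕ.* P) ℕ.^ k                                      ≡⟨ ^-distribʳ-* k x P ⟩
    x ℕ.^ k ℕ.* P ℕ.^ k
      ≤⟨ ℕ.*-mono-≤ (a^k≤k^k*2^a x k) (∏-^-≤ (a ∘ suc) k (0≤a ∘ suc)) ⟩
    (c ℕ.* 2 ℕ.^ x) ℕ.* (c ℕ.^ K ℕ.* 2 ℕ.^ s)
      ≡⟨ ℕ.[m*n]*[o*p]≡[m*o]*[n*p] c (2 ℕ.^ x) (c ℕ.^ K) (2 ℕ.^ s) ⟩
    (c ℕ.* c ℕ.^ K) ℕ.* (2 ℕ.^ x ℕ.* 2 ℕ.^ s)
      ≡⟨ cong (ℕ._*_ (c ℕ.* c ℕ.^ K)) (sym (ℕ.^-distribˡ-+-* 2 x s)) ⟩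
    (c ℕ.* c ℕ.^ K) ℕ.* 2 ℕ.^ (x ℕ.+ s)                  ≡⟨ cong (λ z → c ℕ.* c ℕ.^ K ℕ.* 2 ℕ.^ z)
                                                              (∣+∣ (0≤a zero) (0≤sum (0≤a ∘ suc))) ⟩
    (c ℕ.* c ℕ.^ K) ℕ.* 2 ℕ.^ ∣ sum a ∣                  ∎
    where
    open ℕ.≤-Reasoning
    c = k ℕ.^ k
    x = ∣ a zero ∣
    P = ∏ (∣_∣ ∘ a ∘ suc)
    s = ∣ sum (a ∘ suc) ∣
    ∣+∣ : ∀ {i j} → 0ℤ ≤ i → 0ℤ ≤ j → ∣ i ∣ ℕ.+ ∣ j ∣ ≡ ∣ i + j ∣
    ∣+∣ (+≤+ _) (+≤+ _) = refl

open Hadamard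

-- Minors of matrices with laminar families of columns

module LaminarColumns where

  open import Data.Integer.Base hiding (suc)
  open import Data.Integer.Tactic.RingSolver using (solve-∀)

  ⟦_⟧ : Bool → ℤ
  ⟦ true ⟧  = 1ℤ
  ⟦ false ⟧ = 0ℤ

  tail : ∀ {ℓ} {X : Set} {Y : Set ℓ} {K} → (X → Fin (suc K) → Y) → X → Fin K → Y
  tail s x j = s x (suc j)

  wedge-cong : ∀ {n K} {M N : Matrix n K} → (∀ i j → M i j ≡ N i j) → wedge M ≗ wedge N
  wedge-cong {K = zero}  M≗N S = refl
  wedge-cong {K = suc K} M≗N S = ⋏-cong (λ i → M≗N i zero) (wedge-cong (λ i j → M≗N i (suc j))) S

  -- Column j of s is the set s _ j, and f j is its family.
  Laminar : ∀ {X : Set} {K k} → (Fin K → Fin k) → (X → Fin K → Bool) → Set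
  Laminar f s = ∀ {j l} → toℕ j ℕ.≤ toℕ l → f j ≡ f l →
    (∀ x → s x l ≡ true → s x j ≡ true) ⊎ (∀ x → s x l ≡ true → s x j ≡ false)

  covered : ∀ {X : Set} {K k} → (Fin K → Fin k) → (X → Fin K → Bool) → Fin k → X → Bool
  covered {K = zero}  f s i x = false
  covered {K = suc K} f s i x = (s x zero ∧ does (f zero Fin.≟ i)) ∨ covered (f ∘ suc) (tail s) i x

  -- For a laminar family this is the result of subtracting later columns from
  -- earlier ones; it leaves each row at most one 1 per family.
  strip : ∀ {X : Set} {K k} → (Fin K → Fin k) → (X → Fin K → Bool) → X → Fin K → Bool
  strip f s x zero    = s x zero ∧ not (covered (f ∘ suc) (tail s) (f zero) x)
  strip f s x (suc j) = strip (f ∘ suc) (tail s) x j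

  module _ {X : Set} where

    -- A point of the union of a family survives exactly once, in the last column of the family that
    -- contains it.
    ∑-strip : ∀ {K k} (f : Fin K → Fin k) (s : X → Fin K → Bool) i x →
              sum (λ j → ⟦ does (f j Fin.≟ i) ⟧ * ⟦ strip f s x j ⟧) ≡ ⟦ covered f s i x ⟧
    ∑-strip {zero}  f s i x = refl
    ∑-strip {suc K} f s i x with f zero Fin.≟ i
    ... | yes refl = trans
      (cong (_+_ (1ℤ * ⟦ s x zero ∧ not c ⟧)) (∑-strip (f ∘ suc) (tail s) i x))
      (cases (s x zero) c)
      where
      c = covered (f ∘ suc) (tail s) i x
      cases : ∀ a c → 1ℤ * ⟦ a ∧ not c ⟧ + ⟦ c ⟧ ≡ ⟦ (a ∧ true) ∨ c ⟧
      cases false false = refl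
      cases false true  = refl
      cases true  false = refl
      cases true  true  = refl
    ... | no _ = trans
      (cong (_+_ 0ℤ) (∑-strip (f ∘ suc) (tail s) i x))
      (cases (s x zero) (covered (f ∘ suc) (tail s) i x))
      where
      cases : ∀ a c → 0ℤ + ⟦ c ⟧ ≡ ⟦ (a ∧ false) ∨ c ⟧
      cases false false = refl
      cases false true  = refl
      cases true  false = refl
      cases true  true  = refl

    strip⇒s : ∀ {K k} (f : Fin K → Fin k) (s : X → Fin K → Bool) x j →
              strip f s x j ≡ true → s x j ≡ true
    strip⇒s f s x zero    p with s x zero
    ... | true = refl
    strip⇒s f s x (suc j) p = strip⇒s (f ∘ suc) (tail s) x j p

    -- A column operation needs a coefficient that does not depend on the row. Laminarity supplies
    -- it: multiplying a later stripped column by the indicator of the first column keeps it whole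
    -- if it is nested and kills it if it is disjoint, so the coefficient is 1 or 0; other families
    -- get 0.
    strip-multiplier : ∀ {K k} (f : Fin (suc K) → Fin k) (s : X → Fin (suc K) → Bool) →
      Laminar f s → ∀ l → ∃[ e ] ∀ x →
      e * ⟦ strip f s x (suc l) ⟧ ≡
      ⟦ s x zero ⟧ * (⟦ does (f (suc l) Fin.≟ f zero) ⟧ * ⟦ strip f s x (suc l) ⟧)
    strip-multiplier f s lam l with f (suc l) Fin.≟ f zero
    ... | no _ = 0ℤ , λ x → sym (ℤ.*-zeroʳ ⟦ s x zero ⟧)
    ... | yes fl≡f0 with lam {zero} {suc l} ℕ.z≤n (sym fl≡f0)
    ...   | inj₁ l⊆0 = 1ℤ , inside
      where
      inside : ∀ x → 1ℤ * ⟦ strip f s x (suc l) ⟧ ≡ ⟦ s x zero ⟧ * (1ℤ * ⟦ strip f s x (suc l) ⟧)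
      inside x with strip f s x (suc l) in eq
      ... | false = sym (ℤ.*-zeroʳ ⟦ s x zero ⟧)
      ... | true rewrite l⊆0 x (strip⇒s f s x (suc l) eq) = refl
    ...   | inj₂ l∩0 = 0ℤ , outside
      where
      outside : ∀ x → 0ℤ ≡ ⟦ s x zero ⟧ * (1ℤ * ⟦ strip f s x (suc l) ⟧)
      outside x with strip f s x (suc l) in eq
      ... | false = sym (ℤ.*-zeroʳ ⟦ s x zero ⟧)
      ... | true rewrite l∩0 x (strip⇒s f s x (suc l) eq) = refl

    strip-column : ∀ {K k} (f : Fin (suc K) → Fin k) (s : X → Fin (suc K) → Bool) (lam : Laminar f s) x →
      ⟦ s x zero ⟧ - sum (λ l → proj₁ (strip-multiplier f s lam l) * ⟦ strip f s x (suc l) ⟧) ≡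
      ⟦ strip f s x zero ⟧
    strip-column f s lam x = begin
      a - sum (λ l → proj₁ (strip-multiplier f s lam l) * ⟦ strip f s x (suc l) ⟧)
        ≡⟨ cong (_-_ a) (trans (sum-cong-≗ (λ l → proj₂ (strip-multiplier f s lam l) x))
                               (sym (*-distribˡ-sum a
                                 (λ l → ⟦ does (f (suc l) Fin.≟ f zero) ⟧ * ⟦ strip f s x (suc l) ⟧)))) ⟩
      a - a * sum (λ l → ⟦ does (f (suc l) Fin.≟ f zero) ⟧ * ⟦ strip f s x (suc l) ⟧)
        ≡⟨ cong (λ z → a - a * z) (∑-strip (f ∘ suc) (tail s) (f zero) x) ⟩
      a - a * ⟦ c ⟧ ≡⟨ cases (s x zero) c ⟩
      ⟦ s x zero ∧ not c ⟧ ∎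
      where
      open ≡-Reasoning
      a = ⟦ s x zero ⟧
      c = covered (f ∘ suc) (tail s) (f zero) x
      cases : ∀ a c → ⟦ a ⟧ - ⟦ a ⟧ * ⟦ c ⟧ ≡ ⟦ a ∧ not c ⟧
      cases false false = refl
      cases false true  = refl
      cases true  false = refl
      cases true  true  = refl

    ∑∑-strip-≤ : ∀ {K k} (f : Fin K → Fin k) (s : X → Fin K → Bool) x →
                 sum (λ j → ⟦ strip f s x j ⟧) ≤ + k
    ∑∑-strip-≤ {K} {k} f s x = begin
      sum (λ j → ⟦ strip f s x j ⟧)
        -- Inserting 1 = Σᵢ [f j = i] sorts the columns by family.
        ≡⟨ sum-cong-≗ (λ j → sym (trans (cong (_* ⟦ strip f s x j ⟧) (∑-indicator (f j)))
                                        (ℤ.*-identityˡ ⟦ strip f s x j ⟧))) ⟩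
      sum (λ j → sum (λ i → ⟦ does (f j Fin.≟ i) ⟧) * ⟦ strip f s x j ⟧)
        ≡⟨ sum-cong-≗ (λ j → *-distribʳ-sum ⟦ strip f s x j ⟧ (λ i → ⟦ does (f j Fin.≟ i) ⟧)) ⟩
      sum (λ j → sum (λ i → ⟦ does (f j Fin.≟ i) ⟧ * ⟦ strip f s x j ⟧))
        ≡⟨ ∑-comm (λ j i → ⟦ does (f j Fin.≟ i) ⟧ * ⟦ strip f s x j ⟧) ⟩
      sum (λ i → sum (λ j → ⟦ does (f j Fin.≟ i) ⟧ * ⟦ strip f s x j ⟧))
        ≡⟨ sum-cong-≗ (λ i → ∑-strip f s i x) ⟩
      sum (λ i → ⟦ covered f s i x ⟧) ≤⟨ ∑≤k (λ i → covered f s i x) ⟩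
      + k ∎
      where
      open ℤ.≤-Reasoning
      ∑≤k : ∀ {k} (b : Fin k → Bool) → sum (⟦_⟧ ∘ b) ≤ + k
      ∑≤k {zero}  b = ℤ.≤-refl
      ∑≤k {suc k} b = ℤ.+-mono-≤ (≤1 (b zero)) (∑≤k (b ∘ suc))
        where
        ≤1 : ∀ c → ⟦ c ⟧ ≤ 1ℤ
        ≤1 true  = ℤ.≤-refl
        ≤1 false = +≤+ ℕ.z≤n
      ∑-indicator : ∀ {k} (l : Fin k) → sum (λ i → ⟦ does (l Fin.≟ i) ⟧) ≡ 1ℤ
      ∑-indicator {suc k} zero    = cong (_+_ 1ℤ) (∑0 k)
        where
        ∑0 : ∀ k → sum {k} (λ _ → 0ℤ) ≡ 0ℤ
        ∑0 zero    = refl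
        ∑0 (suc k) = trans (ℤ.+-identityˡ _) (∑0 k)
      ∑-indicator {suc k} (suc l) = trans (ℤ.+-identityˡ _) (∑-indicator l)

  -- The later columns are stripped first. Within a family their remainders are then disjoint, so
  -- that subtracting them from the first column removes no point twice.
  wedge-strip : ∀ {n K k} (f : Fin K → Fin k) (s : Fin n → Fin K → Bool) → Laminar f s →
                wedge (λ x j → ⟦ s x j ⟧) ≗ wedge (λ x j → ⟦ strip f s x j ⟧)
  wedge-strip {K = zero}  f s lam S = refl
  wedge-strip {K = suc K} f s lam S = begin
    ((λ x → ⟦ s x zero ⟧) ⋏ wedge (λ x j → ⟦ s x (suc j) ⟧)) S
      ≡⟨ ⋏-congʳ (λ x → ⟦ s x zero ⟧) (wedge-strip (f ∘ suc) (tail s) (λ j≤l → lam (ℕ.s≤s j≤l))) S ⟩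
    ((λ x → ⟦ s x zero ⟧) ⋏ wedge S′) S
      ≡⟨ ⋏-subtract-columns (λ x → ⟦ s x zero ⟧) e S′ S ⟨
    ((λ x → ⟦ s x zero ⟧ - sum (λ l → e l * S′ x l)) ⋏ wedge S′) S
      ≡⟨ ⋏-congˡ (wedge S′) (strip-column f s lam) S ⟩
    ((λ x → ⟦ strip f s x zero ⟧) ⋏ wedge S′) S ∎
    where
    open ≡-Reasoning
    S′ : Matrix _ _
    S′ x j = ⟦ strip f s x (suc j) ⟧
    e : Fin _ → ℤ
    e l = proj₁ (strip-multiplier f s lam l)

  ∏-≤ : ∀ {K} (a : Fin K → ℤ) k → .{{_ : ℕ.NonZero k}} → (∀ j → 0ℤ ≤ a j) →
        sum a ≤ + (k ℕ.* K) → ∏ (∣_∣ ∘ a) ℕ.≤ (2 ℕ.* k) ℕ.^ K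
  ∏-≤ {K} a k 0≤a ∑a≤kK = ℕ.≮⇒≥ λ lt → ℕ.<⇒≱ (ℕ.^-monoˡ-< k lt) (begin
    ∏ (∣_∣ ∘ a) ℕ.^ k                                ≤⟨ ∏-^-≤ a k 0≤a ⟩
    (k ℕ.^ k) ℕ.^ K ℕ.* 2 ℕ.^ ∣ sum a ∣
      ≤⟨ ℕ.*-monoʳ-≤ ((k ℕ.^ k) ℕ.^ K) (ℕ.^-monoʳ-≤ 2 (∣∣≤ ∑a≤kK (0≤sum 0≤a))) ⟩
    (k ℕ.^ k) ℕ.^ K ℕ.* 2 ℕ.^ (k ℕ.* K)              ≡⟨ cong (ℕ._* 2 ℕ.^ (k ℕ.* K)) (ℕ.^-*-assoc k k K) ⟩
    k ℕ.^ (k ℕ.* K) ℕ.* 2 ℕ.^ (k ℕ.* K)              ≡⟨ ^-distribʳ-* (k ℕ.* K) k 2 ⟨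
    (k ℕ.* 2) ℕ.^ (k ℕ.* K)                          ≡⟨ cong₂ ℕ._^_ (ℕ.*-comm k 2) (ℕ.*-comm k K) ⟩
    (2 ℕ.* k) ℕ.^ (K ℕ.* k)                          ≡⟨ ℕ.^-*-assoc (2 ℕ.* k) K k ⟨
    ((2 ℕ.* k) ℕ.^ K) ℕ.^ k                          ∎)
    where
    open ℕ.≤-Reasoning
    ∣∣≤ : ∀ {i n} → i ≤ + n → 0ℤ ≤ i → ∣ i ∣ ℕ.≤ n
    ∣∣≤ (+≤+ m≤n) (+≤+ _) = m≤n

  sum-≤-const : ∀ {n} (g : Fin n → ℤ) k → (∀ x → g x ≤ + k) → sum g ≤ + (k ℕ.* n)
  sum-≤-const {zero}  g k g≤k = +≤+ ℕ.z≤n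
  sum-≤-const {suc n} g k g≤k = subst (sum g ≤_) (cong +_ (sym (ℕ.*-suc k n)))
    (ℤ.+-mono-≤ (g≤k zero) (sum-≤-const (g ∘ suc) k (g≤k ∘ suc)))

  -- The squared norm of a 0/1 column is its number of ones. Counted by rows, the K rows of the
  -- stripped matrix have at most k ones each, so the squared norms add up to at most k K and `∏-≤`
  -- bounds their product.
  laminar-wedge-bound : ∀ {K k} .{{_ : ℕ.NonZero k}} (f : Fin K → Fin k) (s : Fin K → Fin K → Bool) →
    Laminar f s → ∀ S → wedge (λ x j → ⟦ s x j ⟧) S * wedge (λ x j → ⟦ s x j ⟧) S ≤ + ((2 ℕ.* k) ℕ.^ K)
  laminar-wedge-bound {K} {k} f s lam S = begin
    wedge (λ x j → ⟦ s x j ⟧) S * wedge (λ x j → ⟦ s x j ⟧) S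
      ≡⟨ cong₂ _*_ (wedge-strip f s lam S) (wedge-strip f s lam S) ⟩
    wedge M S * wedge M S                ≤⟨ coefficient²≤⟨⟩ (wedge M) S ⟩
    ⟨ wedge M , wedge M ⟩                ≡⟨ ℤ.0≤i⇒+∣i∣≡i (0≤⟨⟩ (wedge M)) ⟨
    + ∣ ⟨ wedge M , wedge M ⟩ ∣          ≤⟨ +≤+ (hadamard M) ⟩
    + ∏ (λ j → ∣ norm j ∣)               ≤⟨ +≤+ (∏-≤ norm k (λ j → 0≤sum (λ x → 0≤i*i (M x j))) total) ⟩
    + ((2 ℕ.* k) ℕ.^ K)                  ∎
    where
    open ℤ.≤-Reasoning
    M : Matrix K K
    M x j = ⟦ strip f s x j ⟧
    norm : Fin K → ℤ
    norm j = ∣ (λ x → M x j) ∣²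
    square : ∀ b → ⟦ b ⟧ * ⟦ b ⟧ ≡ ⟦ b ⟧
    square true  = refl
    square false = refl
    total : sum norm ≤ + (k ℕ.* K)
    total = begin
      sum (λ j → sum (λ x → M x j * M x j))
        ≡⟨ sum-cong-≗ (λ j → sum-cong-≗ (λ x → square (strip f s x j))) ⟩
      sum (λ j → sum (λ x → M x j))   ≡⟨ ∑-comm (λ j x → M x j) ⟩
      sum (λ x → sum (λ j → M x j))   ≤⟨ sum-≤-const (λ x → sum (M x)) k (∑∑-strip-≤ f s) ⟩
      + (k ℕ.* K)                     ∎

  -- The additive functional φ absorbs the columns whose part has already been chosen. By (x + y)² ≤
  -- 2x² + 2y² each column contributes two branches, each with weight 2, hence a factor 4.
  wedge-split-bound : ∀ {n K} (φ : Form n → ℤ) →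
    (∀ {ω η} → ω ≗ η → φ ω ≡ φ η) → (∀ ω η → φ (λ S → ω S + η S) ≡ φ ω + φ η) →
    ∀ (P : Bool → Matrix n K) X →
    (∀ (c : Vec Bool K) → φ (wedge (λ i j → P (lookup c j) i j)) * φ (wedge (λ i j → P (lookup c j) i j)) ≤ X) →
    φ (wedge (λ i j → P true i j + P false i j)) * φ (wedge (λ i j → P true i j + P false i j)) ≤ + (4 ℕ.^ K) * X
  wedge-split-bound {K = zero}  φ φ-cong φ-+ P X bound = subst (φ one * φ one ≤_) (sym (ℤ.*-identityˡ X)) (bound [])
  wedge-split-bound {K = suc K} φ φ-cong φ-+ P X bound = begin
    φ (wedge (λ i j → P true i j + P false i j)) * φ (wedge (λ i j → P true i j + P false i j))
      ≡⟨ cong₂ _*_ split split ⟩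
    (φ (col true ⋏ Ω) + φ (col false ⋏ Ω)) * (φ (col true ⋏ Ω) + φ (col false ⋏ Ω))
      ≤⟨ square-+-≤ (φ (col true ⋏ Ω)) (φ (col false ⋏ Ω)) ⟩
    + 2 * (φ (col true ⋏ Ω) * φ (col true ⋏ Ω)) + + 2 * (φ (col false ⋏ Ω) * φ (col false ⋏ Ω))
      ≤⟨ ℤ.+-mono-≤ (ℤ.*-monoˡ-≤-nonNeg (+ 2) (rest true)) (ℤ.*-monoˡ-≤-nonNeg (+ 2) (rest false)) ⟩
    + 2 * (+ (4 ℕ.^ K) * X) + + 2 * (+ (4 ℕ.^ K) * X)
      ≡⟨ ring (+ (4 ℕ.^ K)) X ⟩
    + 4 * + (4 ℕ.^ K) * X
      ≡⟨ cong (_* X) (sym (ℤ.pos-* 4 (4 ℕ.^ K))) ⟩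
    + (4 ℕ.^ suc K) * X ∎
    where
    open ℤ.≤-Reasoning
    col : Bool → Fin _ → ℤ
    col b i = P b i zero
    Ω : Form _
    Ω = wedge (λ i j → P true i (suc j) + P false i (suc j))
    add : (λ i → col true i + col false i) ⋏ Ω ≗ λ S → (col true ⋏ Ω) S + (col false ⋏ Ω) S
    add S = trans (⋏-congˡ Ω (λ i → sym (cong₂ _+_ (ℤ.*-identityˡ (col true i)) (ℤ.*-identityˡ (col false i)))) S)
      (trans (⋏-linearˡ 1ℤ 1ℤ (col true) (col false) Ω S)
             (cong₂ _+_ (ℤ.*-identityˡ ((col true ⋏ Ω) S)) (ℤ.*-identityˡ ((col false ⋏ Ω) S))))
    split : φ ((λ i → col true i + col false i) ⋏ Ω) ≡ φ (col true ⋏ Ω) + φ (col false ⋏ Ω)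
    split = trans (φ-cong add) (φ-+ (col true ⋏ Ω) (col false ⋏ Ω))
    rest : ∀ b → φ (col b ⋏ Ω) * φ (col b ⋏ Ω) ≤ + (4 ℕ.^ K) * X
    rest b = wedge-split-bound (λ ω → φ (col b ⋏ ω)) (λ ω≗η → φ-cong (⋏-congʳ (col b) ω≗η))
      (λ ω η → trans (φ-cong (addʳ ω η)) (φ-+ (col b ⋏ ω) (col b ⋏ η)))
      (λ b′ i j → P b′ i (suc j)) X (λ c → bound (b ∷ c))
      where
      addʳ : ∀ ω η → col b ⋏ (λ S → ω S + η S) ≗ λ S → (col b ⋏ ω) S + (col b ⋏ η) S
      addʳ ω η S = trans (⋏-congʳ (col b) (λ S → sym (cong₂ _+_ (ℤ.*-identityˡ (ω S)) (ℤ.*-identityˡ (η S)))) S)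
        (trans (⋏-linearʳ (col b) 1ℤ 1ℤ ω η S)
               (cong₂ _+_ (ℤ.*-identityˡ ((col b ⋏ ω) S)) (ℤ.*-identityˡ ((col b ⋏ η) S))))
    square-+-≤ : ∀ x y → (x + y) * (x + y) ≤ + 2 * (x * x) + + 2 * (y * y)
    square-+-≤ x y = ℤ.0≤i-j⇒j≤i (subst (0ℤ ≤_) (difference x y) (0≤i*i (x - y)))
      where
      difference : ∀ x y → (x - y) * (x - y) ≡ + 2 * (x * x) + + 2 * (y * y) - (x + y) * (x + y)
      difference = solve-∀
    ring : ∀ c X → + 2 * (c * X) + + 2 * (c * X) ≡ + 4 * c * X
    ring = solve-∀

open LaminarColumns

-- The tree matrix and its minors

module TreeMatrix where

  open import Data.Integer.Base hiding (suc)

  nodes : ℕ → ℕ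
  nodes zero    = 0
  nodes (suc h) = suc (nodes h ℕ.+ nodes h)

  -- The inner nodes of the complete binary tree of height h are numbered in
  -- preorder; below h σ p v says that the leaf reached by the path p lies below
  -- the child of v on side σ.
  below : ∀ h → Bool → Vec Bool h → Fin (nodes h) → Bool
  below (suc h) σ p zero    = if Vec.head p then σ else not σ
  below (suc h) σ p (suc j) =
    [ (λ u → not (Vec.head p) ∧ below h σ (Vec.tail p) u)
    , (λ u → Vec.head p ∧ below h σ (Vec.tail p) u) ]′ (splitAt (nodes h) j)

  toℕ-splitAt₁ : ∀ m {n} (j : Fin (m ℕ.+ n)) {u} → splitAt m j ≡ inj₁ u → toℕ j ≡ toℕ u
  toℕ-splitAt₁ m {n} j {u} eq = trans (cong toℕ (sym (Fin.splitAt⁻¹-↑ˡ eq))) (Fin.toℕ-↑ˡ u n)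

  toℕ-splitAt₂ : ∀ m {n} (j : Fin (m ℕ.+ n)) {u} → splitAt m j ≡ inj₂ u → toℕ j ≡ m ℕ.+ toℕ u
  toℕ-splitAt₂ m {n} j {u} eq = trans (cong toℕ (sym (Fin.splitAt⁻¹-↑ʳ {m} eq))) (Fin.toℕ-↑ʳ m u)

  Nested : {X : Set} → (X → Bool) → (X → Bool) → Set
  Nested s t = (∀ x → t x ≡ true → s x ≡ true) ⊎ (∀ x → t x ≡ true → s x ≡ false)

  -- In preorder a later node never lies above an earlier one. If it is the same node or lies below
  -- the σ-child, its leaves are contained in those of the earlier node; otherwise the two sets are
  -- disjoint.
  below-nested : ∀ h σ (u w : Fin (nodes h)) → toℕ u ℕ.≤ toℕ w →
                 Nested (λ p → below h σ p u) (λ p → below h σ p w)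
  below-nested (suc h) σ zero zero _ = inj₁ (λ p → id)
  below-nested (suc h) σ zero (suc j) _ with splitAt (nodes h) j
  below-nested (suc h) false zero (suc j) _ | inj₁ w = inj₁ λ { (false ∷ p) _ → refl ; (true ∷ p) () }
  below-nested (suc h) true  zero (suc j) _ | inj₁ w = inj₂ λ { (false ∷ p) _ → refl ; (true ∷ p) () }
  below-nested (suc h) false zero (suc j) _ | inj₂ w = inj₂ λ { (true ∷ p) _ → refl ; (false ∷ p) () }
  below-nested (suc h) true  zero (suc j) _ | inj₂ w = inj₁ λ { (true ∷ p) _ → refl ; (false ∷ p) () }
  below-nested (suc h) σ (suc i) (suc j) (ℕ.s≤s i≤j)
    with splitAt (nodes h) i in eqᵢ | splitAt (nodes h) j in eqⱼ
  ... | inj₁ u | inj₂ w = inj₂ λ { (true ∷ p) _ → refl ; (false ∷ p) () }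
  ... | inj₂ u | inj₁ w = contradiction i≤j (ℕ.<⇒≱ (begin-strict
    toℕ j              ≡⟨ toℕ-splitAt₁ (nodes h) j eqⱼ ⟩
    toℕ w              <⟨ Fin.toℕ<n w ⟩
    nodes h            ≤⟨ ℕ.m≤m+n (nodes h) (toℕ u) ⟩
    nodes h ℕ.+ toℕ u  ≡⟨ toℕ-splitAt₂ (nodes h) i eqᵢ ⟨
    toℕ i              ∎))
    where open ℕ.≤-Reasoning
  ... | inj₁ u | inj₁ w with below-nested h σ u w
        (subst₂ ℕ._≤_ (toℕ-splitAt₁ (nodes h) i eqᵢ) (toℕ-splitAt₁ (nodes h) j eqⱼ) i≤j)
  ...   | inj₁ w⊆u = inj₁ λ { (false ∷ p) → w⊆u p ; (true ∷ p) () }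
  ...   | inj₂ w∩u = inj₂ λ { (false ∷ p) → w∩u p ; (true ∷ p) () }
  below-nested (suc h) σ (suc i) (suc j) (ℕ.s≤s i≤j)
      | inj₂ u | inj₂ w with below-nested h σ u w (ℕ.+-cancelˡ-≤ (nodes h) (toℕ u) (toℕ w)
        (subst₂ ℕ._≤_ (toℕ-splitAt₂ (nodes h) i eqᵢ) (toℕ-splitAt₂ (nodes h) j eqⱼ) i≤j))
  ...   | inj₁ w⊆u = inj₁ λ { (true ∷ p) → w⊆u p ; (false ∷ p) () }
  ...   | inj₂ w∩u = inj₂ λ { (true ∷ p) → w∩u p ; (false ∷ p) () }

  nodes<2^h : ∀ h → nodes h ℕ.< 2 ℕ.^ h
  nodes<2^h zero    = ℕ.s≤s ℕ.z≤n
  nodes<2^h (suc h) = begin-strict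
    suc (nodes h ℕ.+ nodes h)      <⟨ ℕ.n<1+n _ ⟩
    suc (suc (nodes h ℕ.+ nodes h)) ≡⟨ cong suc (ℕ.+-suc (nodes h) (nodes h)) ⟨
    suc (nodes h) ℕ.+ suc (nodes h) ≤⟨ ℕ.+-mono-≤ (nodes<2^h h) (nodes<2^h h) ⟩
    2 ℕ.^ h ℕ.+ 2 ℕ.^ h             ≡⟨ cong (2 ℕ.^ h ℕ.+_) (sym (ℕ.+-identityʳ (2 ℕ.^ h))) ⟩
    2 ℕ.^ suc h                     ∎
    where open ℕ.≤-Reasoning

  odd : ℕ → Bool
  odd zero    = false
  odd (suc n) = not (odd n)

  -- Lowest digit first, with the remaining quotient. Every natural number thereby encodes a row, so
  -- the matrix is defined for any number m of rows; when m exceeds the number of triples, rows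
  -- repeat, which harms neither bound.
  digits : ∀ q → ℕ → Vec Bool q × ℕ
  digits zero    n = [] , n
  digits (suc q) n = let v , r = digits q ⌊ n /2⌋ in odd n ∷ v , r

  twice : ℕ → ℕ
  twice zero    = 0
  twice (suc n) = suc (suc (twice n))

  fromDigits : ∀ {q} → Vec Bool q → ℕ → ℕ
  fromDigits []          r = r
  fromDigits (false ∷ v) r = twice (fromDigits v r)
  fromDigits (true ∷ v)  r = suc (twice (fromDigits v r))

  odd-twice : ∀ n → odd (twice n) ≡ false
  odd-twice zero    = refl
  odd-twice (suc n) = trans (Bool.not-involutive (odd (twice n))) (odd-twice n)

  ⌊twice/2⌋ : ∀ n → ⌊ twice n /2⌋ ≡ n
  ⌊twice/2⌋ zero    = refl
  ⌊twice/2⌋ (suc n) = cong suc (⌊twice/2⌋ n)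

  ⌊1+twice/2⌋ : ∀ n → ⌊ suc (twice n) /2⌋ ≡ n
  ⌊1+twice/2⌋ zero    = refl
  ⌊1+twice/2⌋ (suc n) = cong suc (⌊1+twice/2⌋ n)

  twice≡2* : ∀ n → twice n ≡ 2 ℕ.* n
  twice≡2* zero    = refl
  twice≡2* (suc n) = trans (cong (2 ℕ.+_) (twice≡2* n)) (cong suc (sym (ℕ.+-suc n (n ℕ.+ 0))))

  digits-fromDigits : ∀ {q} (v : Vec Bool q) r → digits q (fromDigits v r) ≡ (v , r)
  digits-fromDigits []          r = refl
  digits-fromDigits (false ∷ v) r
    rewrite ⌊twice/2⌋ (fromDigits v r) | odd-twice (fromDigits v r) | digits-fromDigits v r = refl
  digits-fromDigits (true ∷ v)  r
    rewrite ⌊1+twice/2⌋ (fromDigits v r) | odd-twice (fromDigits v r) | digits-fromDigits v r = refl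

  fromDigits-< : ∀ {q} (v : Vec Bool q) r B → r ℕ.< B → fromDigits v r ℕ.< 2 ℕ.^ q ℕ.* B
  fromDigits-< []              r B r<B = subst (r ℕ.<_) (sym (ℕ.+-identityʳ B)) r<B
  fromDigits-< {suc q} (b ∷ v) r B r<B = begin-strict
    fromDigits (b ∷ v) r          ≤⟨ upper b ⟩
    suc (twice (fromDigits v r))  <⟨ ℕ.n<1+n _ ⟩
    twice (suc (fromDigits v r))  ≡⟨ twice≡2* (suc (fromDigits v r)) ⟩
    2 ℕ.* suc (fromDigits v r)    ≤⟨ ℕ.*-monoʳ-≤ 2 (fromDigits-< v r B r<B) ⟩
    2 ℕ.* (2 ℕ.^ q ℕ.* B)         ≡⟨ ℕ.*-assoc 2 (2 ℕ.^ q) B ⟨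
    2 ℕ.^ suc q ℕ.* B             ∎
    where
    open ℕ.≤-Reasoning
    upper : ∀ b → fromDigits (b ∷ v) r ℕ.≤ suc (twice (fromDigits v r))
    upper false = ℕ.n≤1+n _
    upper true  = ℕ.≤-refl

  -- Laminarity refers to the order of the columns; this lets it pass to submatrices.
  choose-increasing : ∀ k n {v} → v ∈ˡ choose k n → ∀ {i j} → toℕ i ℕ.≤ toℕ j →
                      toℕ (lookup v i) ℕ.≤ toℕ (lookup v j)
  choose-increasing (suc k) (suc n) {v} v∈ {i} {j} i≤j
    with ∈-++⁻ (map (λ v → zero ∷ Vec.map suc v) (choose k n)) v∈
  ... | inj₂ v∈′ with ∈-map⁻ (Vec.map suc) v∈′
  ...   | w , w∈ , refl rewrite Vec.lookup-map i Fin.suc w | Vec.lookup-map j Fin.suc w =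
    ℕ.s≤s (choose-increasing (suc k) n w∈ i≤j)
  choose-increasing (suc k) (suc n) {v} v∈ {i} {j} i≤j | inj₁ v∈′ with ∈-map⁻ (λ v → zero ∷ Vec.map suc v) v∈′
  ...   | w , w∈ , refl = go i j i≤j
    where
    go : ∀ i j → toℕ i ℕ.≤ toℕ j →
         toℕ (lookup (Fin.zero ∷ Vec.map suc w) i) ℕ.≤ toℕ (lookup (Fin.zero ∷ Vec.map suc w) j)
    go zero    j       _ = ℕ.z≤n
    go (suc i) (suc j) (ℕ.s≤s i≤j) rewrite Vec.lookup-map i Fin.suc w | Vec.lookup-map j Fin.suc w =
      ℕ.s≤s (choose-increasing k n w∈ i≤j)

  -- A row is a triple (σ, p, S) of a side, a leaf and a subset of k elements;
  -- a column is a pair (v, i) of a node and one of the k elements, or padding.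
  module Construction (h k r : ℕ) .{{_ : ℕ.NonZero k}} where

    n : ℕ
    n = nodes h ℕ.* k ℕ.+ r

    entry : Vec Bool (suc h) × Vec Bool k → Fin n → Bool
    entry (σp , S) j =
      [ (λ c → let v , i = remQuot {nodes h} k c in
           below h (Vec.head σp) (Vec.tail σp) v ∧ lookup S i)
      , (λ _ → false) ]′ (splitAt (nodes h ℕ.* k) j)

    family : Fin n → Fin k
    family j with splitAt (nodes h ℕ.* k) j
    ... | inj₁ c = proj₂ (remQuot {nodes h} k c)
    -- A padding column is empty, hence nested in or disjoint from any other, so its family is an
    -- arbitrary default.
    ... | inj₂ _ = fromℕ< (ℕ.>-nonZero⁻¹ k)

    entry-nested : ∀ σ (a b : Fin n) → toℕ a ℕ.≤ toℕ b → family a ≡ family b →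
      Nested {Vec Bool h × Vec Bool k} (λ (p , S) → entry (σ ∷ p , S) a) (λ (p , S) → entry (σ ∷ p , S) b)
    entry-nested σ a b a≤b eq with splitAt (nodes h ℕ.* k) a in eqᵃ | splitAt (nodes h ℕ.* k) b in eqᵇ
    ... | _       | inj₂ _  = inj₁ λ _ ()
    ... | inj₂ _  | inj₁ _  = inj₂ λ _ _ → refl
    ... | inj₁ ca | inj₁ cb with below-nested h σ (node ca) (node cb) u≤w
      where
      node : Fin (nodes h ℕ.* k) → Fin (nodes h)
      node c = proj₁ (remQuot {nodes h} k c)
      u≤w : toℕ (node ca) ℕ.≤ toℕ (node cb)
      -- `combine` orders columns by their node first, so the order of the columns forces that of
      -- the nodes.
      u≤w = ℕ.≮⇒≥ λ w<u → ℕ.<⇒≱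
        (subst₂ (λ x y → toℕ x ℕ.< toℕ y) (Fin.combine-remQuot {nodes h} k cb) (Fin.combine-remQuot {nodes h} k ca)
          (Fin.combine-monoˡ-< (proj₂ (remQuot {nodes h} k cb)) (proj₂ (remQuot {nodes h} k ca)) w<u))
        (subst₂ ℕ._≤_ (toℕ-splitAt₁ (nodes h ℕ.* k) a eqᵃ) (toℕ-splitAt₁ (nodes h ℕ.* k) b eqᵇ) a≤b)
    ...   | inj₁ w⊆u = inj₁ λ (p , S) → ∧-true (w⊆u p) (cong (lookup S) eq)
      where
      ∧-true : ∀ {x y b c} → (x ≡ true → y ≡ true) → b ≡ c → x ∧ c ≡ true → y ∧ b ≡ true
      ∧-true {true} x⇒y refl c≡t rewrite x⇒y refl = c≡t
    ...   | inj₂ w∩u = inj₂ λ (p , S) → ∧-false (w∩u p)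
      where
      ∧-false : ∀ {x y b c} → (x ≡ true → y ≡ false) → x ∧ c ≡ true → y ∧ b ≡ false
      ∧-false {true} x⇒¬y _ rewrite x⇒¬y refl = refl

    row : ℕ → Vec Bool (suc h) × Vec Bool k
    row x = let σp , y = digits (suc h) x in σp , proj₁ (digits k y)

    row-surjective : ∀ σp S → ∃[ x ] (x ℕ.< 2 ℕ.^ (suc h ℕ.+ k) × row x ≡ (σp , S))
    row-surjective σp S = fromDigits σp y , bound , equal
      where
      y = fromDigits S 0
      bound : fromDigits σp y ℕ.< 2 ℕ.^ (suc h ℕ.+ k)
      bound = subst (fromDigits σp y ℕ.<_) (sym (ℕ.^-distribˡ-+-* 2 (suc h) k))
        (fromDigits-< σp y (2 ℕ.^ k) (subst (y ℕ.<_) (ℕ.*-identityʳ (2 ℕ.^ k)) (fromDigits-< S 0 1 (ℕ.s≤s ℕ.z≤n))))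
      equal : row (fromDigits σp y) ≡ (σp , S)
      equal = cong₂ _,_ (cong proj₁ (digits-fromDigits σp y))
        (trans (cong (λ z → proj₁ (digits k (proj₂ z))) (digits-fromDigits σp y))
               (cong proj₁ (digits-fromDigits S 0)))

    treeMatrix : ∀ {m} → Matrix m n
    treeMatrix x j = ⟦ entry (row (toℕ x)) j ⟧

    sameSide : Bool → Vec Bool (suc h) × Vec Bool k → Bool
    sameSide τ (σp , S) = if τ then Vec.head σp else not (Vec.head σp)

    treeMatrix-wedge-bound : ∀ {m K} (rows : Vec (Fin m) K) (cols : Vec (Fin n) K) → cols ∈ˡ choose K n → ∀ S →
      wedge (submatrix treeMatrix rows cols) S * wedge (submatrix treeMatrix rows cols) S ≤
      + (4 ℕ.^ K ℕ.* (2 ℕ.* k) ℕ.^ K)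
    treeMatrix-wedge-bound {m} {K} rows cols cols∈ S = subst₂ _≤_
      (cong₂ _*_ (wedge-cong (λ i j → split (rowᵢ i) (lookup cols j)) S)
                 (wedge-cong (λ i j → split (rowᵢ i) (lookup cols j)) S))
      (sym (ℤ.pos-* (4 ℕ.^ K) ((2 ℕ.* k) ℕ.^ K)))
      (wedge-split-bound (λ ω → ω S) (λ ω≗η → ω≗η S) (λ _ _ → refl)
        (λ τ i j → ⟦ part τ i j ⟧) (+ ((2 ℕ.* k) ℕ.^ K))
        (λ c → laminar-wedge-bound (λ j → family (lookup cols j)) (λ i j → part (lookup c j) i j) (laminar c) S))
      where
      rowᵢ : Fin K → Vec Bool (suc h) × Vec Bool k
      rowᵢ i = row (toℕ (lookup rows i))
      part : Bool → Fin K → Fin K → Bool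
      part τ i j = sameSide τ (rowᵢ i) ∧ entry (rowᵢ i) (lookup cols j)
      split : ∀ ρ j → ⟦ sameSide true ρ ∧ entry ρ j ⟧ + ⟦ sameSide false ρ ∧ entry ρ j ⟧ ≡ ⟦ entry ρ j ⟧
      split (false ∷ p , S) j = ℤ.+-identityˡ _
      split (true ∷ p , S)  j = ℤ.+-identityʳ _
      opposite : ∀ τ τ′ ρ b b′ → τ ≢ τ′ → sameSide τ′ ρ ∧ b′ ≡ true → sameSide τ ρ ∧ b ≡ false
      opposite false false ρ               b b′ τ≢τ′ _ = contradiction refl τ≢τ′
      opposite true  true  ρ               b b′ τ≢τ′ _ = contradiction refl τ≢τ′
      opposite false true  (true ∷ p , S)  b b′ τ≢τ′ _ = refl
      opposite true  false (false ∷ p , S) b b′ τ≢τ′ _ = refl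
      same : ∀ τ (a b : Fin n) → toℕ a ℕ.≤ toℕ b → family a ≡ family b →
             Nested (λ ρ → sameSide τ ρ ∧ entry ρ a) (λ ρ → sameSide τ ρ ∧ entry ρ b)
      same τ a b a≤b eq with entry-nested τ a b a≤b eq
      same false a b a≤b eq | inj₁ b⊆a = inj₁ λ { (false ∷ p , S) → b⊆a (p , S) ; (true ∷ p , S) () }
      same true  a b a≤b eq | inj₁ b⊆a = inj₁ λ { (true ∷ p , S) → b⊆a (p , S) ; (false ∷ p , S) () }
      same false a b a≤b eq | inj₂ b∩a = inj₂ λ { (false ∷ p , S) → b∩a (p , S) ; (true ∷ p , S) () }
      same true  a b a≤b eq | inj₂ b∩a = inj₂ λ { (true ∷ p , S) → b∩a (p , S) ; (false ∷ p , S) () }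
      -- The vector c assigns a side to every column. Different sides are disjoint by `opposite`; on
      -- equal sides the tree order decides.
      laminar : ∀ c → Laminar (λ j → family (lookup cols j)) (λ i j → part (lookup c j) i j)
      laminar c {j} {l} j≤l eq with lookup c j Bool.≟ lookup c l
      ... | no c≢ = inj₂ λ i → opposite (lookup c j) (lookup c l) (rowᵢ i) _ _ c≢
      ... | yes c≡ rewrite c≡ with same (lookup c l) (lookup cols j) (lookup cols l)
                                     (choose-increasing K n cols∈ j≤l) eq
      ...   | inj₁ l⊆j = inj₁ λ i → l⊆j (rowᵢ i)
      ...   | inj₂ l∩j = inj₂ λ i → l∩j (rowᵢ i)

    treeMatrix-det-bound : ∀ {m K} (rows : Vec (Fin m) K) (cols : Vec (Fin n) K) → cols ∈ˡ choose K n →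
      ∣ det (submatrix treeMatrix rows cols) ∣ ℕ.* ∣ det (submatrix treeMatrix rows cols) ∣ ℕ.≤
      4 ℕ.^ K ℕ.* (2 ℕ.* k) ℕ.^ K
    treeMatrix-det-bound {m} {K} rows cols cols∈ = subst (ℕ._≤ _) (ℤ.abs-* d d)
      (∣∣-mono-≤ (0≤i*i d) (subst (λ z → z * z ≤ _) (sym (det≡wedge (submatrix treeMatrix rows cols)))
        (treeMatrix-wedge-bound rows cols cols∈ (replicate K true))))
      where d = det (submatrix treeMatrix rows cols)

open TreeMatrix

-- Lower bound for the discrepancy of the tree matrix

module Discrepancy where

  open import Data.Integer.Base hiding (suc)
  open import Data.Integer.Tactic.RingSolver using (solve-∀)

  Sign : ℤ → Set
  Sign i = i ≡ 1ℤ ⊎ i ≡ -1ℤ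

  min±-attained : ∀ {n} (f : Vec ℤ n → ℕ) → ∃[ x ] ((∀ j → Sign (lookup x j)) × min± f ≡ f x)
  min±-attained {zero}  f = [] , (λ ()) , refl
  min±-attained {suc n} f
    with min±-attained (λ x → f (1ℤ ∷ x)) | min±-attained (λ x → f (-1ℤ ∷ x))
       | ℕ.⊓-sel (min± (λ x → f (1ℤ ∷ x))) (min± (λ x → f (-1ℤ ∷ x)))
  ... | x , sx , eq | _           | inj₁ sel = 1ℤ ∷ x , (λ { zero → inj₁ refl ; (suc j) → sx j }) , trans sel eq
  ... | _           | x , sx , eq | inj₂ sel = -1ℤ ∷ x , (λ { zero → inj₂ refl ; (suc j) → sx j }) , trans sel eq

  ∈⇒≤max : ∀ {x xs} → x ∈ˡ xs → x ℕ.≤ max 0 xs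
  ∈⇒≤max {xs = xs} x∈xs = All.lookup (xs≤max 0 xs) x∈xs

  ∈-concatMap : ∀ {A B : Set} {f : A → List B} {xs x y} → x ∈ˡ xs → y ∈ˡ f x → y ∈ˡ concatMap f xs
  ∈-concatMap {f = f} x∈xs y∈fx = ∈-concatMap⁺ f (Any.map (λ { refl → y∈fx }) x∈xs)

  allFin∈choose : ∀ n → Vec.allFin n ∈ˡ choose n n
  allFin∈choose zero    = here refl
  allFin∈choose (suc n) = ∈-++⁺ˡ (subst (_∈ˡ map (λ v → zero ∷ Vec.map suc v) (choose n n))
    (cong (zero ∷_) (sym (Vec.tabulate-∘ suc id))) (∈-map⁺ (λ v → zero ∷ Vec.map suc v) (allFin∈choose n)))

  disc≤herdisc : ∀ {m n} (A : Matrix (suc m) (suc n)) →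
    disc (submatrix A (Vec.allFin (suc m)) (Vec.allFin (suc n))) ℕ.≤ herdisc A
  disc≤herdisc {m} {n} A = ∈⇒≤max
    (∈-concatMap {f = λ k → concatMap (λ l → concatMap (λ rows → map (λ cols → disc (submatrix A rows cols))
      (choose l (suc n))) (choose k (suc m))) (oneTo (suc n))}
      (last∈oneTo m)
    (∈-concatMap {f = λ l → concatMap (λ rows → map (λ cols → disc (submatrix A rows cols))
      (choose l (suc n))) (choose (suc m) (suc m))}
      (last∈oneTo n)
    (∈-concatMap {f = λ rows → map (λ cols → disc (submatrix A rows cols)) (choose (suc n) (suc n))}
      (allFin∈choose (suc m))
    (∈-map⁺ (λ cols → disc (submatrix A (Vec.allFin (suc m)) cols)) (allFin∈choose (suc n))))))
    where
    last∈oneTo : ∀ n → suc n ∈ˡ oneTo (suc n)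
    last∈oneTo n = ∈-map⁺ suc (∈-upTo⁺ (ℕ.n<1+n n))

  -- The submatrix of all rows and columns already witnesses the bound. The constant c stands in for
  -- a division of D.
  herdisc-bound : ∀ {m n} (A : Matrix m n) D c → 1 ℕ.≤ m → 1 ℕ.≤ n →
    (∀ (x : Fin n → ℤ) → (∀ j → Sign (x j)) → ∃[ i ] D ℕ.≤ c ℕ.* ∣ sum (λ j → A i j * x j) ∣) →
    D ℕ.≤ c ℕ.* herdisc A
  herdisc-bound {suc m} {suc n} A D c _ _ large = begin
    D                                                       ≤⟨ proj₂ row ⟩
    c ℕ.* ∣ sum (λ j → A i j * lookup x j) ∣
      ≡⟨ cong (λ z → c ℕ.* ∣ z ∣) (sum-cong-≗ (λ j → cong (_* lookup x j)
          (sym (cong₂ A (Vec.lookup-allFin i) (Vec.lookup-allFin j))))) ⟩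
    c ℕ.* ∣ sum (λ j → B i j * lookup x j) ∣
      ≤⟨ ℕ.*-monoʳ-≤ c (∈⇒≤max (∈-map⁺ (λ i → ∣ sum (λ j → B i j * lookup x j) ∣) (∈-allFin i))) ⟩
    c ℕ.* ‖ B · x ‖∞                                        ≡⟨ cong (c ℕ.*_) (proj₂ (proj₂ minimiser)) ⟨
    c ℕ.* disc B                                            ≤⟨ ℕ.*-monoʳ-≤ c (disc≤herdisc A) ⟩
    c ℕ.* herdisc A                                         ∎
    where
    open ℕ.≤-Reasoning
    B : Matrix (suc m) (suc n)
    B = submatrix A (Vec.allFin (suc m)) (Vec.allFin (suc n))
    minimiser = min±-attained (λ x → ‖ B · x ‖∞)
    x = proj₁ minimiser
    row = large (lookup x) (proj₁ (proj₂ minimiser))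
    i = proj₁ row

  sum-↑ : ∀ a {b} (f : Fin (a ℕ.+ b) → ℤ) → sum f ≡ sum (λ i → f (i ↑ˡ b)) + sum (λ i → f (a ↑ʳ i))
  sum-↑ zero    f = sym (ℤ.+-identityˡ (sum f))
  sum-↑ (suc a) {b} f = trans (cong (_+_ (f zero)) (sum-↑ a (f ∘ suc)))
    (sym (ℤ.+-assoc (f zero) (sum (λ i → f (suc (i ↑ˡ b)))) (sum (λ i → f (suc (a ↑ʳ i))))))

  sum-combine : ∀ a k (f : Fin (a ℕ.* k) → ℤ) → sum f ≡ sum (λ v → sum (λ i → f (combine {a} v i)))
  sum-combine zero    k f = refl
  sum-combine (suc a) k f = trans (sum-↑ k f)
    (cong (_+_ (sum (λ i → f (i ↑ˡ (a ℕ.* k))))) (sum-combine a k (λ c → f (k ↑ʳ c))))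

  sideSum : ∀ h → Bool → Vec Bool h → (Fin (nodes h) → ℤ) → ℤ
  sideSum h σ p X = sum (λ v → ⟦ below h σ p v ⟧ * X v)

  child : ∀ h → Bool → Fin (nodes h) → Fin (nodes (suc h))
  child h b u = suc (if b then nodes h ↑ʳ u else u ↑ˡ nodes h)

  sum-false : ∀ {n} (X : Fin n → ℤ) → sum (λ u → 0ℤ * X u) ≡ 0ℤ
  sum-false {zero}  X = refl
  sum-false {suc n} X = trans (ℤ.+-identityˡ (sum (λ u → 0ℤ * X (suc u)))) (sum-false (X ∘ suc))

  sideSum-∷ : ∀ h σ b p X → sideSum (suc h) σ (b ∷ p) X ≡
              ⟦ if b then σ else not σ ⟧ * X zero + sideSum h σ p (X ∘ child h b)
  sideSum-∷ h σ b p X = cong (_+_ (⟦ if b then σ else not σ ⟧ * X zero)) (begin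
    sum (λ j → ⟦ below (suc h) σ (b ∷ p) (suc j) ⟧ * X (suc j))
      ≡⟨ sum-↑ (nodes h) (λ j → ⟦ below (suc h) σ (b ∷ p) (suc j) ⟧ * X (suc j)) ⟩
    sum (λ u → ⟦ below (suc h) σ (b ∷ p) (suc (u ↑ˡ nodes h)) ⟧ * X (suc (u ↑ˡ nodes h))) +
    sum (λ u → ⟦ below (suc h) σ (b ∷ p) (suc (nodes h ↑ʳ u)) ⟧ * X (suc (nodes h ↑ʳ u)))
      ≡⟨ cong₂ _+_
          (sum-cong-≗ (λ u → cong
            (λ z → ⟦ [ (λ u → not b ∧ below h σ p u) , (λ u → b ∧ below h σ p u) ]′ z ⟧ * X (suc (u ↑ˡ nodes h)))
            (Fin.splitAt-↑ˡ (nodes h) u (nodes h))))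
          (sum-cong-≗ (λ u → cong
            (λ z → ⟦ [ (λ u → not b ∧ below h σ p u) , (λ u → b ∧ below h σ p u) ]′ z ⟧ * X (suc (nodes h ↑ʳ u)))
            (Fin.splitAt-↑ʳ (nodes h) (nodes h) u))) ⟩
    sum (λ u → ⟦ not b ∧ below h σ p u ⟧ * X (suc (u ↑ˡ nodes h))) +
    sum (λ u → ⟦ b ∧ below h σ p u ⟧ * X (suc (nodes h ↑ʳ u)))
      ≡⟨ select b ⟩
    sideSum h σ p (X ∘ child h b) ∎)
    where
    open ≡-Reasoning
    select : ∀ b → sum (λ u → ⟦ not b ∧ below h σ p u ⟧ * X (suc (u ↑ˡ nodes h))) +
                   sum (λ u → ⟦ b ∧ below h σ p u ⟧ * X (suc (nodes h ↑ʳ u))) ≡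
                   sideSum h σ p (X ∘ child h b)
    select false = trans (cong (_+_ (sideSum h σ p (X ∘ child h false))) (sum-false (λ u → X (suc (nodes h ↑ʳ u)))))
                         (ℤ.+-identityʳ (sideSum h σ p (X ∘ child h false)))
    select true  = trans (cong (_+ sideSum h σ p (X ∘ child h true)) (sum-false (λ u → X (suc (u ↑ˡ nodes h)))))
                         (ℤ.+-identityˡ (sideSum h σ p (X ∘ child h true)))

  walk : ∀ h → Vec Bool h → (Fin (nodes h) → ℤ) → ℤ
  walk h p X = sideSum h true p X - sideSum h false p X

  -- The path leaves the root on exactly one side, so the root's label enters with the sign of the
  -- turn. On a random path each step is therefore a fair ±1, whatever the labels are.
  walk-∷ : ∀ h b p X → walk (suc h) (b ∷ p) X ≡ (if b then X zero else - X zero) + walk h p (X ∘ child h b)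
  walk-∷ h b p X = trans (cong₂ _-_ (sideSum-∷ h true b p X) (sideSum-∷ h false b p X))
    (step b (sideSum h true p (X ∘ child h b)) (sideSum h false p (X ∘ child h b)))
    where
    ring₁ : ∀ x y z → 0ℤ * x + y - (1ℤ * x + z) ≡ - x + (y - z)
    ring₁ = solve-∀
    ring₂ : ∀ x y z → 1ℤ * x + y - (0ℤ * x + z) ≡ x + (y - z)
    ring₂ = solve-∀
    step : ∀ b y z → ⟦ if b then true else false ⟧ * X zero + y - (⟦ if b then false else true ⟧ * X zero + z) ≡
                     (if b then X zero else - X zero) + (y - z)
    step false = ring₁ (X zero)
    step true  = ring₂ (X zero)

  sumPaths : ∀ h → (Vec Bool h → ℤ) → ℤ
  sumPaths zero    g = g []
  sumPaths (suc h) g = sumPaths h (λ p → g (false ∷ p)) + sumPaths h (λ p → g (true ∷ p))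

  sumPaths-cong : ∀ h {g g′} → g ≗ g′ → sumPaths h g ≡ sumPaths h g′
  sumPaths-cong zero    g≗g′ = g≗g′ []
  sumPaths-cong (suc h) g≗g′ =
    cong₂ _+_ (sumPaths-cong h (λ p → g≗g′ (false ∷ p))) (sumPaths-cong h (λ p → g≗g′ (true ∷ p)))

  sumPaths-sum : ∀ h {k} (g : Fin k → Vec Bool h → ℤ) →
                 sumPaths h (λ p → sum (λ i → g i p)) ≡ sum (λ i → sumPaths h (g i))
  sumPaths-sum zero    g = refl
  sumPaths-sum (suc h) g = trans
    (cong₂ _+_ (sumPaths-sum h (λ i p → g i (false ∷ p))) (sumPaths-sum h (λ i p → g i (true ∷ p))))
    (sym (∑-distrib-+ (λ i → sumPaths h (λ p → g i (false ∷ p))) (λ i → sumPaths h (λ p → g i (true ∷ p)))))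

  ≤-+-split : ∀ {d e} a b → d + e ≤ a + b → d ≤ a ⊎ e ≤ b
  ≤-+-split {d} {e} a b de≤ab with d ℤ.≤? a
  ... | yes d≤a = inj₁ d≤a
  ... | no  d≰a = inj₂ (ℤ.≮⇒≥ λ b<e → ℤ.<⇒≱ (ℤ.+-mono-< (ℤ.≰⇒> d≰a) b<e) de≤ab)

  2^1+h* : ∀ h b → + (2 ℕ.^ suc h) * b ≡ + (2 ℕ.^ h) * b + + (2 ℕ.^ h) * b
  2^1+h* h b = trans (cong (_* b) (ℤ.pos-* 2 (2 ℕ.^ h))) (ring (+ (2 ℕ.^ h)) b)
    where
    ring : ∀ x b → + 2 * x * b ≡ x * b + x * b
    ring = solve-∀

  sumPaths-average : ∀ h g b → + (2 ℕ.^ h) * b ≤ sumPaths h g → ∃[ p ] b ≤ g p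
  sumPaths-average zero    g b b≤ = [] , subst (_≤ g []) (ℤ.*-identityˡ b) b≤
  sumPaths-average (suc h) g b b≤
    with ≤-+-split (sumPaths h (λ p → g (false ∷ p))) (sumPaths h (λ p → g (true ∷ p)))
                   (subst (_≤ sumPaths (suc h) g) (2^1+h* h b) b≤)
  ... | inj₁ left  = let p , b≤gp = sumPaths-average h (λ p → g (false ∷ p)) b left in false ∷ p , b≤gp
  ... | inj₂ right = let p , b≤gp = sumPaths-average h (λ p → g (true ∷ p)) b right in true ∷ p , b≤gp

  -- A lower bound for 2r³|z|, since |z| (|z| − r)² (|z| + 2r) ≥ 0, whose mean over
  -- a random walk is explicit.
  Φ : ℤ → ℤ → ℤ
  Φ r z = + 3 * (r * r) * (z * z) - z * z * (z * z)

  -- For a simple random walk S of length h started at s, the second moment is s² + h and the fourth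
  -- is s⁴ + 6hs² + 3h² - 2h.
  ΦMean : ℤ → ℤ → ℤ → ℤ
  ΦMean r s h = + 3 * (r * r) * (s * s + h) - (s * s * (s * s) + + 6 * h * (s * s) + + 3 * (h * h) - + 2 * h)

  -- Induction on the first step, with s free to absorb it. The two subtrees carry different labels,
  -- but the mean does not see them; the label of the root only decides which of the two branches
  -- goes up.
  sumPaths-Φ : ∀ r h s (X : Fin (nodes h) → ℤ) → (∀ v → Sign (X v)) →
               sumPaths h (λ p → Φ r (s + walk h p X)) ≡ + (2 ℕ.^ h) * ΦMean r s (+ h)
  sumPaths-Φ r zero    s X sX = ring r s
    where
    ring : ∀ r s → + 3 * (r * r) * ((s + 0ℤ) * (s + 0ℤ)) - (s + 0ℤ) * (s + 0ℤ) * ((s + 0ℤ) * (s + 0ℤ)) ≡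
      1ℤ * (+ 3 * (r * r) * (s * s + 0ℤ) - (s * s * (s * s) + + 6 * 0ℤ * (s * s) + + 3 * (0ℤ * 0ℤ) - + 2 * 0ℤ))
    ring = solve-∀
  sumPaths-Φ r (suc h) s X sX = begin
    sumPaths h (λ p → Φ r (s + walk (suc h) (false ∷ p) X)) + sumPaths h (λ p → Φ r (s + walk (suc h) (true ∷ p) X))
      ≡⟨ cong₂ _+_ (half false) (half true) ⟩
    + (2 ℕ.^ h) * ΦMean r (s + - X zero) (+ h) + + (2 ℕ.^ h) * ΦMean r (s + X zero) (+ h)
      ≡⟨ step (X zero) (sX zero) ⟩
    + (2 ℕ.^ h) * ΦMean r s (1ℤ + + h) + + (2 ℕ.^ h) * ΦMean r s (1ℤ + + h)
      ≡⟨ 2^1+h* h (ΦMean r s (1ℤ + + h)) ⟨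
    + (2 ℕ.^ suc h) * ΦMean r s (1ℤ + + h) ∎
    where
    open ≡-Reasoning
    half : ∀ b → sumPaths h (λ p → Φ r (s + walk (suc h) (b ∷ p) X)) ≡
                 + (2 ℕ.^ h) * ΦMean r (s + (if b then X zero else - X zero)) (+ h)
    half b = trans (sumPaths-cong h (λ p → cong (Φ r) (trans (cong (_+_ s) (walk-∷ h b p X))
        (sym (ℤ.+-assoc s (if b then X zero else - X zero) (walk h p (X ∘ child h b)))))))
      (sumPaths-Φ r h (s + (if b then X zero else - X zero)) (X ∘ child h b) (sX ∘ child h b))
    ring : ∀ w r s h →
      w * (+ 3 * (r * r) * ((s + -1ℤ) * (s + -1ℤ) + h)
        - ((s + -1ℤ) * (s + -1ℤ) * ((s + -1ℤ) * (s + -1ℤ)) + + 6 * h * ((s + -1ℤ) * (s + -1ℤ)) + + 3 * (h * h) - + 2 * h)) +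
      w * (+ 3 * (r * r) * ((s + 1ℤ) * (s + 1ℤ) + h)
        - ((s + 1ℤ) * (s + 1ℤ) * ((s + 1ℤ) * (s + 1ℤ)) + + 6 * h * ((s + 1ℤ) * (s + 1ℤ)) + + 3 * (h * h) - + 2 * h)) ≡
      w * (+ 3 * (r * r) * (s * s + (1ℤ + h))
        - (s * s * (s * s) + + 6 * (1ℤ + h) * (s * s) + + 3 * ((1ℤ + h) * (1ℤ + h)) - + 2 * (1ℤ + h))) +
      w * (+ 3 * (r * r) * (s * s + (1ℤ + h))
        - (s * s * (s * s) + + 6 * (1ℤ + h) * (s * s) + + 3 * ((1ℤ + h) * (1ℤ + h)) - + 2 * (1ℤ + h)))
    ring = solve-∀
    step : ∀ x → Sign x → + (2 ℕ.^ h) * ΦMean r (s + - x) (+ h) + + (2 ℕ.^ h) * ΦMean r (s + x) (+ h) ≡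
           + (2 ℕ.^ h) * ΦMean r s (1ℤ + + h) + + (2 ℕ.^ h) * ΦMean r s (1ℤ + + h)
    step _ (inj₁ refl) = ring (+ (2 ℕ.^ h)) r s (+ h)
    step _ (inj₂ refl) = trans
      (ℤ.+-comm (+ (2 ℕ.^ h) * ΦMean r (s + 1ℤ) (+ h)) (+ (2 ℕ.^ h) * ΦMean r (s + -1ℤ) (+ h)))
      (ring (+ (2 ℕ.^ h)) r s (+ h))

  0≤* : ∀ {i j} → 0ℤ ≤ i → 0ℤ ≤ j → 0ℤ ≤ i * j
  0≤* {i} {j} 0≤i 0≤j = subst (_≤ i * j) (ℤ.*-zeroʳ i) (ℤ.*-monoˡ-≤-nonNeg i {{ℤ.nonNegative 0≤i}} 0≤j)

  Φ-≤ : ∀ r z → 0ℤ ≤ r → Φ r z ≤ + 2 * (r * r * r) * + ∣ z ∣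
  Φ-≤ r z 0≤r = ℤ.0≤i-j⇒j≤i (subst (0ℤ ≤_) eq
    (0≤* (0≤* 0≤a (0≤i*i (a - r))) (ℤ.+-mono-≤ 0≤a (0≤* {+ 2} (+≤+ ℕ.z≤n) 0≤r))))
    where
    a = + ∣ z ∣
    0≤a : 0ℤ ≤ a
    0≤a = +≤+ ℕ.z≤n
    z*z≡a*a : ∀ z → z * z ≡ + ∣ z ∣ * + ∣ z ∣
    z*z≡a*a (+ n)    = refl
    z*z≡a*a -[1+ n ] = refl
    ring : ∀ a r → a * ((a - r) * (a - r)) * (a + + 2 * r) ≡
                   + 2 * (r * r * r) * a - (+ 3 * (r * r) * (a * a) - a * a * (a * a))
    ring = solve-∀
    eq : a * ((a - r) * (a - r)) * (a + + 2 * r) ≡ + 2 * (r * r * r) * a - Φ r z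
    eq = trans (ring a r) (cong (λ w → + 2 * (r * r * r) * a - (+ 3 * (r * r) * w - w * w)) (sym (z*z≡a*a z)))

  sum-mono : ∀ {n} {f g : Fin n → ℤ} → (∀ i → f i ≤ g i) → sum f ≤ sum g
  sum-mono {zero}  f≤g = ℤ.≤-refl
  sum-mono {suc n} f≤g = ℤ.+-mono-≤ (f≤g zero) (sum-mono (f≤g ∘ suc))

  sum-const : ∀ k c → sum {k} (λ _ → c) ≡ + k * c
  sum-const zero    c = refl
  sum-const (suc k) c = trans (cong (_+_ c) (sum-const k c)) (sym (ℤ.suc-* (+ k) c))

  -- With r = 2T and length T² the mean is 12T⁴ - 3T⁴ + 2T² = 9T⁴ + 2T², which exceeds 8T⁴, while
  -- 2r³ = 16T³. Cancelling 8T³ leaves K T ≤ 2W.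
  ΦMean-0 : ∀ K T W → 0ℤ ≤ K → K * ΦMean (+ 2 * T) 0ℤ (T * T) ≤ + 2 * (+ 2 * T * (+ 2 * T) * (+ 2 * T)) * W →
            + 8 * (T * T * T) * (K * T) ≤ + 8 * (T * T * T) * (+ 2 * W)
  ΦMean-0 K T W 0≤K mean≤ = begin
    + 8 * (T * T * T) * (K * T)
      ≤⟨ ℤ.0≤i-j⇒j≤i (subst (0ℤ ≤_) (ring₁ K T)
           (0≤* 0≤K (ℤ.+-mono-≤ (0≤i*i (T * T)) (ℤ.+-mono-≤ (0≤i*i T) (0≤i*i T))))) ⟩
    K * ΦMean (+ 2 * T) 0ℤ (T * T)                       ≤⟨ mean≤ ⟩
    + 2 * (+ 2 * T * (+ 2 * T) * (+ 2 * T)) * W          ≡⟨ ring₂ T W ⟩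
    + 8 * (T * T * T) * (+ 2 * W)                        ∎
    where
    open ℤ.≤-Reasoning
    ring₁ : ∀ k t → k * (t * t * (t * t) + (t * t + t * t)) ≡
      k * (+ 3 * ((+ 2 * t) * (+ 2 * t)) * (0ℤ * 0ℤ + t * t) -
        (0ℤ * 0ℤ * (0ℤ * 0ℤ) + + 6 * (t * t) * (0ℤ * 0ℤ) + + 3 * (t * t * (t * t)) - + 2 * (t * t))) -
      + 8 * (t * t * t) * (k * t)
    ring₁ = solve-∀
    ring₂ : ∀ t s → + 2 * (+ 2 * t * (+ 2 * t) * (+ 2 * t)) * s ≡ + 8 * (t * t * t) * (+ 2 * s)
    ring₂ = solve-∀

  *-cancelˡ-8t³ : ∀ t .{{_ : ℕ.NonZero t}} {i j} → + 8 * (+ t * + t * + t) * i ≤ + 8 * (+ t * + t * + t) * j → i ≤ j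
  *-cancelˡ-8t³ (suc t) {i} {j} = ℤ.*-cancelˡ-≤-pos i j (+ 8 * (+ suc t * + suc t * + suc t))

  sumPaths-sum-Φ : ∀ r h {k} (X : Fin (nodes h) → Fin k → ℤ) → (∀ v i → Sign (X v i)) →
    sumPaths h (λ p → sum (λ i → Φ r (0ℤ + walk h p (λ v → X v i)))) ≡ + (2 ℕ.^ h) * (+ k * ΦMean r 0ℤ (+ h))
  sumPaths-sum-Φ r h {k} X sX = begin
    sumPaths h (λ p → sum (λ i → Φ r (0ℤ + walk h p (λ v → X v i))))
      ≡⟨ sumPaths-sum h (λ i p → Φ r (0ℤ + walk h p (λ v → X v i))) ⟩
    sum (λ i → sumPaths h (λ p → Φ r (0ℤ + walk h p (λ v → X v i))))
      ≡⟨ sum-cong-≗ (λ i → sumPaths-Φ r h 0ℤ (λ v → X v i) (λ v → sX v i)) ⟩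
    sum {k} (λ i → + (2 ℕ.^ h) * ΦMean r 0ℤ (+ h))   ≡⟨ sum-const k (+ (2 ℕ.^ h) * ΦMean r 0ℤ (+ h)) ⟩
    + k * (+ (2 ℕ.^ h) * ΦMean r 0ℤ (+ h))           ≡⟨ ring (+ k) (+ (2 ℕ.^ h)) (ΦMean r 0ℤ (+ h)) ⟩
    + (2 ℕ.^ h) * (+ k * ΦMean r 0ℤ (+ h))           ∎
    where
    open ≡-Reasoning
    ring : ∀ a b c → a * (b * c) ≡ b * (a * c)
    ring = solve-∀

  large-walks-Φ : ∀ r h {k} (X : Fin (nodes h) → Fin k → ℤ) → (∀ v i → Sign (X v i)) → 0ℤ ≤ r →
    ∃[ p ] + k * ΦMean r 0ℤ (+ h) ≤ + 2 * (r * r * r) * sum (λ i → + ∣ walk h p (λ v → X v i) ∣)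
  large-walks-Φ r h {k} X sX 0≤r = proj₁ average , (begin
    + k * ΦMean r 0ℤ (+ h)                            ≤⟨ proj₂ average ⟩
    sum (λ i → Φ r (0ℤ + w i))                        ≡⟨ sum-cong-≗ (λ i → cong (Φ r) (ℤ.+-identityˡ (w i))) ⟩
    sum (λ i → Φ r (w i))                             ≤⟨ sum-mono (λ i → Φ-≤ r (w i) 0≤r) ⟩
    sum (λ i → + 2 * (r * r * r) * + ∣ w i ∣)         ≡⟨ *-distribˡ-sum (+ 2 * (r * r * r)) (λ i → + ∣ w i ∣) ⟨
    + 2 * (r * r * r) * sum (λ i → + ∣ w i ∣)         ∎)
    where
    open ℤ.≤-Reasoning
    average = sumPaths-average h (λ p → sum (λ i → Φ r (0ℤ + walk h p (λ v → X v i)))) (+ k * ΦMean r 0ℤ (+ h))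
      (ℤ.≤-reflexive (sym (sumPaths-sum-Φ r h X sX)))
    w : Fin k → ℤ
    w i = walk h (proj₁ average) (λ v → X v i)

  large-walks : ∀ t h .{{_ : ℕ.NonZero t}} {k} → h ≡ t ℕ.* t →
    (X : Fin (nodes h) → Fin k → ℤ) → (∀ v i → Sign (X v i)) →
    ∃[ p ] + k * + t ≤ + 2 * sum (λ i → + ∣ walk h p (λ v → X v i) ∣)
  large-walks t h {k} h≡t² X sX = p , *-cancelˡ-8t³ t
    (ΦMean-0 (+ k) (+ t) (sum (λ i → + ∣ walk h p (λ v → X v i) ∣)) (+≤+ ℕ.z≤n)
    (subst (λ z → + k * ΦMean (+ 2 * + t) 0ℤ z ≤
                  + 2 * (+ 2 * + t * (+ 2 * + t) * (+ 2 * + t)) * sum (λ i → + ∣ walk h p (λ v → X v i) ∣))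
      (trans (cong +_ h≡t²) (ℤ.pos-* t t)) (proj₂ large)))
    where
    large = large-walks-Φ (+ 2 * + t) h X sX (0≤* {+ 2} {+ t} (+≤+ ℕ.z≤n) (+≤+ ℕ.z≤n))
    p = proj₁ large

  -- S marks the nonnegative values and S′ the negative ones.
  sum-abs : ∀ {k} (y : Fin k → ℤ) → ∃[ S ] ∃[ S′ ]
    sum (λ i → + ∣ y i ∣) ≡ sum (λ i → ⟦ lookup S i ⟧ * y i) - sum (λ i → ⟦ lookup S′ i ⟧ * y i)
  sum-abs {zero}  y = [] , [] , refl
  sum-abs {suc k} y with sum-abs (y ∘ suc)
  ... | S , S′ , eq with y zero
  ...   | + n = true ∷ S , false ∷ S′ , trans (cong (_+_ (+ n)) eq) (ring (+ n) (value S) (value S′))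
    where
    value : Vec Bool _ → ℤ
    value S = sum (λ i → ⟦ lookup S i ⟧ * y (suc i))
    ring : ∀ n a b → n + (a - b) ≡ 1ℤ * n + a - (0ℤ + b)
    ring = solve-∀
  ...   | -[1+ n ] = false ∷ S , true ∷ S′ , trans (cong (_+_ (+ suc n)) eq) (ring -[1+ n ] (value S) (value S′))
    where
    value : Vec Bool _ → ℤ
    value S = sum (λ i → ⟦ lookup S i ⟧ * y (suc i))
    ring : ∀ n a b → - n + (a - b) ≡ 0ℤ + a - (1ℤ * n + b)
    ring = solve-∀

  i≤+∣i∣ : ∀ i → i ≤ + ∣ i ∣
  i≤+∣i∣ (+ n)    = ℤ.≤-refl
  i≤+∣i∣ -[1+ n ] = -≤+

  halve-+ : ∀ {d} a b → d ≤ a + b → d ≤ + 2 * a ⊎ d ≤ + 2 * b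
  halve-+ {d} a b d≤ = ≤-+-split (+ 2 * a) (+ 2 * b) (begin
    d + d                 ≤⟨ ℤ.+-mono-≤ d≤ d≤ ⟩
    (a + b) + (a + b)     ≡⟨ ring a b ⟩
    + 2 * a + + 2 * b     ∎)
    where
    open ℤ.≤-Reasoning
    ring : ∀ a b → (a + b) + (a + b) ≡ + 2 * a + + 2 * b
    ring = solve-∀

  halve-abs : ∀ {d} a b → d ≤ + 4 * (a - b) → d ≤ + 8 * + ∣ a ∣ ⊎ d ≤ + 8 * + ∣ b ∣
  halve-abs {d} a b d≤ = Sum.map (subst (d ≤_) (ring (+ ∣ a ∣))) (subst (d ≤_) (ring (+ ∣ b ∣)))
    (halve-+ (+ 4 * + ∣ a ∣) (+ 4 * + ∣ b ∣) (begin
      d                                 ≤⟨ d≤ ⟩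
      + 4 * (a - b)                     ≤⟨ ℤ.*-monoˡ-≤-nonNeg (+ 4) (i≤+∣i∣ (a - b)) ⟩
      + 4 * + ∣ a - b ∣                 ≤⟨ ℤ.*-monoˡ-≤-nonNeg (+ 4) (+≤+ (ℤ.∣i-j∣≤∣i∣+∣j∣ a b)) ⟩
      + 4 * (+ ∣ a ∣ + + ∣ b ∣)         ≡⟨ ℤ.*-distribˡ-+ (+ 4) (+ ∣ a ∣) (+ ∣ b ∣) ⟩
      + 4 * + ∣ a ∣ + + 4 * + ∣ b ∣     ∎))
    where
    open ℤ.≤-Reasoning
    ring : ∀ i → + 2 * (+ 4 * i) ≡ + 8 * i
    ring = solve-∀

  large-subset : ∀ {k d} (y : Fin k → ℤ) → d ≤ + 4 * sum (λ i → + ∣ y i ∣) →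
                 ∃[ S ] d ≤ + 8 * + ∣ sum (λ i → ⟦ lookup S i ⟧ * y i) ∣
  large-subset {d = d} y d≤ = [ (λ le → proj₁ sets , le) , (λ le → proj₁ (proj₂ sets) , le) ]′
    (halve-abs (sum (λ i → ⟦ lookup (proj₁ sets) i ⟧ * y i)) (sum (λ i → ⟦ lookup (proj₁ (proj₂ sets)) i ⟧ * y i))
      (subst (λ z → d ≤ + 4 * z) (proj₂ (proj₂ sets)) d≤))
    where sets = sum-abs y

  large-side : ∀ {k d} (y z : Fin k → ℤ) → d ≤ + 2 * sum (λ i → + ∣ y i - z i ∣) →
               d ≤ + 4 * sum (λ i → + ∣ y i ∣) ⊎ d ≤ + 4 * sum (λ i → + ∣ z i ∣)
  large-side {d = d} y z d≤ = Sum.map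
    (subst (d ≤_) (ring (sum (λ i → + ∣ y i ∣))))
    (subst (d ≤_) (ring (sum (λ i → + ∣ z i ∣))))
    (halve-+ (+ 2 * sum (λ i → + ∣ y i ∣)) (+ 2 * sum (λ i → + ∣ z i ∣)) (begin
      d                                              ≤⟨ d≤ ⟩
      + 2 * sum (λ i → + ∣ y i - z i ∣)
        ≤⟨ ℤ.*-monoˡ-≤-nonNeg (+ 2) (sum-mono (λ i → +≤+ (ℤ.∣i-j∣≤∣i∣+∣j∣ (y i) (z i)))) ⟩
      + 2 * sum (λ i → + ∣ y i ∣ + + ∣ z i ∣)
        ≡⟨ cong (_*_ (+ 2)) (∑-distrib-+ (λ i → + ∣ y i ∣) (λ i → + ∣ z i ∣)) ⟩
      + 2 * (sum (λ i → + ∣ y i ∣) + sum (λ i → + ∣ z i ∣))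
        ≡⟨ ℤ.*-distribˡ-+ (+ 2) (sum (λ i → + ∣ y i ∣)) (sum (λ i → + ∣ z i ∣)) ⟩
      + 2 * sum (λ i → + ∣ y i ∣) + + 2 * sum (λ i → + ∣ z i ∣) ∎))
    where
    open ℤ.≤-Reasoning
    ring : ∀ i → + 2 * (+ 2 * i) ≡ + 4 * i
    ring = solve-∀

  module TreeDiscrepancy (t h k r : ℕ) .{{_ : ℕ.NonZero t}} .{{_ : ℕ.NonZero k}} (h≡t² : h ≡ t ℕ.* t) where

    open Construction h k r

    column : Fin (nodes h) → Fin k → Fin n
    column v i = combine v i ↑ˡ r

    row-sum : ∀ σ p S (x : Fin n → ℤ) → sum (λ j → ⟦ entry (σ ∷ p , S) j ⟧ * x j) ≡
              sum (λ i → ⟦ lookup S i ⟧ * sideSum h σ p (λ v → x (column v i)))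
    row-sum σ p S x = begin
      sum (λ j → ⟦ entry (σ ∷ p , S) j ⟧ * x j)
        ≡⟨ sum-↑ (nodes h ℕ.* k) (λ j → ⟦ entry (σ ∷ p , S) j ⟧ * x j) ⟩
      sum (λ c → ⟦ entry (σ ∷ p , S) (c ↑ˡ r) ⟧ * x (c ↑ˡ r)) +
      sum (λ c → ⟦ entry (σ ∷ p , S) (nodes h ℕ.* k ↑ʳ c) ⟧ * x (nodes h ℕ.* k ↑ʳ c))
        ≡⟨ cong₂ _+_ (sum-combine (nodes h) k (λ c → ⟦ entry (σ ∷ p , S) (c ↑ˡ r) ⟧ * x (c ↑ˡ r)))
             (trans (sum-cong-≗ (λ c → cong (λ z → ⟦ z ⟧ * x (nodes h ℕ.* k ↑ʳ c)) (padding c)))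
                    (sum-false (λ c → x (nodes h ℕ.* k ↑ʳ c)))) ⟩
      sum (λ v → sum (λ i → ⟦ entry (σ ∷ p , S) (column v i) ⟧ * x (column v i))) + 0ℤ
        ≡⟨ ℤ.+-identityʳ _ ⟩
      sum (λ v → sum (λ i → ⟦ entry (σ ∷ p , S) (column v i) ⟧ * x (column v i)))
        ≡⟨ ∑-comm (λ v i → ⟦ entry (σ ∷ p , S) (column v i) ⟧ * x (column v i)) ⟩
      sum (λ i → sum (λ v → ⟦ entry (σ ∷ p , S) (column v i) ⟧ * x (column v i)))
        ≡⟨ sum-cong-≗ (λ i → trans (sum-cong-≗ (λ v → term v i))
             (sym (*-distribˡ-sum ⟦ lookup S i ⟧ (λ v → ⟦ below h σ p v ⟧ * x (column v i))))) ⟩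
      sum (λ i → ⟦ lookup S i ⟧ * sideSum h σ p (λ v → x (column v i))) ∎
      where
      open ≡-Reasoning
      inside : Fin (nodes h ℕ.* k) → Bool
      inside c = let v , i = remQuot {nodes h} k c in below h σ p v ∧ lookup S i
      padding : ∀ c → entry (σ ∷ p , S) (nodes h ℕ.* k ↑ʳ c) ≡ false
      padding c = cong [ inside , (λ _ → false) ]′ (Fin.splitAt-↑ʳ (nodes h ℕ.* k) r c)
      entry-column : ∀ v i → entry (σ ∷ p , S) (column v i) ≡ below h σ p v ∧ lookup S i
      entry-column v i = trans (cong [ inside , (λ _ → false) ]′ (Fin.splitAt-↑ˡ (nodes h ℕ.* k) (combine v i) r))
        (cong (λ (v , i) → below h σ p v ∧ lookup S i) (Fin.remQuot-combine v i))
      ⟦∧⟧ : ∀ a b z → ⟦ a ∧ b ⟧ * z ≡ ⟦ b ⟧ * (⟦ a ⟧ * z)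
      ⟦∧⟧ true  b z = cong (_*_ ⟦ b ⟧) (sym (ℤ.*-identityˡ z))
      ⟦∧⟧ false b z = sym (ℤ.*-zeroʳ ⟦ b ⟧)
      term : ∀ v i → ⟦ entry (σ ∷ p , S) (column v i) ⟧ * x (column v i) ≡
                     ⟦ lookup S i ⟧ * (⟦ below h σ p v ⟧ * x (column v i))
      term v i = trans (cong (λ z → ⟦ z ⟧ * x (column v i)) (entry-column v i))
                       (⟦∧⟧ (below h σ p v) (lookup S i) (x (column v i)))

    large-row-on-side : ∀ (x : Fin n → ℤ) d σ p → d ≤ + 4 * sum (λ i → + ∣ sideSum h σ p (λ v → x (column v i)) ∣) →
      ∃[ ρ ] d ≤ + 8 * + ∣ sum (λ j → ⟦ entry ρ j ⟧ * x j) ∣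
    large-row-on-side x d σ p d≤ =
      let S , d≤′ = large-subset (λ i → sideSum h σ p (λ v → x (column v i))) d≤ in
      (σ ∷ p , S) , subst (λ z → d ≤ + 8 * + ∣ z ∣) (sym (row-sum σ p S x)) d≤′

    large-row-on-path : ∀ (x : Fin n → ℤ) d p → d ≤ + 2 * sum (λ i → + ∣ walk h p (λ v → x (column v i)) ∣) →
      ∃[ ρ ] d ≤ + 8 * + ∣ sum (λ j → ⟦ entry ρ j ⟧ * x j) ∣
    large-row-on-path x d p d≤ = [ large-row-on-side x d true p , large-row-on-side x d false p ]′
      (large-side (λ i → sideSum h true p (λ v → x (column v i))) (λ i → sideSum h false p (λ v → x (column v i))) d≤)

    -- The 8 is a product of three factors 2: the mean absolute value of a walk, the choice of a
    -- side, and the choice between nonnegative and negative values.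
    large-row : ∀ (x : Fin n → ℤ) → (∀ j → Sign (x j)) →
      ∃[ ρ ] + k * + t ≤ + 8 * + ∣ sum (λ j → ⟦ entry ρ j ⟧ * x j) ∣
    large-row x sx = large-row-on-path x (+ k * + t) (proj₁ large) (proj₂ large)
      where large = large-walks t h h≡t² (λ v i → x (column v i)) (λ v i → sx (column v i))

    treeMatrix-large : ∀ m → 2 ℕ.^ (suc h ℕ.+ k) ℕ.≤ m → ∀ (x : Fin n → ℤ) → (∀ j → Sign (x j)) →
      ∃[ i ] k ℕ.* t ℕ.≤ 8 ℕ.* ∣ sum (λ j → treeMatrix {m} i j * x j) ∣
    treeMatrix-large m 2^≤m x sx = present (proj₁ (large-row x sx)) (proj₂ (large-row x sx))
      where
      value : Vec Bool (suc h) × Vec Bool k → ℕ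
      value ρ = ∣ sum (λ j → ⟦ entry ρ j ⟧ * x j) ∣
      present : ∀ ρ → + k * + t ≤ + 8 * + value ρ → ∃[ i ] k ℕ.* t ℕ.≤ 8 ℕ.* value (row (toℕ {m} i))
      present (σp , S) d≤ with row-surjective σp S
      ... | z , z< , row≡ = fromℕ< z<m , subst (λ ρ → k ℕ.* t ℕ.≤ 8 ℕ.* value ρ)
        (sym (trans (cong row (Fin.toℕ-fromℕ< z<m)) row≡))
        (ℤ.drop‿+≤+ (subst₂ _≤_ (sym (ℤ.pos-* k t)) (sym (ℤ.pos-* 8 (value (σp , S)))) d≤))
        where
        z<m : z ℕ.< m
        z<m = ℕ.<-≤-trans z< 2^≤m

    treeMatrix-herdisc : ∀ m → 1 ℕ.≤ n → 2 ℕ.^ (suc h ℕ.+ k) ℕ.≤ m → k ℕ.* t ℕ.≤ 8 ℕ.* herdisc (treeMatrix {m})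
    treeMatrix-herdisc m 1≤n 2^≤m = herdisc-bound (treeMatrix {m}) (k ℕ.* t) 8
      (ℕ.≤-trans (ℕ.m^n>0 2 (suc h ℕ.+ k)) 2^≤m) 1≤n (treeMatrix-large m 2^≤m)

    -- Makes the determinant lower bound positive. With all signs equal to 1 some row sum is
    -- nonzero, so that row contains a 1.
    treeMatrix-one : ∀ m → 2 ℕ.^ (suc h ℕ.+ k) ℕ.≤ m → ∃[ i ] ∃[ j ] treeMatrix {m} i j ≡ 1ℤ
    treeMatrix-one m 2^≤m = nonzero (treeMatrix-large m 2^≤m (λ _ → 1ℤ) (λ _ → inj₁ refl))
      where
      one∈ : ∀ {n} (b : Fin n → Bool) → (∃[ j ] ⟦ b j ⟧ ≡ 1ℤ) ⊎ sum (λ j → ⟦ b j ⟧ * 1ℤ) ≡ 0ℤ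
      one∈ {zero}  b = inj₂ refl
      one∈ {suc n} b with b zero in eq | one∈ (b ∘ suc)
      ... | true  | _              = inj₁ (zero , cong ⟦_⟧ eq)
      ... | false | inj₁ (j , eq′) = inj₁ (suc j , eq′)
      ... | false | inj₂ sum≡0     = inj₂ (trans (ℤ.+-identityˡ _) sum≡0)
      nonzero : (∃[ i ] k ℕ.* t ℕ.≤ 8 ℕ.* ∣ sum (λ j → treeMatrix {m} i j * 1ℤ) ∣) →
                ∃[ i ] ∃[ j ] treeMatrix {m} i j ≡ 1ℤ
      nonzero (i , kt≤) with one∈ (entry (row (toℕ i)))
      ... | inj₁ one   = i , one
      ... | inj₂ sum≡0 = contradiction (subst (λ z → k ℕ.* t ℕ.≤ 8 ℕ.* ∣ z ∣) sum≡0 kt≤) (ℕ.<⇒≱ 0<kt)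
        where
        0<kt : 0 ℕ.< k ℕ.* t
        0<kt = ℕ.*-mono-≤ (ℕ.>-nonZero⁻¹ k) (ℕ.>-nonZero⁻¹ t)

open Discrepancy

-- Integer form of the gap, and the matrix with a single 1

⟦⟧-01 : ∀ b → ⟦ b ⟧ ≡ 0ℤ ⊎ ⟦ b ⟧ ≡ 1ℤ
⟦⟧-01 false = inj₁ refl
⟦⟧-01 true  = inj₂ refl

^-cancelʳ-≤ : ∀ m {n o} .{{_ : NonZero m}} → n ℕ.^ m ℕ.≤ o ℕ.^ m → n ℕ.≤ o
^-cancelʳ-≤ m nᵐ≤oᵐ = ℕ.≮⇒≥ λ o<n → ℕ.<⇒≱ (ℕ.^-monoˡ-< m o<n) nᵐ≤oᵐ

square-cancel-≤ : ∀ {n o} → n ℕ.* n ℕ.≤ o ℕ.* o → n ℕ.≤ o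
square-cancel-≤ n²≤o² = ℕ.≮⇒≥ λ o<n → ℕ.<⇒≱ (ℕ.*-mono-< o<n o<n) n²≤o²

n≤2^n : ∀ n → n ℕ.≤ 2 ℕ.^ n
n≤2^n zero    = z≤n
n≤2^n (suc n) = ℕ.+-mono-≤ (ℕ.m^n>0 2 n) (ℕ.≤-trans (n≤2^n n) (ℕ.m≤m+n (2 ℕ.^ n) 0))

DetBound : ∀ {m n} → Matrix m n → ℕ → Set
DetBound {m} {n} A b = ∀ {K} (rows : Vec (Fin m) K) (cols : Vec (Fin n) K) → cols ∈ˡ choose K n →
  ∣ det (submatrix A rows cols) ∣ ℕ.≤ b ℕ.^ K

corner : ∀ {m n} → Fin m → Fin n → Bool
corner zero    zero    = true
corner zero    (suc _) = false
corner (suc _) _       = false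

cornerMatrix : ∀ {m n} → Matrix m n
cornerMatrix i j = ⟦ corner i j ⟧

-- The columns form one laminar family, so the general bound with k = 1 gives det² ≤ 2^K. The value
-- 2 is crude but costs only a constant.
cornerMatrix-det-bound : ∀ {m n} → DetBound (cornerMatrix {m} {n}) 2
cornerMatrix-det-bound {m} {n} {K} rows cols _ = square-cancel-≤ (begin
  ∣ d ∣ ℕ.* ∣ d ∣       ≡⟨ ℤ.abs-* d d ⟨
  ∣ d ℤ.* d ∣           ≤⟨ ∣∣-mono-≤ (0≤i*i d) (subst (λ z → z ℤ.* z ℤ.≤ + (2 ℕ.^ K)) (sym (det≡wedge M))
                             (laminar-wedge-bound {k = 1} (λ _ → zero) s laminar (replicate K true))) ⟩
  2 ℕ.^ K               ≤⟨ ℕ.m≤m*n (2 ℕ.^ K) (2 ℕ.^ K) {{ℕ.m^n≢0 2 K}} ⟩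
  2 ℕ.^ K ℕ.* 2 ℕ.^ K   ∎)
  where
  open ℕ.≤-Reasoning
  s : Fin K → Fin K → Bool
  s i j = corner (lookup rows i) (lookup cols j)
  M : Matrix K K
  M = submatrix cornerMatrix rows cols
  d = det M
  nested : ∀ {m n} (a b : Fin n) →
    (∀ (x : Fin m) → corner x b ≡ true → corner x a ≡ true) ⊎ (∀ (x : Fin m) → corner x b ≡ true → corner x a ≡ false)
  nested zero    zero    = inj₁ λ _ → id
  nested zero    (suc b) = inj₁ λ { zero () ; (suc _) () }
  nested (suc a) b       = inj₂ λ { zero _ → refl ; (suc _) _ → refl }
  laminar : Laminar {Fin K} {K} {1} (λ _ → zero) s
  laminar {j} {l} _ _ = Sum.map (λ f x → f (lookup rows x)) (λ f x → f (lookup rows x))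
    (nested (lookup cols j) (lookup cols l))

cornerMatrix-herdisc : ∀ {m n} → 1 ℕ.≤ m → 1 ℕ.≤ n → 1 ℕ.≤ herdisc (cornerMatrix {m} {n})
cornerMatrix-herdisc {suc m} {suc n} 1≤m 1≤n = subst (1 ℕ.≤_) (ℕ.*-identityˡ (herdisc (cornerMatrix {suc m} {suc n})))
  (herdisc-bound (cornerMatrix {suc m} {suc n}) 1 1 1≤m 1≤n
    (λ x sx → zero , ℕ.≤-reflexive (sym (trans (ℕ.*-identityˡ _) (first x (sx zero))))))
  where
  first : ∀ (x : Fin (suc n) → ℤ) → Sign (x zero) → ∣ 1ℤ ℤ.* x zero ℤ.+ sum (λ j → 0ℤ ℤ.* x (suc j)) ∣ ≡ 1
  first x sx = trans
    (cong ∣_∣ (trans (cong₂ ℤ._+_ (ℤ.*-identityˡ (x zero)) (sum-false (x ∘ suc))) (ℤ.+-identityʳ (x zero))))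
    ([ cong ∣_∣ , cong ∣_∣ ]′ sx)

-- C bounds the ratio between √((1 + ⌊log₂ m⌋)(1 + ⌊log₂ n⌋)) and herdisc / b.
record Gap (C l μ n m : ℕ) : Set where
  field
    A         : Matrix m n
    is01      : Is01 A
    one∈A     : ∃[ i ] ∃[ j ] A i j ≡ 1ℤ
    b         : ℕ
    0<b       : 0 ℕ.< b
    det-bound : DetBound A b
    gap       : suc μ ℕ.* suc l ℕ.* (b ℕ.* b) ℕ.≤ (C ℕ.* herdisc A) ℕ.* (C ℕ.* herdisc A)

cornerGap : ∀ {n m l μ} C → 1 ℕ.≤ n → 1 ℕ.≤ m → suc μ ℕ.≤ C → suc l ℕ.≤ C → Gap (2 ℕ.* C) l μ n m
cornerGap {suc n} {suc m} {l} {μ} C 1≤n 1≤m μ<C l<C = record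
  { A         = cornerMatrix
  ; is01      = λ i j → ⟦⟧-01 (corner i j)
  ; one∈A     = zero , zero , refl
  ; b         = 2
  ; 0<b       = s≤s z≤n
  ; det-bound = cornerMatrix-det-bound
  ; gap       = bound (herdisc (cornerMatrix {suc m} {suc n})) (cornerMatrix-herdisc {suc m} {suc n} 1≤m 1≤n)
  }
  where
  open ℕ.≤-Reasoning
  bound : ∀ H → 1 ℕ.≤ H → suc μ ℕ.* suc l ℕ.* (2 ℕ.* 2) ℕ.≤ (2 ℕ.* C ℕ.* H) ℕ.* (2 ℕ.* C ℕ.* H)
  bound H 1≤H = begin
    suc μ ℕ.* suc l ℕ.* (2 ℕ.* 2)               ≤⟨ ℕ.*-monoˡ-≤ (2 ℕ.* 2) (ℕ.*-mono-≤ μ<C l<C) ⟩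
    C ℕ.* C ℕ.* (2 ℕ.* 2)                       ≡⟨ ring C ⟩
    (2 ℕ.* C ℕ.* 1) ℕ.* (2 ℕ.* C ℕ.* 1)
      ≤⟨ ℕ.*-mono-≤ (ℕ.*-monoʳ-≤ (2 ℕ.* C) 1≤H) (ℕ.*-monoʳ-≤ (2 ℕ.* C) 1≤H) ⟩
    (2 ℕ.* C ℕ.* H) ℕ.* (2 ℕ.* C ℕ.* H)         ∎
    where
    ring : ∀ C → C ℕ.* C ℕ.* (2 ℕ.* 2) ≡ (2 ℕ.* C ℕ.* 1) ℕ.* (2 ℕ.* C ℕ.* 1)
    ring = ℕ.solve-∀

-- Choice of s and t

module _ (s t Q l μ n m : ℕ) .{{_ : NonZero s}} .{{_ : NonZero t}}
  (2^l≤n : 2 ℕ.^ l ℕ.≤ n) (2^μ≤m : 2 ℕ.^ μ ℕ.≤ m) (l≤μ : l ℕ.≤ μ) (4≤Q : 4 ℕ.≤ suc Q)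
  (Qt²≤l : suc Q ℕ.* (t ℕ.* t) ℕ.≤ l) (l<Qt² : l ℕ.< suc Q ℕ.* (suc t ℕ.* suc t))
  (4s²≤μ-1 : 4 ℕ.* (s ℕ.* s) ℕ.≤ μ ℕ.∸ 1) (μ-1<4s² : μ ℕ.∸ 1 ℕ.< 4 ℕ.* (suc s ℕ.* suc s))
  (μ^Q≤n^ : (μ ℕ.∸ 1) ℕ.^ suc Q ℕ.≤ n ℕ.^ Q) where

  private
    instance
      s²≢0 : NonZero (s ℕ.* s)
      s²≢0 = ℕ.m*n≢0 s s

  -- A row takes one bit for the side, t² for the leaf and s² for the subset. From 4t² ≤ l ≤ μ, 4s²
  -- ≤ μ - 1 and 4 ≤ μ follows 4(1 + t² + s²) ≤ 3μ.
  rows-fit : 2 ℕ.^ (suc (t ℕ.* t) ℕ.+ s ℕ.* s) ℕ.≤ m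
  rows-fit = ℕ.≤-trans (ℕ.^-monoʳ-≤ 2 {_} {μ} (ℕ.*-cancelˡ-≤ 4 (begin
    4 ℕ.* (suc (t ℕ.* t) ℕ.+ s ℕ.* s)               ≡⟨ ring (t ℕ.* t) (s ℕ.* s) ⟩
    4 ℕ.* (t ℕ.* t) ℕ.+ (4 ℕ.+ 4 ℕ.* (s ℕ.* s))
      ≤⟨ ℕ.+-mono-≤ 4t²≤μ (ℕ.+-monoʳ-≤ 4 (ℕ.≤-trans 4s²≤μ-1 (ℕ.m∸n≤m μ 1))) ⟩
    μ ℕ.+ (4 ℕ.+ μ)                                 ≤⟨ ℕ.+-monoʳ-≤ μ (ℕ.+-monoˡ-≤ μ 4≤μ) ⟩
    μ ℕ.+ (μ ℕ.+ μ)                                 ≤⟨ ℕ.m≤m+n (μ ℕ.+ (μ ℕ.+ μ)) μ ⟩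
    μ ℕ.+ (μ ℕ.+ μ) ℕ.+ μ                           ≡⟨ ring′ μ ⟩
    4 ℕ.* μ                                         ∎))) 2^μ≤m
    where
    open ℕ.≤-Reasoning
    4t²≤μ : 4 ℕ.* (t ℕ.* t) ℕ.≤ μ
    4t²≤μ = ℕ.≤-trans (ℕ.*-monoˡ-≤ (t ℕ.* t) 4≤Q) (ℕ.≤-trans Qt²≤l l≤μ)
    4≤μ : 4 ℕ.≤ μ
    4≤μ = ℕ.≤-trans (ℕ.*-monoʳ-≤ 4 (ℕ.>-nonZero⁻¹ (s ℕ.* s))) (ℕ.≤-trans 4s²≤μ-1 (ℕ.m∸n≤m μ 1))
    ring : ∀ x y → 4 ℕ.* (suc x ℕ.+ y) ≡ 4 ℕ.* x ℕ.+ (4 ℕ.+ 4 ℕ.* y)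
    ring = ℕ.solve-∀
    ring′ : ∀ x → x ℕ.+ (x ℕ.+ x) ℕ.+ x ≡ 4 ℕ.* x
    ring′ = ℕ.solve-∀

  columns-fit : nodes (t ℕ.* t) ℕ.* (s ℕ.* s) ℕ.≤ n
  columns-fit = ℕ.≤-trans (ℕ.*-monoˡ-≤ (s ℕ.* s) (ℕ.<⇒≤ (nodes<2^h (t ℕ.* t)))) (^-cancelʳ-≤ (suc Q) (begin
    (2 ℕ.^ (t ℕ.* t) ℕ.* (s ℕ.* s)) ℕ.^ suc Q
      ≡⟨ ^-distribʳ-* (suc Q) (2 ℕ.^ (t ℕ.* t)) (s ℕ.* s) ⟩
    (2 ℕ.^ (t ℕ.* t)) ℕ.^ suc Q ℕ.* (s ℕ.* s) ℕ.^ suc Q      ≤⟨ ℕ.*-mono-≤ nodes-part elements-part ⟩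
    n ℕ.* n ℕ.^ Q                                            ∎))
    where
    open ℕ.≤-Reasoning
    nodes-part : (2 ℕ.^ (t ℕ.* t)) ℕ.^ suc Q ℕ.≤ n
    nodes-part = begin
      (2 ℕ.^ (t ℕ.* t)) ℕ.^ suc Q   ≡⟨ ℕ.^-*-assoc 2 (t ℕ.* t) (suc Q) ⟩
      2 ℕ.^ (t ℕ.* t ℕ.* suc Q)     ≤⟨ ℕ.^-monoʳ-≤ 2 (subst (ℕ._≤ l) (ℕ.*-comm (suc Q) (t ℕ.* t)) Qt²≤l) ⟩
      2 ℕ.^ l                       ≤⟨ 2^l≤n ⟩
      n                             ∎
    elements-part : (s ℕ.* s) ℕ.^ suc Q ℕ.≤ n ℕ.^ Q
    elements-part = ℕ.≤-trans (ℕ.^-monoˡ-≤ (suc Q)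
      (ℕ.≤-trans (ℕ.m≤m+n (s ℕ.* s) (3 ℕ.* (s ℕ.* s))) 4s²≤μ-1)) μ^Q≤n^

  suc≤2* : ∀ x .{{_ : NonZero x}} → suc x ℕ.≤ 2 ℕ.* x
  suc≤2* (suc x) = s≤s (subst (suc x ℕ.≤_) (sym (ℕ.+-suc x (x ℕ.+ 0))) (s≤s (ℕ.m≤m+n x (x ℕ.+ 0))))

  suc-square-≤ : ∀ x .{{_ : NonZero x}} → suc x ℕ.* suc x ℕ.≤ 4 ℕ.* (x ℕ.* x)
  suc-square-≤ x = ℕ.≤-trans (ℕ.*-mono-≤ (suc≤2* x) (suc≤2* x)) (ℕ.≤-reflexive (ring x))
    where
    ring : ∀ x → 2 ℕ.* x ℕ.* (2 ℕ.* x) ≡ 4 ℕ.* (x ℕ.* x)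
    ring = ℕ.solve-∀

  -- Rounding s and t down loses constants: μ + 1 ≤ 2⁵ s² and, with q = Q + 1, l + 1 ≤ 2^(2+q) t².
  -- Together with (3s)² ≤ 2⁴ s² and (s² t)² ≤ 2⁶ H² the exponent of 2 is 17 + q, at most 2(9 + q).
  tree-gap : ∀ H → s ℕ.* s ℕ.* t ℕ.≤ 8 ℕ.* H →
    suc μ ℕ.* suc l ℕ.* (3 ℕ.* s ℕ.* (3 ℕ.* s)) ℕ.≤ (2 ℕ.^ (9 ℕ.+ suc Q) ℕ.* H) ℕ.* (2 ℕ.^ (9 ℕ.+ suc Q) ℕ.* H)
  tree-gap H s²t≤8H = begin
    suc μ ℕ.* suc l ℕ.* (3 ℕ.* s ℕ.* (3 ℕ.* s))
      ≤⟨ ℕ.*-mono-≤ (ℕ.*-mono-≤ μ-part l-part) (ℕ.*-mono-≤ (ℕ.*-monoˡ-≤ s 3≤4) (ℕ.*-monoˡ-≤ s 3≤4)) ⟩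
    (2 ℕ.^ 5 ℕ.* (s ℕ.* s)) ℕ.* (2 ℕ.^ (2 ℕ.+ suc Q) ℕ.* (t ℕ.* t)) ℕ.* (4 ℕ.* s ℕ.* (4 ℕ.* s))
      ≡⟨ regroup (2 ℕ.^ 5) (2 ℕ.^ (2 ℕ.+ suc Q)) 4 s t ⟩
    2 ℕ.^ 5 ℕ.* 2 ℕ.^ (2 ℕ.+ suc Q) ℕ.* (4 ℕ.* 4) ℕ.* ((s ℕ.* s ℕ.* t) ℕ.* (s ℕ.* s ℕ.* t))
      ≤⟨ ℕ.*-monoʳ-≤ (2 ℕ.^ 5 ℕ.* 2 ℕ.^ (2 ℕ.+ suc Q) ℕ.* (4 ℕ.* 4)) (ℕ.*-mono-≤ s²t≤8H s²t≤8H) ⟩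
    2 ℕ.^ 5 ℕ.* 2 ℕ.^ (2 ℕ.+ suc Q) ℕ.* (2 ℕ.^ 4) ℕ.* ((8 ℕ.* H) ℕ.* (8 ℕ.* H))
      ≡⟨ regroup′ (2 ℕ.^ 5) (2 ℕ.^ (2 ℕ.+ suc Q)) (2 ℕ.^ 4) 8 H ⟩
    2 ℕ.^ 5 ℕ.* 2 ℕ.^ (2 ℕ.+ suc Q) ℕ.* 2 ℕ.^ 4 ℕ.* 2 ℕ.^ 6 ℕ.* (H ℕ.* H)
      ≤⟨ ℕ.*-monoˡ-≤ (H ℕ.* H) powers ⟩
    (2 ℕ.^ (9 ℕ.+ suc Q) ℕ.* 2 ℕ.^ (9 ℕ.+ suc Q)) ℕ.* (H ℕ.* H)
      ≡⟨ ℕ.[m*n]*[o*p]≡[m*o]*[n*p] (2 ℕ.^ (9 ℕ.+ suc Q)) (2 ℕ.^ (9 ℕ.+ suc Q)) H H ⟩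
    (2 ℕ.^ (9 ℕ.+ suc Q) ℕ.* H) ℕ.* (2 ℕ.^ (9 ℕ.+ suc Q) ℕ.* H) ∎
    where
    open ℕ.≤-Reasoning
    3≤4 : 3 ℕ.≤ 4
    3≤4 = ℕ.n≤1+n 3
    regroup : ∀ a b c s t → (a ℕ.* (s ℕ.* s)) ℕ.* (b ℕ.* (t ℕ.* t)) ℕ.* (c ℕ.* s ℕ.* (c ℕ.* s)) ≡
              a ℕ.* b ℕ.* (c ℕ.* c) ℕ.* ((s ℕ.* s ℕ.* t) ℕ.* (s ℕ.* s ℕ.* t))
    regroup = ℕ.solve-∀
    regroup′ : ∀ a b c d H → a ℕ.* b ℕ.* c ℕ.* ((d ℕ.* H) ℕ.* (d ℕ.* H)) ≡ a ℕ.* b ℕ.* c ℕ.* (d ℕ.* d) ℕ.* (H ℕ.* H)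
    regroup′ = ℕ.solve-∀
    powers : 2 ℕ.^ 5 ℕ.* 2 ℕ.^ (2 ℕ.+ suc Q) ℕ.* 2 ℕ.^ 4 ℕ.* 2 ℕ.^ 6 ℕ.≤ 2 ℕ.^ (9 ℕ.+ suc Q) ℕ.* 2 ℕ.^ (9 ℕ.+ suc Q)
    powers = begin
      2 ℕ.^ 5 ℕ.* 2 ℕ.^ (2 ℕ.+ suc Q) ℕ.* 2 ℕ.^ 4 ℕ.* 2 ℕ.^ 6
        ≡⟨ cong (λ z → z ℕ.* 2 ℕ.^ 4 ℕ.* 2 ℕ.^ 6) (ℕ.^-distribˡ-+-* 2 5 (2 ℕ.+ suc Q)) ⟨
      2 ℕ.^ (5 ℕ.+ (2 ℕ.+ suc Q)) ℕ.* 2 ℕ.^ 4 ℕ.* 2 ℕ.^ 6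
        ≡⟨ cong (ℕ._* 2 ℕ.^ 6) (ℕ.^-distribˡ-+-* 2 (5 ℕ.+ (2 ℕ.+ suc Q)) 4) ⟨
      2 ℕ.^ (5 ℕ.+ (2 ℕ.+ suc Q) ℕ.+ 4) ℕ.* 2 ℕ.^ 6
        ≡⟨ ℕ.^-distribˡ-+-* 2 (5 ℕ.+ (2 ℕ.+ suc Q) ℕ.+ 4) 6 ⟨
      2 ℕ.^ (5 ℕ.+ (2 ℕ.+ suc Q) ℕ.+ 4 ℕ.+ 6)
        ≤⟨ ℕ.^-monoʳ-≤ 2 (ℕ.m≤m+n (5 ℕ.+ (2 ℕ.+ suc Q) ℕ.+ 4 ℕ.+ 6) (1 ℕ.+ suc Q)) ⟩
      2 ℕ.^ (5 ℕ.+ (2 ℕ.+ suc Q) ℕ.+ 4 ℕ.+ 6 ℕ.+ (1 ℕ.+ suc Q))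
        ≡⟨ cong (2 ℕ.^_) (exponent (suc Q)) ⟩
      2 ℕ.^ (9 ℕ.+ suc Q ℕ.+ (9 ℕ.+ suc Q))
        ≡⟨ ℕ.^-distribˡ-+-* 2 (9 ℕ.+ suc Q) (9 ℕ.+ suc Q) ⟩
      2 ℕ.^ (9 ℕ.+ suc Q) ℕ.* 2 ℕ.^ (9 ℕ.+ suc Q) ∎
      where
      exponent : ∀ x → 5 ℕ.+ (2 ℕ.+ x) ℕ.+ 4 ℕ.+ 6 ℕ.+ (1 ℕ.+ x) ≡ 9 ℕ.+ x ℕ.+ (9 ℕ.+ x)
      exponent = ℕ.solve-∀
    l-part : suc l ℕ.≤ 2 ℕ.^ (2 ℕ.+ suc Q) ℕ.* (t ℕ.* t)
    l-part = begin
      suc l                                    ≤⟨ l<Qt² ⟩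
      suc Q ℕ.* (suc t ℕ.* suc t)              ≤⟨ ℕ.*-mono-≤ (n≤2^n (suc Q)) (suc-square-≤ t) ⟩
      2 ℕ.^ suc Q ℕ.* (4 ℕ.* (t ℕ.* t))        ≡⟨ ℕ.*-assoc (2 ℕ.^ suc Q) 4 (t ℕ.* t) ⟨
      2 ℕ.^ suc Q ℕ.* 4 ℕ.* (t ℕ.* t)
        ≡⟨ cong (ℕ._* (t ℕ.* t)) (trans (ℕ.*-comm (2 ℕ.^ suc Q) 4) (sym (ℕ.^-distribˡ-+-* 2 2 (suc Q)))) ⟩
      2 ℕ.^ (2 ℕ.+ suc Q) ℕ.* (t ℕ.* t)        ∎
    μ-part : suc μ ℕ.≤ 2 ℕ.^ 5 ℕ.* (s ℕ.* s)
    μ-part = begin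
      suc μ                                    ≤⟨ s≤s (ℕ.m≤n+m∸n μ 1) ⟩
      suc (suc (μ ℕ.∸ 1))                      ≤⟨ s≤s μ-1<4s² ⟩
      1 ℕ.+ 4 ℕ.* (suc s ℕ.* suc s)
        ≤⟨ ℕ.+-mono-≤ (ℕ.>-nonZero⁻¹ (s ℕ.* s)) (ℕ.*-monoʳ-≤ 4 (suc-square-≤ s)) ⟩
      s ℕ.* s ℕ.+ 4 ℕ.* (4 ℕ.* (s ℕ.* s))      ≤⟨ ℕ.m≤m+n _ (15 ℕ.* (s ℕ.* s)) ⟩
      s ℕ.* s ℕ.+ 4 ℕ.* (4 ℕ.* (s ℕ.* s)) ℕ.+ 15 ℕ.* (s ℕ.* s)  ≡⟨ ring (s ℕ.* s) ⟩
      32 ℕ.* (s ℕ.* s)                         ∎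
      where
      ring : ∀ x → x ℕ.+ 4 ℕ.* (4 ℕ.* x) ℕ.+ 15 ℕ.* x ≡ 32 ℕ.* x
      ring = ℕ.solve-∀

  -- Raising 8s² to the perfect square 9s² keeps the base an integer.
  square-bound : ∀ d K → d ℕ.* d ℕ.≤ 4 ℕ.^ K ℕ.* (2 ℕ.* (s ℕ.* s)) ℕ.^ K → d ℕ.≤ (3 ℕ.* s) ℕ.^ K
  square-bound d K d²≤ = square-cancel-≤ (begin
    d ℕ.* d                                      ≤⟨ d²≤ ⟩
    4 ℕ.^ K ℕ.* (2 ℕ.* (s ℕ.* s)) ℕ.^ K          ≡⟨ ^-distribʳ-* K 4 (2 ℕ.* (s ℕ.* s)) ⟨
    (4 ℕ.* (2 ℕ.* (s ℕ.* s))) ℕ.^ K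
      ≤⟨ ℕ.^-monoˡ-≤ K (ℕ.m≤m+n (4 ℕ.* (2 ℕ.* (s ℕ.* s))) (s ℕ.* s)) ⟩
    (4 ℕ.* (2 ℕ.* (s ℕ.* s)) ℕ.+ s ℕ.* s) ℕ.^ K  ≡⟨ cong (ℕ._^ K) (ring s) ⟩
    (3 ℕ.* s ℕ.* (3 ℕ.* s)) ℕ.^ K                ≡⟨ ^-distribʳ-* K (3 ℕ.* s) (3 ℕ.* s) ⟩
    (3 ℕ.* s) ℕ.^ K ℕ.* (3 ℕ.* s) ℕ.^ K          ∎)
    where
    open ℕ.≤-Reasoning
    ring : ∀ s → 4 ℕ.* (2 ℕ.* (s ℕ.* s)) ℕ.+ s ℕ.* s ≡ 3 ℕ.* s ℕ.* (3 ℕ.* s)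
    ring = ℕ.solve-∀

  treeGap : ∀ r → 1 ℕ.≤ n → nodes (t ℕ.* t) ℕ.* (s ℕ.* s) ℕ.+ r ≡ n → Gap (2 ℕ.^ (9 ℕ.+ suc Q)) l μ n m
  treeGap r 1≤n refl = record
    { A         = treeMatrix
    ; is01      = λ i j → ⟦⟧-01 (entry (row (toℕ i)) j)
    ; one∈A     = treeMatrix-one m rows-fit
    ; b         = 3 ℕ.* s
    ; 0<b       = ℕ.>-nonZero⁻¹ (3 ℕ.* s) {{ℕ.m*n≢0 3 s}}
    ; det-bound = λ {K} rows cols cols∈ →
        square-bound ∣ det (submatrix treeMatrix rows cols) ∣ K (treeMatrix-det-bound rows cols cols∈)
    ; gap       = tree-gap (herdisc (treeMatrix {m})) (treeMatrix-herdisc m 1≤n rows-fit)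
    }
    where
    open Construction (t ℕ.* t) (s ℕ.* s) r
    open TreeDiscrepancy t (t ℕ.* t) (s ℕ.* s) r refl

square-floor : ∀ q a .{{_ : NonZero q}} → ∃[ t ] (q ℕ.* (t ℕ.* t) ℕ.≤ a × a ℕ.< q ℕ.* (suc t ℕ.* suc t))
square-floor q zero    = 0 , ℕ.≤-reflexive (ℕ.*-zeroʳ q) , subst (0 ℕ.<_) (sym (ℕ.*-identityʳ q)) (ℕ.>-nonZero⁻¹ q)
square-floor q (suc a) with square-floor q a
... | t , qt²≤a , a<qt² with q ℕ.* (suc t ℕ.* suc t) ℕ.≤? suc a
...   | no  ≰ = t , ℕ.m≤n⇒m≤1+n qt²≤a , ℕ.≰⇒> ≰
...   | yes ≤ = suc t , ≤ , ℕ.≤-<-trans a<qt² (ℕ.*-monoʳ-< q (ℕ.*-mono-< (ℕ.n<1+n (suc t)) (ℕ.n<1+n (suc t))))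

log-floor : ∀ a .{{_ : NonZero a}} → ∃[ l ] (2 ℕ.^ l ℕ.≤ a × a ℕ.< 2 ℕ.^ suc l)
log-floor 1             = 0 , s≤s z≤n , s≤s (s≤s z≤n)
log-floor (suc (suc a)) with log-floor (suc a)
... | l , 2^l≤a , a<2^l with 2 ℕ.^ suc l ℕ.≤? suc (suc a)
...   | no  ≰ = l , ℕ.m≤n⇒m≤1+n 2^l≤a , ℕ.≰⇒> ≰
...   | yes ≤ = suc l , ≤ , ℕ.≤-<-trans a<2^l (ℕ.^-monoʳ-< 2 (s≤s (s≤s z≤n)) (ℕ.n<1+n (suc l)))

gap-exists : ∀ Q l μ n m → 4 ℕ.≤ suc Q → 1 ℕ.≤ n → n ℕ.≤ m →
  2 ℕ.^ l ℕ.≤ n → n ℕ.< 2 ℕ.^ suc l → 2 ℕ.^ μ ℕ.≤ m → m ℕ.< 2 ℕ.^ suc μ →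
  (μ ℕ.∸ 1) ℕ.^ suc Q ℕ.≤ n ℕ.^ Q → Gap (2 ℕ.^ (9 ℕ.+ suc Q)) l μ n m
gap-exists Q l μ n m 4≤Q 1≤n n≤m 2^l≤n n<2^l 2^μ≤m m<2^μ μ^Q≤n^
  with square-floor (suc Q) l | square-floor 4 (μ ℕ.∸ 1)
... | suc t , t≤ , t> | suc s , s≤ , s> =
  treeGap (suc s) (suc t) Q l μ n m 2^l≤n 2^μ≤m l≤μ 4≤Q t≤ t> s≤ s> μ^Q≤n^ _ 1≤n
    (ℕ.m+[n∸m]≡n (columns-fit (suc s) (suc t) Q l μ n m 2^l≤n 2^μ≤m l≤μ 4≤Q t≤ t> s≤ s> μ^Q≤n^))
  where
  l≤μ : l ℕ.≤ μ
  l≤μ = ℕ.≮⇒≥ λ μ<l → ℕ.<⇒≱ m<2^μ (ℕ.≤-trans (ℕ.^-monoʳ-≤ 2 μ<l) (ℕ.≤-trans 2^l≤n n≤m))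
-- t = 0 means l ≤ Q, so n < 2^(Q+1), and `μ-1≤n` then bounds μ as well. The exponent is one below
-- the required one because `cornerGap` doubles its constant.
... | zero , _ , t> | _ = cornerGap (2 ℕ.^ (8 ℕ.+ suc Q)) 1≤n (ℕ.≤-trans 1≤n n≤m) μ-bound l-bound
  where
  open ℕ.≤-Reasoning
  l<Q : l ℕ.< suc Q
  l<Q = subst (l ℕ.<_) (ℕ.*-identityʳ (suc Q)) t>
  2^Q≤ : ∀ c → 2 ℕ.^ suc Q ℕ.≤ 2 ℕ.^ (c ℕ.+ suc Q)
  2^Q≤ c = ℕ.^-monoʳ-≤ 2 (ℕ.m≤n+m (suc Q) c)
  l-bound : suc l ℕ.≤ 2 ℕ.^ (8 ℕ.+ suc Q)
  l-bound = ℕ.≤-trans l<Q (ℕ.≤-trans (n≤2^n (suc Q)) (2^Q≤ 8))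
  μ-1≤n : μ ℕ.∸ 1 ℕ.≤ n
  μ-1≤n = ^-cancelʳ-≤ (suc Q) (ℕ.≤-trans μ^Q≤n^ (ℕ.m≤n*m (n ℕ.^ Q) n {{ℕ.>-nonZero 1≤n}}))
  μ-bound : suc μ ℕ.≤ 2 ℕ.^ (8 ℕ.+ suc Q)
  μ-bound = begin
    suc μ                                      ≤⟨ s≤s (ℕ.m≤n+m∸n μ 1) ⟩
    2 ℕ.+ (μ ℕ.∸ 1)                            ≤⟨ ℕ.+-monoʳ-≤ 2 μ-1≤n ⟩
    2 ℕ.+ n
      ≤⟨ ℕ.+-mono-≤ (ℕ.^-monoʳ-≤ 2 {1} {suc Q} (s≤s z≤n)) (ℕ.≤-trans (ℕ.<⇒≤ n<2^l) (ℕ.^-monoʳ-≤ 2 l<Q)) ⟩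
    2 ℕ.^ suc Q ℕ.+ 2 ℕ.^ suc Q                ≡⟨ cong (2 ℕ.^ suc Q ℕ.+_) (sym (ℕ.+-identityʳ (2 ℕ.^ suc Q))) ⟩
    2 ℕ.^ (1 ℕ.+ suc Q)                        ≤⟨ ℕ.^-monoʳ-≤ 2 (ℕ.+-monoˡ-≤ (suc Q) {1} {8} (s≤s z≤n)) ⟩
    2 ℕ.^ (8 ℕ.+ suc Q)                        ∎
-- s = 0 means μ - 1 < 4, and l ≤ μ because n ≤ m.
... | _ | zero , _ , s> =
  cornerGap (2 ℕ.^ (8 ℕ.+ suc Q)) 1≤n (ℕ.≤-trans 1≤n n≤m) (bound μ≤4) (bound (ℕ.≤-trans l≤μ μ≤4))
  where
  open ℕ.≤-Reasoning
  l≤μ : l ℕ.≤ μ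
  l≤μ = ℕ.≮⇒≥ λ μ<l → ℕ.<⇒≱ m<2^μ (ℕ.≤-trans (ℕ.^-monoʳ-≤ 2 μ<l) (ℕ.≤-trans 2^l≤n n≤m))
  μ≤4 : μ ℕ.≤ 4
  μ≤4 = ℕ.≤-trans (ℕ.m≤n+m∸n μ 1) s>
  bound : ∀ {x} → x ℕ.≤ 4 → suc x ℕ.≤ 2 ℕ.^ (8 ℕ.+ suc Q)
  bound {x} x≤4 = begin
    suc x                  ≤⟨ s≤s x≤4 ⟩
    5                      ≤⟨ ℕ.m≤m+n 5 3 ⟩
    2 ℕ.^ 3                ≤⟨ ℕ.^-monoʳ-≤ 2 {3} {8 ℕ.+ suc Q} (s≤s (s≤s (s≤s z≤n))) ⟩
    2 ℕ.^ (8 ℕ.+ suc Q)    ∎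

-- Real numbers

open Defs.Lemmas
open import Algebra.Properties.Semiring.Exp
  (CommutativeRing.semiring ℚ.+-*-commutativeRing) using (_^_)

ι : ℕ → ℚ
ι n = (+ n) ℚ./ 1

ι-mono-≤ : ∀ {a b} → a ℕ.≤ b → ι a ℚ.≤ ι b
ι-mono-≤ {a} {b} a≤b = subst₂ ℚ._≤_ (sym (n/1 a)) (sym (n/1 b)) (*≤* (ℤ.*-monoʳ-≤-nonNeg 1ℤ (+≤+ a≤b)))

ι-mono-< : ∀ {a b} → a ℕ.< b → ι a ℚ.< ι b
ι-mono-< {a} {b} a<b = subst₂ ℚ._<_ (sym (n/1 a)) (sym (n/1 b)) (*<* (ℤ.*-monoʳ-<-pos 1ℤ (ℤ.+<+ a<b)))

ι-cancel-≤ : ∀ {a b} → ι a ℚ.≤ ι b → a ℕ.≤ b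
ι-cancel-≤ ιa≤ιb = ℕ.≮⇒≥ λ b<a → <⇒≱ (ι-mono-< b<a) ιa≤ιb

ι-cancel-< : ∀ {a b} → ι a ℚ.< ι b → a ℕ.< b
ι-cancel-< ιa<ιb = ℕ.≰⇒> λ b≤a → <⇒≱ ιa<ιb (ι-mono-≤ b≤a)

0≤ι : ∀ n → 0ℚ ℚ.≤ ι n
0≤ι n = ι-mono-≤ {0} {n} z≤n

ι-* : ∀ a b → ι a ℚ.* ι b ≡ ι (a ℕ.* b)
ι-* a b = trans (cong₂ ℚ._*_ (n/1 a) (n/1 b)) (cong (ℚ._/ 1) (sym (ℤ.pos-* a b)))

ι-^ : ∀ a k → ι a ^ k ≡ ι (a ℕ.^ k)
ι-^ a zero    = refl
ι-^ a (suc k) = trans (cong (ι a ℚ.*_) (ι-^ a k)) (ι-* a (a ℕ.^ k))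

ι≤ : ∀ {p k} → 0ℚ ℚ.≤ p → k ℕ.* ↧ₙ p ℕ.≤ ∣ ↥ p ∣ → ι k ℚ.≤ p
ι≤ {p@record{}} {k} 0≤p kd≤c = subst (ℚ._≤ p) (sym (n/1 k)) (*≤* (begin
  + k ℤ.* ↧ p             ≡⟨ ℤ.pos-* k (↧ₙ p) ⟨
  + (k ℕ.* ↧ₙ p)          ≤⟨ +≤+ kd≤c ⟩
  + ∣ ↥ p ∣               ≡⟨ ℤ.0≤i⇒+∣i∣≡i (subst (0ℤ ℤ.≤_) (ℤ.*-identityʳ (↥ p)) (ℚ.drop-*≤* 0≤p)) ⟩
  ↥ p                     ≡⟨ ℤ.*-identityʳ (↥ p) ⟨
  ↥ p ℤ.* 1ℤ              ∎))
  where open ℤ.≤-Reasoning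

≤ι : ∀ {p k} → 0ℚ ℚ.≤ p → ∣ ↥ p ∣ ℕ.≤ k ℕ.* ↧ₙ p → p ℚ.≤ ι k
≤ι {p@record{}} {k} 0≤p c≤kd = subst (p ℚ.≤_) (sym (n/1 k)) (*≤* (begin
  ↥ p ℤ.* 1ℤ              ≡⟨ ℤ.*-identityʳ (↥ p) ⟩
  ↥ p                     ≡⟨ ℤ.0≤i⇒+∣i∣≡i (subst (0ℤ ℤ.≤_) (ℤ.*-identityʳ (↥ p)) (ℚ.drop-*≤* 0≤p)) ⟨
  + ∣ ↥ p ∣               ≤⟨ +≤+ c≤kd ⟩
  + (k ℕ.* ↧ₙ p)          ≡⟨ ℤ.pos-* k (↧ₙ p) ⟩
  + k ℤ.* ↧ p             ∎))
  where open ℤ.≤-Reasoning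

∈fromℚ⇒< : ∀ {p q} → p ∈ Cut (fromℚ q) → p ℚ.< q
∈fromℚ⇒< (_ , p<q , refl) = p<q

<⇒∈fromℚ : ∀ {p q} → p ℚ.< q → p ∈ Cut (fromℚ q)
<⇒∈fromℚ p<q = _ , p<q , refl

^-cancel-≤-exponent : ∀ {a b} → 2 ℕ.^ a ℕ.≤ 2 ℕ.^ b → a ℕ.≤ b
^-cancel-≤-exponent 2^a≤2^b = ℕ.≮⇒≥ λ b<a → ℕ.<⇒≱ (ℕ.^-monoʳ-< 2 (s≤s (s≤s z≤n)) b<a) 2^a≤2^b

∈log₂⇒≤ : ∀ {n l p} → n ℕ.< 2 ℕ.^ suc l → p ∈ Cut (log₂ n) → p ℚ.≤ ι (suc l)
∈log₂⇒≤ {l = l} n<2^l (s , p<s , inj₁ refl) = ℚ.≤-trans (ℚ.<⇒≤ p<s) (0≤ι (suc l))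
∈log₂⇒≤ {n} {l} n<2^l (s , p<s , inj₂ (0≤s , 2^c≤n^d)) = ℚ.≤-trans (ℚ.<⇒≤ p<s)
  (≤ι {k = suc l} 0≤s (^-cancel-≤-exponent (begin
    2 ℕ.^ ∣ ↥ s ∣              ≤⟨ 2^c≤n^d ⟩
    n ℕ.^ ↧ₙ s                 ≤⟨ ℕ.^-monoˡ-≤ (↧ₙ s) (ℕ.<⇒≤ n<2^l) ⟩
    (2 ℕ.^ suc l) ℕ.^ ↧ₙ s     ≡⟨ ℕ.^-*-assoc 2 (suc l) (↧ₙ s) ⟩
    2 ℕ.^ (suc l ℕ.* ↧ₙ s)     ∎)))
  where open ℕ.≤-Reasoning

-- As a ≥ 1, the element above `ι a` cannot be the default 1 of the power, so it comes with a
-- genuine exponent s.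
∈^ᴿ : ∀ {b a} x → 1 ℕ.≤ a → ι a ∈ Cut (b ^ᴿ x) → ∃[ s ] (s ∈ Cut x × 0ℚ ℚ.≤ s × a ℕ.^ ↧ₙ s ℕ.≤ b ℕ.^ ∣ ↥ s ∣)
∈^ᴿ {b} {a} x 1≤a (p , a<p , inj₁ refl) = contradiction (ι-cancel-< {a} {1} a<p) (ℕ.≤⇒≯ 1≤a)
∈^ᴿ {b} {a} x 1≤a (p , a<p , inj₂ (s , s∈x , 0≤s , 0≤p , p^d≤b^c)) = s , s∈x , 0≤s ,
  ι-cancel-≤ (subst₂ ℚ._≤_ (ι-^ a (↧ₙ s)) (ι-^ b ∣ ↥ s ∣)
    (ℚ.≤-trans (^-monoˡ-≤ (↧ₙ s) (0≤ι a) (ℚ.<⇒≤ a<p)) p^d≤b^c))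

∈1-ε : ∀ ε {δ u} → δ ∈ Cut ε → u ∈ Cut (1ℝ -ᴿ ε) → u ℚ.+ δ ℚ.≤ 1ℚ
∈1-ε ε {δ} {u} δ∈ε (v , u<v , a , r , a∈1 , r∉ε , refl) = begin
  u ℚ.+ δ                     ≤⟨ ℚ.+-mono-≤ (ℚ.<⇒≤ u<v) (∉⇒≤ ε δ∈ε r∉ε) ⟩
  (a ℚ.- r) ℚ.+ r             ≡⟨ ℚ.+-assoc a (ℚ.- r) r ⟩
  a ℚ.+ (ℚ.- r ℚ.+ r)         ≡⟨ cong (a ℚ.+_) (ℚ.+-inverseˡ r) ⟩
  a ℚ.+ 0ℚ                    ≡⟨ ℚ.+-identityʳ a ⟩
  a                           ≤⟨ ℚ.<⇒≤ (∈fromℚ⇒< a∈1) ⟩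
  1ℚ                          ∎
  where open ℚ.≤-Reasoning

-- A positive δ with denominator d is at least 1/d, so u + 1/d ≤ 1; the conclusion is this with
-- denominators cleared.
∣↥∣-+-≤ : ∀ {u δ} → 0ℚ ℚ.≤ u → 0ℚ ℚ.< δ → u ℚ.+ δ ℚ.≤ 1ℚ →
          ∣ ↥ u ∣ ℕ.* ↧ₙ δ ℕ.+ ↧ₙ u ℕ.≤ ↧ₙ u ℕ.* ↧ₙ δ
∣↥∣-+-≤ {u@(mkℚ (+ c) _ _)} {δ@(mkℚ (+ suc a) _ _)} 0≤u 0<δ u+δ≤1 = ℤ.drop‿+≤+ (begin
  + (c ℕ.* ↧ₙ δ ℕ.+ ↧ₙ u)
    ≤⟨ +≤+ (ℕ.+-monoʳ-≤ (c ℕ.* ↧ₙ δ) (ℕ.m≤m+n (↧ₙ u) (a ℕ.* ↧ₙ u))) ⟩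
  + (c ℕ.* ↧ₙ δ ℕ.+ suc a ℕ.* ↧ₙ u)             ≡⟨ cong₂ ℤ._+_ (ℤ.pos-* c (↧ₙ δ)) (ℤ.pos-* (suc a) (↧ₙ u)) ⟩
  + c ℤ.* ↧ δ ℤ.+ + suc a ℤ.* ↧ u               ≡⟨ ℤ.*-identityʳ _ ⟨
  (+ c ℤ.* ↧ δ ℤ.+ + suc a ℤ.* ↧ u) ℤ.* 1ℤ
    ≤⟨ ℚᵘ.drop-*≤* (ℚᵘ.≤-respˡ-≃ (ℚ.toℚᵘ-homo-+ u δ) (ℚ.toℚᵘ-mono-≤ u+δ≤1)) ⟩
  1ℤ ℤ.* + (↧ₙ u ℕ.* ↧ₙ δ)                      ≡⟨ ℤ.*-identityˡ _ ⟩
  + (↧ₙ u ℕ.* ↧ₙ δ)                             ∎)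
  where open ℤ.≤-Reasoning
∣↥∣-+-≤ {mkℚ ℤ.-[1+ _ ] _ _} (*≤* ())
∣↥∣-+-≤ {δ = mkℚ (+ zero) _ _} _ (*<* (ℤ.+<+ ()))
∣↥∣-+-≤ {δ = mkℚ ℤ.-[1+ _ ] _ _} _ (*<* ())

-- With δ ≤ ε of denominator d, the exponent 1 − 1/(d + 4) exceeds 1 − ε; the
-- loss of 1 in log₂ m makes room for the strict inequalities of the cuts.
log-bound : ∀ ε {δ} → 0ℚ ℚ.< δ → δ ∈ Cut ε → ∀ n m μ → 1 ℕ.≤ n → 2 ℕ.^ μ ℕ.≤ m →
  fromℕ m ≤ᴿ 2 ^ᴿ (n ^ᴿ (1ℝ -ᴿ ε)) → (μ ℕ.∸ 1) ℕ.^ (4 ℕ.+ ↧ₙ δ) ℕ.≤ n ℕ.^ (3 ℕ.+ ↧ₙ δ)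
log-bound ε 0<δ δ∈ε n m zero          1≤n 2^μ≤m m≤ = z≤n
log-bound ε 0<δ δ∈ε n m (suc zero)    1≤n 2^μ≤m m≤ = z≤n
log-bound ε 0<δ δ∈ε n zero    (suc (suc k)) 1≤n 2^μ≤m m≤ =
  contradiction 2^μ≤m (ℕ.<⇒≱ (ℕ.m^n>0 2 (suc (suc k))))
log-bound ε {δ} 0<δ δ∈ε n (suc m) (suc (suc k)) 1≤n 2^μ≤m m≤ =
  exponent (proj₁ first) (proj₁ (proj₂ first)) (proj₁ (proj₂ (proj₂ first))) (proj₂ (proj₂ (proj₂ first)))
  where
  -- The number of rows is `suc m`, whose cut contains only smaller rationals. The argument
  -- therefore runs with m, and one unit of the exponent pays for it.
  2^1+k≤m : 2 ℕ.^ suc k ℕ.≤ m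
  2^1+k≤m = ℕ.s≤s⁻¹ (begin
    suc (2 ℕ.^ suc k)                 ≤⟨ ℕ.+-monoˡ-≤ (2 ℕ.^ suc k) (ℕ.m^n>0 2 (suc k)) ⟩
    2 ℕ.^ suc k ℕ.+ 2 ℕ.^ suc k       ≡⟨ cong (2 ℕ.^ suc k ℕ.+_) (sym (ℕ.+-identityʳ (2 ℕ.^ suc k))) ⟩
    2 ℕ.^ suc (suc k)                 ≤⟨ 2^μ≤m ⟩
    suc m                             ∎)
    where open ℕ.≤-Reasoning
  first : ∃[ s ] (s ∈ Cut (n ^ᴿ (1ℝ -ᴿ ε)) × 0ℚ ℚ.≤ s × m ℕ.^ ↧ₙ s ℕ.≤ 2 ℕ.^ ∣ ↥ s ∣)
  first = ∈^ᴿ {2} {m} (n ^ᴿ (1ℝ -ᴿ ε)) (ℕ.≤-trans (ℕ.m^n>0 2 (suc k)) 2^1+k≤m)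
    (m≤ (<⇒∈fromℚ (ι-mono-< (ℕ.n<1+n m))))
  exponent : ∀ s → s ∈ Cut (n ^ᴿ (1ℝ -ᴿ ε)) → 0ℚ ℚ.≤ s → m ℕ.^ ↧ₙ s ℕ.≤ 2 ℕ.^ ∣ ↥ s ∣ →
             suc k ℕ.^ (4 ℕ.+ ↧ₙ δ) ℕ.≤ n ℕ.^ (3 ℕ.+ ↧ₙ δ)
  exponent s (s′ , s<s′ , s′∈) 0≤s m^d≤2^c =
    base (∈^ᴿ {n} {suc k} (1ℝ -ᴿ ε) (s≤s z≤n) (s′ , ℚ.≤-<-trans ι1+k≤s s<s′ , s′∈))
    where
    ι1+k≤s : ι (suc k) ℚ.≤ s
    ι1+k≤s = ι≤ {k = suc k} 0≤s (^-cancel-≤-exponent (begin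
      2 ℕ.^ (suc k ℕ.* ↧ₙ s)       ≡⟨ ℕ.^-*-assoc 2 (suc k) (↧ₙ s) ⟨
      (2 ℕ.^ suc k) ℕ.^ ↧ₙ s       ≤⟨ ℕ.^-monoˡ-≤ (↧ₙ s) 2^1+k≤m ⟩
      m ℕ.^ ↧ₙ s                   ≤⟨ m^d≤2^c ⟩
      2 ℕ.^ ∣ ↥ s ∣                ∎))
      where open ℕ.≤-Reasoning
    base : ∃[ u ] (u ∈ Cut (1ℝ -ᴿ ε) × 0ℚ ℚ.≤ u × suc k ℕ.^ ↧ₙ u ℕ.≤ n ℕ.^ ∣ ↥ u ∣) →
           suc k ℕ.^ (4 ℕ.+ ↧ₙ δ) ℕ.≤ n ℕ.^ (3 ℕ.+ ↧ₙ δ)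
    base (u , u∈ , 0≤u , k^e≤n^f) = ^-cancelʳ-≤ e {{nonZero u}} (begin
      (suc k ℕ.^ (4 ℕ.+ d)) ℕ.^ e     ≡⟨ ℕ.^-*-assoc (suc k) (4 ℕ.+ d) e ⟩
      suc k ℕ.^ ((4 ℕ.+ d) ℕ.* e)     ≡⟨ cong (suc k ℕ.^_) (ℕ.*-comm (4 ℕ.+ d) e) ⟩
      suc k ℕ.^ (e ℕ.* (4 ℕ.+ d))     ≡⟨ ℕ.^-*-assoc (suc k) e (4 ℕ.+ d) ⟨
      (suc k ℕ.^ e) ℕ.^ (4 ℕ.+ d)     ≤⟨ ℕ.^-monoˡ-≤ (4 ℕ.+ d) k^e≤n^f ⟩
      (n ℕ.^ f) ℕ.^ (4 ℕ.+ d)         ≡⟨ ℕ.^-*-assoc n f (4 ℕ.+ d) ⟩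
      n ℕ.^ (f ℕ.* (4 ℕ.+ d))         ≤⟨ ℕ.^-monoʳ-≤ n {{ℕ.>-nonZero 1≤n}} f[4+d]≤ ⟩
      n ℕ.^ ((3 ℕ.+ d) ℕ.* e)         ≡⟨ ℕ.^-*-assoc n (3 ℕ.+ d) e ⟨
      (n ℕ.^ (3 ℕ.+ d)) ℕ.^ e         ∎)
      where
      open ℕ.≤-Reasoning
      nonZero : ∀ q → NonZero (↧ₙ q)
      nonZero (mkℚ _ _ _) = _
      d = ↧ₙ δ
      e = ↧ₙ u
      f = ∣ ↥ u ∣
      fd+e≤ed : f ℕ.* d ℕ.+ e ℕ.≤ e ℕ.* d
      fd+e≤ed = ∣↥∣-+-≤ 0≤u 0<δ (∈1-ε ε δ∈ε u∈)
      f≤e : f ℕ.≤ e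
      f≤e = ℕ.*-cancelʳ-≤ f e d {{nonZero δ}} (ℕ.≤-trans (ℕ.m≤m+n (f ℕ.* d) e) fd+e≤ed)
      -- That is f/e ≤ 1 - 1/(4 + d), weaker than the bound 1 - 1/d at hand; the 4 secures the
      -- condition `4 ≤ suc Q` behind `rows-fit`.
      f[4+d]≤ : f ℕ.* (4 ℕ.+ d) ℕ.≤ (3 ℕ.+ d) ℕ.* e
      f[4+d]≤ = begin
        f ℕ.* (4 ℕ.+ d)                       ≡⟨ ring₁ f d ⟩
        f ℕ.+ 3 ℕ.* f ℕ.+ f ℕ.* d             ≤⟨ ℕ.+-monoˡ-≤ (f ℕ.* d) (ℕ.+-mono-≤ f≤e (ℕ.*-monoʳ-≤ 3 f≤e)) ⟩
        e ℕ.+ 3 ℕ.* e ℕ.+ f ℕ.* d             ≡⟨ ring₂ e (f ℕ.* d) ⟩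
        3 ℕ.* e ℕ.+ (f ℕ.* d ℕ.+ e)           ≤⟨ ℕ.+-monoʳ-≤ (3 ℕ.* e) fd+e≤ed ⟩
        3 ℕ.* e ℕ.+ e ℕ.* d                   ≡⟨ ring₃ e d ⟩
        (3 ℕ.+ d) ℕ.* e                       ∎
        where
        ring₁ : ∀ f d → f ℕ.* (4 ℕ.+ d) ≡ f ℕ.+ 3 ℕ.* f ℕ.+ f ℕ.* d
        ring₁ = ℕ.solve-∀
        ring₂ : ∀ e x → e ℕ.+ 3 ℕ.* e ℕ.+ x ≡ 3 ℕ.* e ℕ.+ (x ℕ.+ e)
        ring₂ = ℕ.solve-∀
        ring₃ : ∀ e d → 3 ℕ.* e ℕ.+ e ℕ.* d ≡ (3 ℕ.+ d) ℕ.* e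
        ring₃ = ℕ.solve-∀

∈maxᴿ⁺ : ∀ {xs q} → Any (λ x → q ∈ Cut x) xs → q ∈ Cut (maxᴿ xs)
∈maxᴿ⁺ {x ∷ xs} (here q∈x)   = let r , q<r , r∈x = rounded x q∈x in r , q<r , inj₁ r∈x
∈maxᴿ⁺ {x ∷ xs} (there q∈xs) = let r , q<r , r∈xs = rounded (maxᴿ xs) (∈maxᴿ⁺ q∈xs) in r , q<r , inj₂ r∈xs

∈maxᴿ⁻ : ∀ {xs q} → 0ℚ ℚ.≤ q → q ∈ Cut (maxᴿ xs) → Any (λ x → q ∈ Cut x) xs
∈maxᴿ⁻ {[]}     0≤q q∈0                      = contradiction 0≤q (<⇒≱ (∈fromℚ⇒< q∈0))
∈maxᴿ⁻ {x ∷ xs} 0≤q (r , q<r , inj₁ r∈x)     = here (closed x q<r r∈x)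
∈maxᴿ⁻ {x ∷ xs} 0≤q (r , q<r , inj₂ r∈max)   = there (∈maxᴿ⁻ 0≤q (closed (maxᴿ xs) q<r r∈max))

∉root : ∀ k d b → d ℕ.≤ b ℕ.^ suc k → ι b ∉ Cut (root (suc k) (fromℕ d))
∉root k d b d≤b^k (p , b<p , inj₁ refl)          = <⇒≱ b<p (0≤ι b)
∉root k d b d≤b^k (p , b<p , inj₂ (0≤p , p^k∈d)) = <⇒≱ (∈fromℚ⇒< p^k∈d) (begin
  ι d               ≤⟨ ι-mono-≤ d≤b^k ⟩
  ι (b ℕ.^ suc k)   ≡⟨ ι-^ b (suc k) ⟨
  ι b ^ suc k       ≤⟨ ^-monoˡ-≤ (suc k) (0≤ι b) (ℚ.<⇒≤ b<p) ⟩
  p ^ suc k         ∎)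
  where open ℚ.≤-Reasoning

∉All⇒¬Any : ∀ {a p} {A : Set a} {P : A → Set p} {xs : List A} → (∀ x → x ∈ˡ xs → ¬ P x) → ¬ Any P xs
∉All⇒¬Any ¬P any = let x , x∈xs , Px = find any in ¬P x x∈xs Px

-- This form is what makes `ι b` an admissible divisor in the cut of a quotient by `detlb A`.
∉detlb : ∀ {m n} (A : Matrix m n) b → DetBound A b → ι b ∉ Cut (detlb A)
∉detlb {m} {n} A b bound b∈ =
  ∉All⇒¬Any {P = Any ∋b ∘ byRows} {xs = upTo (m ℕ.⊓ n)} sizes (Any.concatMap⁻ byRows (∈maxᴿ⁻ (0≤ι b) b∈))
  where
  ∋b : ℝ → Set
  ∋b x = ι b ∈ Cut x
  minor : ∀ j → Vec (Fin m) (suc j) → Vec (Fin n) (suc j) → ℝ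
  minor j rows cols = root (suc j) (fromℕ ∣ det (submatrix A rows cols) ∣)
  byColumns : ∀ j → Vec (Fin m) (suc j) → List ℝ
  byColumns j rows = map (minor j rows) (choose (suc j) n)
  byRows : ℕ → List ℝ
  byRows j = concatMap (byColumns j) (choose (suc j) m)
  sizes : ∀ j → _ → ¬ Any ∋b (byRows j)
  sizes j _ any = ∉All⇒¬Any {P = Any ∋b ∘ byColumns j} {xs = choose (suc j) m}
    (λ rows _ any → ∉All⇒¬Any {P = ∋b ∘ minor j rows} {xs = choose (suc j) n}
      (λ cols cols∈ → ∉root j ∣ det (submatrix A rows cols) ∣ b (bound rows cols cols∈))
      (Any.map⁻ any))
    (Any.concatMap⁻ (byColumns j) any)

singleton∈choose : ∀ {n} (i : Fin n) → (i ∷ []) ∈ˡ choose 1 n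
singleton∈choose zero    = here refl
singleton∈choose (suc i) =
  ∈-++⁺ʳ (map (λ v → zero ∷ Vec.map suc v) (choose 0 _)) (∈-map⁺ (Vec.map suc) (singleton∈choose i))

Any-concatMap : ∀ {a b p} {A : Set a} {B : Set b} (f : A → List B) (P : B → Set p) {x xs} →
                x ∈ˡ xs → Any P (f x) → Any P (concatMap f xs)
Any-concatMap f P x∈xs Pfx = Any.concatMap⁺ f (lose x∈xs Pfx)

0<detlb : ∀ {m n} (A : Matrix m n) → ∃[ i ] ∃[ j ] A i j ≡ 1ℤ → 0ℝ <ᴿ detlb A
0<detlb {m} {n} A (i , j , Aij≡1) = 0ℚ , (λ 0∈0 → ℚ.<-irrefl refl (∈fromℚ⇒< 0∈0)) , ∈maxᴿ⁺ some-size
  where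
  ∋0 : ℝ → Set
  ∋0 x = 0ℚ ∈ Cut x
  minor : ∀ k → Vec (Fin m) (suc k) → Vec (Fin n) (suc k) → ℝ
  minor k rows cols = root (suc k) (fromℕ ∣ det (submatrix A rows cols) ∣)
  byColumns : ∀ k → Vec (Fin m) (suc k) → List ℝ
  byColumns k rows = map (minor k rows) (choose (suc k) n)
  byRows : ℕ → List ℝ
  byRows k = concatMap (byColumns k) (choose (suc k) m)
  positive : ∀ {n} → Fin n → 0 ℕ.< n
  positive zero    = s≤s z≤n
  positive (suc _) = s≤s z≤n
  det≡1 : det (submatrix A (i ∷ []) (j ∷ [])) ≡ 1ℤ
  det≡1 = cong (λ a → 1ℤ ℤ.* a ℤ.* 1ℤ ℤ.+ 0ℤ) Aij≡1
  0∈minor : ∋0 (minor 0 (i ∷ []) (j ∷ []))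
  -- The cut demands an element strictly above 0 whose power is strictly below the determinant 1; ½
  -- is one.
  0∈minor = ½ , *<* (ℤ.+<+ (s≤s z≤n)) , inj₂ (*≤* (+≤+ z≤n) ,
    subst (λ d → ½ ^ 1 ∈ Cut (fromℕ ∣ d ∣)) (sym det≡1) (<⇒∈fromℚ (*<* (ℤ.+<+ (s≤s (s≤s z≤n))))))
  some-columns : Any ∋0 (byColumns 0 (i ∷ []))
  some-columns = Any.map⁺ {f = minor 0 (i ∷ [])} {xs = choose 1 n} (lose (singleton∈choose j) 0∈minor)
  some-rows : Any ∋0 (byRows 0)
  some-rows = Any-concatMap (byColumns 0) ∋0 (singleton∈choose i) some-columns
  some-size : Any ∋0 (concatMap byRows (upTo (m ℕ.⊓ n)))
  some-size = Any-concatMap byRows ∋0 (∈-upTo⁺ (ℕ.⊓-pres-m< (positive i) (positive j))) some-rows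

∈√⇒≤ : ∀ {x b k} → (∀ {z} → z ∈ Cut x → z ℚ.≤ ι k) → 0ℚ ℚ.≤ b → b ∈ Cut (√ x) → b ℚ.* b ℚ.≤ ι k
∈√⇒≤ {k = k} x≤k 0≤b (p , b<p , inj₁ refl) = contradiction 0≤b (<⇒≱ b<p)
∈√⇒≤ {x} {b} {k} x≤k 0≤b (p , b<p , inj₂ (0≤p , p²∈x)) = ℚ.≤-trans
  (*-mono-≤ 0≤b 0≤p (ℚ.<⇒≤ b<p) (ℚ.<⇒≤ b<p))
  (subst (ℚ._≤ ι k) (cong (p ℚ.*_) (ℚ.*-identityʳ p)) (x≤k p²∈x))

∈*ᴿ⇒≤ : ∀ {x y k l z} → (∀ {p} → p ∈ Cut x → p ℚ.≤ ι k) → (∀ {p} → p ∈ Cut y → p ℚ.≤ ι l) →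
        z ∈ Cut (x *ᴿ y) → z ℚ.≤ ι (k ℕ.* l)
∈*ᴿ⇒≤ {k = k} {l} x≤k y≤l (w , z<w , inj₁ refl) = ℚ.≤-trans (ℚ.<⇒≤ z<w) (0≤ι (k ℕ.* l))
∈*ᴿ⇒≤ {k = k} {l} x≤k y≤l (w , z<w , inj₂ (a , b , a∈x , b∈y , 0≤a , 0≤b , refl)) =
  ℚ.≤-trans (ℚ.<⇒≤ z<w) (subst (a ℚ.* b ℚ.≤_) (ι-* k l) (*-mono-≤ 0≤a (0≤ι l) (x≤k a∈x) (y≤l b∈y)))

square-cancel-≤-ℚ : ∀ {p q} → 0ℚ ℚ.≤ q → p ℚ.* p ℚ.≤ q ℚ.* q → p ℚ.≤ q
square-cancel-≤-ℚ {p} {q} 0≤q p²≤q² = ℚ.≮⇒≥ λ q<p →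
  <⇒≱ (subst₂ ℚ._<_ (square q) (square p) (^-monoˡ-< 2 0≤q q<p)) p²≤q²
  where
  square : ∀ q → q ^ 2 ≡ q ℚ.* q
  square q = cong (q ℚ.*_) (ℚ.*-identityʳ q)

-- From the integer gap to the inequality between reals

module Final (C : ℕ) .{{_ : NonZero C}} where

  2C = ι (2 ℕ.* C)

  instance
    2C-pos : ℚ.Positive 2C
    2C-pos = ℚ.positive (ι-mono-< {0} (ℕ.>-nonZero⁻¹ (2 ℕ.* C) {{ℕ.m*n≢0 2 C}}))
    2C-nonZero : ℚ.NonZero 2C
    2C-nonZero = ℚ.pos⇒nonZero 2C

  -- Half of 1/C: the spare factor 2 turns `≤CH` into the strict inequality that membership in the
  -- cut of `fromℕ H` requires.
  c : ℚ
  c = ℚ.1/ 2C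

  0<c : 0ℚ ℚ.< c
  0<c = ℚ.positive⁻¹ c {{ℚ.1/pos⇒pos 2C}}

  0<ᴿc : 0ℝ <ᴿ fromℚ c
  0<ᴿc = 0ℚ , (λ 0∈0 → ℚ.<-irrefl refl (∈fromℚ⇒< 0∈0)) , <⇒∈fromℚ 0<c

  module _ (H b l μ n m : ℕ) (0<b : 0 ℕ.< b) (n<2^l : n ℕ.< 2 ℕ.^ suc l) (m<2^μ : m ℕ.< 2 ℕ.^ suc μ)
    (gap : suc μ ℕ.* suc l ℕ.* (b ℕ.* b) ℕ.≤ (C ℕ.* H) ℕ.* (C ℕ.* H)) where

    0<H : 0 ℕ.< H
    0<H = ℕ.n≢0⇒n>0 λ { refl →
      ℕ.<⇒≱ positive (subst (λ z → suc μ ℕ.* suc l ℕ.* (b ℕ.* b) ℕ.≤ z ℕ.* z) (ℕ.*-zeroʳ C) gap) }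
      where
      positive : 0 ℕ.< suc μ ℕ.* suc l ℕ.* (b ℕ.* b)
      positive = ℕ.*-mono-≤ {1} {suc μ ℕ.* suc l} (s≤s z≤n) (ℕ.*-mono-≤ 0<b 0<b)

    -- Compare squares: y² ≤ (μ + 1)(l + 1), and the rest is the gap.
    ≤CH : ∀ {y} → y ∈ Cut (√ (log₂ m *ᴿ log₂ n)) → 0ℚ ℚ.≤ y → y ℚ.* ι b ℚ.≤ ι (C ℕ.* H)
    ≤CH {y} y∈ 0≤y = square-cancel-≤-ℚ (0≤ι (C ℕ.* H)) (begin
      (y ℚ.* ι b) ℚ.* (y ℚ.* ι b)                      ≡⟨ swap y (ι b) ⟩
      (y ℚ.* y) ℚ.* (ι b ℚ.* ι b)
        ≤⟨ ℚ.*-monoʳ-≤-nonNeg (ι b ℚ.* ι b) {{ℚ.nonNegative (subst (0ℚ ℚ.≤_) (sym (ι-* b b)) (0≤ι (b ℕ.* b)))}}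
            (∈√⇒≤ {log₂ m *ᴿ log₂ n} {k = suc μ ℕ.* suc l}
              (∈*ᴿ⇒≤ {log₂ m} {log₂ n} {suc μ} {suc l}
                (∈log₂⇒≤ {m} {μ} m<2^μ) (∈log₂⇒≤ {n} {l} n<2^l)) 0≤y y∈) ⟩
      ι (suc μ ℕ.* suc l) ℚ.* (ι b ℚ.* ι b)            ≡⟨ cong (ι (suc μ ℕ.* suc l) ℚ.*_) (ι-* b b) ⟩
      ι (suc μ ℕ.* suc l) ℚ.* ι (b ℕ.* b)              ≡⟨ ι-* (suc μ ℕ.* suc l) (b ℕ.* b) ⟩
      ι (suc μ ℕ.* suc l ℕ.* (b ℕ.* b))                ≤⟨ ι-mono-≤ gap ⟩
      ι ((C ℕ.* H) ℕ.* (C ℕ.* H))      ≡⟨ ι-* (C ℕ.* H) (C ℕ.* H) ⟨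
      ι (C ℕ.* H) ℚ.* ι (C ℕ.* H)      ∎)
      where
      open ℚ.≤-Reasoning
      swap : ∀ x y → (x ℚ.* y) ℚ.* (x ℚ.* y) ≡ (x ℚ.* x) ℚ.* (y ℚ.* y)
      swap x y = trans (ℚ.*-assoc x y (x ℚ.* y)) (trans (cong (x ℚ.*_) (trans (sym (ℚ.*-assoc y x y))
        (trans (cong (ℚ._* y) (ℚ.*-comm y x)) (ℚ.*-assoc x y y)))) (sym (ℚ.*-assoc x x (y ℚ.* y))))

    <H : ∀ {x y} → x ℚ.≤ c → 0ℚ ℚ.≤ y → y ∈ Cut (√ (log₂ m *ᴿ log₂ n)) → x ℚ.* y ℚ.* ι b ℚ.< ι (H)
    <H {x} {y} x≤c 0≤y y∈ = ℚ.*-cancelʳ-<-nonNeg 2C {{ℚ.pos⇒nonNeg 2C}} (begin-strict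
      x ℚ.* y ℚ.* ι b ℚ.* 2C                ≡⟨ cong (ℚ._* 2C) (ℚ.*-assoc x y (ι b)) ⟩
      x ℚ.* (y ℚ.* ι b) ℚ.* 2C
        ≤⟨ ℚ.*-monoʳ-≤-nonNeg 2C {{ℚ.pos⇒nonNeg 2C}} (ℚ.*-monoʳ-≤-nonNeg (y ℚ.* ι b) {{nonNeg}} x≤c) ⟩
      c ℚ.* (y ℚ.* ι b) ℚ.* 2C              ≡⟨ cong (ℚ._* 2C) (ℚ.*-comm c (y ℚ.* ι b)) ⟩
      (y ℚ.* ι b) ℚ.* c ℚ.* 2C              ≡⟨ ℚ.*-assoc (y ℚ.* ι b) c 2C ⟩
      (y ℚ.* ι b) ℚ.* (c ℚ.* 2C)            ≡⟨ cong ((y ℚ.* ι b) ℚ.*_) (ℚ.*-inverseˡ 2C) ⟩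
      (y ℚ.* ι b) ℚ.* 1ℚ                    ≡⟨ ℚ.*-identityʳ (y ℚ.* ι b) ⟩
      y ℚ.* ι b                             ≤⟨ ≤CH y∈ 0≤y ⟩
      ι (C ℕ.* H)                   <⟨ ι-mono-< CH<H2C ⟩
      ι (H ℕ.* (2 ℕ.* C))           ≡⟨ ι-* (H) (2 ℕ.* C) ⟨
      ι (H) ℚ.* 2C                  ∎)
      where
      open ℚ.≤-Reasoning
      nonNeg : ℚ.NonNegative (y ℚ.* ι b)
      nonNeg = ℚ.nonNegative (subst (ℚ._≤ y ℚ.* ι b) (ℚ.*-zeroˡ (ι b))
        (ℚ.*-monoʳ-≤-nonNeg (ι b) {{ℚ.nonNegative (0≤ι b)}} 0≤y))
      CH<H2C : C ℕ.* H ℕ.< H ℕ.* (2 ℕ.* C)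
      CH<H2C = subst (C ℕ.* H ℕ.<_) (ring C (H))
        (ℕ.m<m+n (C ℕ.* H) (ℕ.*-mono-≤ (ℕ.>-nonZero⁻¹ C) 0<H))
        where
        ring : ∀ C H → C ℕ.* H ℕ.+ C ℕ.* H ≡ H ℕ.* (2 ℕ.* C)
        ring = ℕ.solve-∀

  gap-≤ᴿ : ∀ {l μ n m} (G : Gap C l μ n m) → n ℕ.< 2 ℕ.^ suc l → m ℕ.< 2 ℕ.^ suc μ → (0<lb : 0ℝ <ᴿ detlb (Gap.A G)) →
    fromℚ c *ᴿ √ (log₂ m *ᴿ log₂ n) ≤ᴿ (fromℕ (herdisc (Gap.A G)) /ᴿ detlb (Gap.A G)) 0<lb
  gap-≤ᴿ G n<2^l m<2^μ 0<lb (p , q<p , inj₁ refl) = p , q<p , inj₁ refl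
  gap-≤ᴿ {l} {μ} {n} {m} G n<2^l m<2^μ 0<lb (p , q<p , inj₂ (x , y , x∈c , y∈ , 0≤x , 0≤y , refl)) = p , q<p ,
    -- The divisor is b, an upper bound of `detlb A`, and the dividend x y b lies below the
    -- hereditary discrepancy.
    inj₂ (x ℚ.* y ℚ.* ι b , ι b ,
      <⇒∈fromℚ (<H (herdisc A) b l μ n m 0<b n<2^l m<2^μ gap (ℚ.<⇒≤ (∈fromℚ⇒< x∈c)) 0≤y y∈) ,
      ∉detlb A b det-bound , ℚ.≤-refl)
    where open Gap G

  gap-matrix : ∀ {l μ n m} → Gap C l μ n m → n ℕ.< 2 ℕ.^ suc l → m ℕ.< 2 ℕ.^ suc μ →
    Σ[ A ∈ Matrix m n ] (Is01 A × (Σ[ 0<lb ∈ 0ℝ <ᴿ detlb A ]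
      fromℚ c *ᴿ √ (log₂ m *ᴿ log₂ n) ≤ᴿ (fromℕ (herdisc A) /ᴿ detlb A) 0<lb))
  gap-matrix G n<2^l m<2^μ = A , is01 , 0<detlb A one∈A , gap-≤ᴿ G n<2^l m<2^μ (0<detlb A one∈A)
    where open Gap G

module _ (ε : ℝ) (Q : ℕ) (4≤Q : 4 ℕ.≤ suc Q)
  (log-bound : ∀ n m μ → 1 ℕ.≤ n → 2 ℕ.^ μ ℕ.≤ m → fromℕ m ≤ᴿ 2 ^ᴿ (n ^ᴿ (1ℝ -ᴿ ε)) →
               (μ ℕ.∸ 1) ℕ.^ suc Q ℕ.≤ n ℕ.^ Q) where

  open Final (2 ℕ.^ (9 ℕ.+ suc Q)) {{ℕ.m^n≢0 2 (9 ℕ.+ suc Q)}}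

  matrix-of-size : ∀ n m → 2 ℕ.≤ n → n ℕ.≤ m → fromℕ m ≤ᴿ 2 ^ᴿ (n ^ᴿ (1ℝ -ᴿ ε)) →
    Σ[ A ∈ Matrix m n ] (Is01 A × (Σ[ 0<lb ∈ 0ℝ <ᴿ detlb A ]
      fromℚ c *ᴿ √ (log₂ m *ᴿ log₂ n) ≤ᴿ (fromℕ (herdisc A) /ᴿ detlb A) 0<lb))
  matrix-of-size n m 2≤n n≤m m≤ =
    with-logs (log-floor n {{ℕ.>-nonZero 1≤n}}) (log-floor m {{ℕ.>-nonZero (ℕ.≤-trans 1≤n n≤m)}})
    where
    1≤n : 1 ℕ.≤ n
    1≤n = ℕ.≤-trans (s≤s z≤n) 2≤n
    with-logs : ∃[ l ] (2 ℕ.^ l ℕ.≤ n × n ℕ.< 2 ℕ.^ suc l) → ∃[ μ ] (2 ℕ.^ μ ℕ.≤ m × m ℕ.< 2 ℕ.^ suc μ) →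
      Σ[ A ∈ Matrix m n ] (Is01 A × (Σ[ 0<lb ∈ 0ℝ <ᴿ detlb A ]
        fromℚ c *ᴿ √ (log₂ m *ᴿ log₂ n) ≤ᴿ (fromℕ (herdisc A) /ᴿ detlb A) 0<lb))
    with-logs (l , 2^l≤n , n<2^l) (μ , 2^μ≤m , m<2^μ) = gap-matrix
      (gap-exists Q l μ n m 4≤Q 1≤n n≤m 2^l≤n n<2^l 2^μ≤m m<2^μ (log-bound n m μ 1≤n 2^μ≤m m≤))
      n<2^l m<2^μ

  gap-constant : Σ[ c ∈ ℝ ] (0ℝ <ᴿ c ×
    ((n m : ℕ) → 2 ℕ.≤ n → n ℕ.≤ m → fromℕ m ≤ᴿ 2 ^ᴿ (n ^ᴿ (1ℝ -ᴿ ε)) →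
      Σ[ A ∈ Matrix m n ] (Is01 A × (Σ[ 0<lb ∈ 0ℝ <ᴿ detlb A ]
        c *ᴿ √ (log₂ m *ᴿ log₂ n) ≤ᴿ (fromℕ (herdisc A) /ᴿ detlb A) 0<lb))))
  gap-constant = fromℚ c , 0<ᴿc , matrix-of-size

open import Data.Nat.Base using (_≤_)

theorem1 : (ε : ℝ) → 0ℝ <ᴿ ε → ε <ᴿ 1ℝ →
    Σ[ c ∈ ℝ ] (0ℝ <ᴿ c ×
    ((n m : ℕ) → 2 ≤ n → n ≤ m → fromℕ m ≤ᴿ 2 ^ᴿ (n ^ᴿ (1ℝ -ᴿ ε)) →
    Σ[ A ∈ Matrix m n ] (Is01 A ×
    (Σ[ 0<detlb ∈ 0ℝ <ᴿ detlb A ]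
    c *ᴿ √ (log₂ m *ᴿ log₂ n) ≤ᴿ (fromℕ (herdisc A) /ᴿ detlb A) 0<detlb))))
theorem1 ε (q , q∉0 , q∈ε) _ =
  -- The witness q of 0 < ε may itself be 0; a larger element δ of the cut is positive, and its
  -- denominator determines Q.
  let δ , q<δ , δ∈ε = rounded ε q∈ε
      0<δ = ℚ.≤-<-trans (ℚ.≮⇒≥ (λ q<0 → q∉0 (<⇒∈fromℚ q<0))) q<δ
  in gap-constant ε (3 ℕ.+ ↧ₙ δ) (ℕ.m≤m+n 4 (↧ₙ δ)) (log-bound ε 0<δ δ∈ε)
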